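{- There is an absolute constant $C>0$ such that for every $n\ge 3$ and every base graph $G$ on $n$ vertices there is an online algorithm $\mathcal{A}$ for online graph balancing with $T=n$ i.i.d. uniform arrivals from $E(G)$ satisfying $\mathcal{A}(G,n)\le C\log\log n\cdot\mathrm{OPT}(G,n)$.
   Context: Online graph balancing with i.i.d. arrivals: a base graph $G=(V,E)$ with $|V|=n$ and $E\neq\emptyset$ is known in advance. At each time step $t=1,\dots,T$ an edge $e_t$ is drawn independently and uniformly at random from $E$ (with replacement), and upon its arrival the algorithm must irrevocably orient $e_t$ towards one of its endpoints, using only $G$ and $e_1,\dots,e_t$. The load of a vertex is the number of arrived edges oriented into it. Let $G'$ be the sampled multigraph formed by $e_1,\dots,e_T$ and $M^*(G')$ the minimum over all orientations of the edges of $G'$ of the maximum load. $\mathrm{OPT}(G,T)=\mathbb{E}[M^*(G')]$ and $\mathcal{A}(G,T)$ is the expected maximum load produced by the online algorithm $\mathcal{A}$. -}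

module Defs where

open import Data.Nat using (ℕ; zero; suc; _+_; _*_; _⊔_; _⊓_)
open import Data.Nat.Logarithm using (⌈log₂_⌉)
open import Data.Bool using (Bool; true; false)
open import Data.Fin as Fin using (Fin)
open import Data.List using (List; []; _∷_; [_]; _++_; length; lookup; map; foldr; filter; concatMap; allFin)
open import Data.Nat.ListAction using (sum)
open import Data.List.Relation.Unary.All using (All)
open import Data.List.Relation.Unary.Unique.Propositional using (Unique)
open import Data.Product using (_×_; _,_; proj₁; proj₂)
open import Relation.Binary.PropositionalEquality using (_≢_)

-- A (simple) base graph on vertex set Fin n with E ≠ ∅.
-- Each edge {u,v} is stored once as (u , v) with u < v.
record Graph (n : ℕ) : Set where
  field
    edges    : List (Fin n × Fin n)
    simple   : All (λ e → proj₁ e Fin.< proj₂ e) edges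
    distinct : Unique edges
    nonempty : edges ≢ []
open Graph public

-- indices of edges of G (the sample space of a single arrival)
EdgeIx : ∀ {n} → Graph n → Set
EdgeIx G = Fin (length (edges G))

edge : ∀ {n} (G : Graph n) → EdgeIx G → Fin n × Fin n
edge G i = lookup (edges G) i

-- A deterministic online algorithm for G: given the previously arrived edges
-- e_1..e_{t-1} (in order) and the current edge e_t, decide the orientation of e_t
-- (true = towards first endpoint, false = towards second endpoint).
Algorithm : ∀ {n} → Graph n → Set
Algorithm G = List (EdgeIx G) → EdgeIx G → Bool

target : ∀ {n} → Bool → Fin n × Fin n → Fin n
target true  e = proj₁ e
target false e = proj₂ e

runAlg : ∀ {n} (G : Graph n) → Algorithm G → List (EdgeIx G) → List (EdgeIx G) → List (Fin n)
runAlg G A past []       = []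
runAlg G A past (e ∷ es) = target (A past e) (edge G e) ∷ runAlg G A (past ++ [ e ]) es

load : ∀ {n} → List (Fin n) → Fin n → ℕ
load hs v = length (filter (λ w → w Fin.≟ v) hs)

maxLoad : ∀ {n} → List (Fin n) → ℕ
maxLoad {n} hs = foldr _⊔_ 0 (map (load hs) (allFin n))

orientations : ∀ {n} → List (Fin n × Fin n) → List (List (Fin n))
orientations []       = [ [] ]
orientations (e ∷ es) =
  concatMap (λ r → (proj₁ e ∷ r) ∷ (proj₂ e ∷ r) ∷ []) (orientations es)

-- M*(G'): minimum over all orientations of the maximum load
-- (the max load never exceeds the number of edges, so starting the min there is harmless)
Mstar : ∀ {n} → List (Fin n × Fin n) → ℕ
Mstar es = foldr _⊓_ (length es) (map maxLoad (orientations es))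

-- all sequences of length k over Fin m (each equally likely: m^k of them)
seqs : (m k : ℕ) → List (List (Fin m))
seqs m zero    = [ [] ]
seqs m (suc k) = concatMap (λ s → map (_∷ s) (allFin m)) (seqs m k)

-- m^T · OPT(G,T)  (sum over all equally likely arrival sequences)
SumOPT : ∀ {n} → Graph n → ℕ → ℕ
SumOPT G T = sum (map (λ s → Mstar (map (edge G) s)) (seqs (length (edges G)) T))

-- m^T · A(G,T)
SumAlg : ∀ {n} (G : Graph n) → Algorithm G → ℕ → ℕ
SumAlg G A T = sum (map (λ s → maxLoad (runAlg G A [] s)) (seqs (length (edges G)) T))

-- integer surrogate for log log n, within constant factors of ln ln n for n ≥ 3
loglog : ℕ → ℕ
loglog n = 1 ⊔ ⌈log₂ ⌈log₂ n ⌉ ⌉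

{-# OPTIONS --safe #-}
module Submission where

-- Let M be the expected optimum, rounded up. Eliminate the vertices one at a time: from the remaining
-- set B remove a vertex that expects O(M) arrivals from B, and O(M) arrivals from those removed
-- vertices that themselves send at least 3M arrivals into B. It exists, for otherwise the second
-- moment method shows that B together with the latter vertices is typically denser than the optimum
-- allows. The head of an edge is its endpoint removed first. The edges at a head fall into
-- O(log log n) classes with doubly exponentially decreasing rates, an edge lying in a high class if
-- few edges of its head have tails removed at least as late. A head accepts an arrival unless it has
-- accepted O(M) arrivals of the same or higher classes; this costs O(M log log n). Rejected arrivals
-- go greedily to the endpoint with fewer rejected arrivals. Rejections are so unlikely that exploring
-- the graph of rejected edges is a subcritical process: by a union bound over explorations, outside
-- an event of probability 1/n every component has O(log n) heads. Within such a component, among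
-- the vertices of greedy load at least 2i times the optimum, raising i by one halves their number,
-- so the greedy load is O(log log n) times the optimum.

open import Defs
open import Data.Bool using (Bool; true; false; _∧_; _∨_; not; T; if_then_else_)
import Data.Bool.Properties as Bool
open import Data.Empty using (⊥; ⊥-elim)
open import Data.Fin as Fin using (Fin; zero; suc; toℕ; fromℕ<)
import Data.Fin.Properties as Fin
open import Data.List using (List; []; _∷_; [_]; _++_; length; map; foldr; foldl; concatMap; allFin)
open import Data.List.Membership.Propositional using (_∈_; _∉_; lose)
open import Data.List.Membership.Propositional.Properties using (∈-allFin; ∈-lookup; ∈-++⁺ˡ; ∈-++⁺ʳ; ∈-++⁻; ∈-map⁺; ∈-map⁻; ∈-concatMap⁺)
open import Data.List.Properties using (map-tabulate; length-tabulate; foldl-++)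
open import Data.List.Relation.Unary.All as All using (All; []; _∷_)
open import Data.List.Relation.Unary.Any using (here; there)
open import Data.Nat
open import Data.Nat.DivMod using (_/_; _%_; m≡m%n+[m/n]*n; m%n<n; m≥n⇒m/n>0; m/n*n≤m)
open import Data.Nat.Induction using (<-rec)
open import Data.Nat.ListAction using (sum)
open import Data.Nat.Logarithm using (⌈log₂_⌉; ⌈log₂⌉-mono-≤; ⌈log₂⌈n/2⌉⌉≡⌈log₂n⌉∸1)
open import Data.Nat.Properties
open import Data.Nat.Tactic.RingSolver using (solve-∀)
open import Data.Product using (Σ; ∃; _×_; _,_; proj₁; proj₂)
open import Data.Sum using (_⊎_; inj₁; inj₂; [_,_]′)
open import Data.Unit using (tt)
open import Function using (_∘_; id)
open import Relation.Binary.PropositionalEquality hiding ([_])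
open import Relation.Nullary using (¬_; Dec; yes; no; does; contradiction)
open import Relation.Nullary.Decidable using (_×-dec_; _⊎-dec_; ¬?; dec-true; decidable-stable)

-- Probabilities appear as counts over the `m ^ n` arrival sequences, with denominators cleared. The
-- obstacle lies at the tails. A head expects O(M) arrivals, but no degree bound holds for a vertex
-- as a tail, so rejected arrivals that meet in a tail can be controlled only through their
-- probabilities. The second removal condition does this: for each tail, the probabilities that the
-- heads of its edges are heavy, meaning that at least 3M arrivals join the head to vertices removed
-- no earlier than that tail, have a sum of order mM/n. If the edges in question expect about 12M/z
-- arrivals, heaviness has probability at least about z^(-3M), whereas filling a capacity of k with
-- them has probability at most about z^(-k). A capacity that is a large multiple of M therefore
-- makes rejection rarer than heaviness by a factor exponential in M, which beats the branching of
-- the exploration. Grouping the rates by towers 2^(2^j) loses only a square, so heaviness uses up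
-- 6M of the capacity instead of 3M, and O(log log n) classes reach down to a rate of order M/n.

private variable
  α β : Set

-- Finite sums and indicators

⟦_⟧ : Bool → ℕ
⟦ true ⟧ = 1
⟦ false ⟧ = 0

∑ : List α → (α → ℕ) → ℕ
∑ []       f = 0
∑ (x ∷ xs) f = f x + ∑ xs f

∑-sum : (xs : List α) (f : α → ℕ) → sum (map f xs) ≡ ∑ xs f
∑-sum []       f = refl
∑-sum (x ∷ xs) f = cong (f x +_) (∑-sum xs f)

∑-cong : (xs : List α) {f g : α → ℕ} → (∀ x → f x ≡ g x) → ∑ xs f ≡ ∑ xs g
∑-cong []       h = refl
∑-cong (x ∷ xs) h = cong₂ _+_ (h x) (∑-cong xs h)

∑-mono : (xs : List α) {f g : α → ℕ} → (∀ x → f x ≤ g x) → ∑ xs f ≤ ∑ xs g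
∑-mono []       h = z≤n
∑-mono (x ∷ xs) h = +-mono-≤ (h x) (∑-mono xs h)

∑-zero : (xs : List α) {f : α → ℕ} → (∀ x → f x ≡ 0) → ∑ xs f ≡ 0
∑-zero []       h = refl
∑-zero (x ∷ xs) h = cong₂ _+_ (h x) (∑-zero xs h)

+-interchange : ∀ a b c d → (a + b) + (c + d) ≡ (a + c) + (b + d)
+-interchange = solve-∀

∑-+ : (xs : List α) (f g : α → ℕ) → ∑ xs (λ x → f x + g x) ≡ ∑ xs f + ∑ xs g
∑-+ []       f g = refl
∑-+ (x ∷ xs) f g = trans (cong ((f x + g x) +_) (∑-+ xs f g)) (+-interchange (f x) (g x) (∑ xs f) (∑ xs g))

∑-*ˡ : (xs : List α) (c : ℕ) (f : α → ℕ) → ∑ xs (λ x → c * f x) ≡ c * ∑ xs f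
∑-*ˡ []       c f = sym (*-zeroʳ c)
∑-*ˡ (x ∷ xs) c f = trans (cong (c * f x +_) (∑-*ˡ xs c f)) (sym (*-distribˡ-+ c (f x) (∑ xs f)))

∑-*ʳ : (xs : List α) (f : α → ℕ) (c : ℕ) → ∑ xs (λ x → f x * c) ≡ ∑ xs f * c
∑-*ʳ []       f c = refl
∑-*ʳ (x ∷ xs) f c = trans (cong (f x * c +_) (∑-*ʳ xs f c)) (sym (*-distribʳ-+ c (f x) (∑ xs f)))

∑-const : (xs : List α) (c : ℕ) → ∑ xs (λ _ → c) ≡ length xs * c
∑-const []       c = refl
∑-const (x ∷ xs) c = cong (c +_) (∑-const xs c)

∑-swap : (xs : List α) (ys : List β) (f : α → β → ℕ) →
         ∑ xs (λ x → ∑ ys (f x)) ≡ ∑ ys (λ y → ∑ xs (λ x → f x y))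
∑-swap []       ys f = sym (∑-zero ys λ _ → refl)
∑-swap (x ∷ xs) ys f = trans (cong (∑ ys (f x) +_) (∑-swap xs ys f)) (sym (∑-+ ys (f x) _))

∑-++ : (xs ys : List α) (f : α → ℕ) → ∑ (xs ++ ys) f ≡ ∑ xs f + ∑ ys f
∑-++ []       ys f = refl
∑-++ (x ∷ xs) ys f = trans (cong (f x +_) (∑-++ xs ys f)) (sym (+-assoc (f x) _ _))

∑-map : (h : α → β) (xs : List α) (f : β → ℕ) → ∑ (map h xs) f ≡ ∑ xs (f ∘ h)
∑-map h []       f = refl
∑-map h (x ∷ xs) f = cong (f (h x) +_) (∑-map h xs f)

∑-concatMap : (h : α → List β) (xs : List α) (f : β → ℕ) →
              ∑ (concatMap h xs) f ≡ ∑ xs (λ x → ∑ (h x) f)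
∑-concatMap h []       f = refl
∑-concatMap h (x ∷ xs) f = trans (∑-++ (h x) (concatMap h xs) f) (cong (∑ (h x) f +_) (∑-concatMap h xs f))

∑-∈ : {xs : List α} {x : α} (f : α → ℕ) → x ∈ xs → f x ≤ ∑ xs f
∑-∈ f (here refl) = m≤m+n _ _
∑-∈ f (there p)   = ≤-trans (∑-∈ f p) (m≤n+m _ _)

∑-allFin-suc : ∀ {n} (f : Fin (suc n) → ℕ) → ∑ (allFin (suc n)) f ≡ f zero + ∑ (allFin n) (f ∘ suc)
∑-allFin-suc {n} f = cong (f zero +_)
  (trans (cong (λ l → ∑ l f) (sym (map-tabulate id suc))) (∑-map suc (allFin n) f))

∑-allFin-const : ∀ n c → ∑ (allFin n) (λ _ → c) ≡ n * c
∑-allFin-const n c = trans (∑-const (allFin n) c) (cong (_* c) (length-tabulate {n = n} id))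

∑-allFin-term : ∀ {n} (f : Fin n → ℕ) v → f v ≤ ∑ (allFin n) f
∑-allFin-term {suc n} f zero    = ≤-trans (m≤m+n _ _) (≤-reflexive (sym (∑-allFin-suc f)))
∑-allFin-term {suc n} f (suc v) =
  ≤-trans (∑-allFin-term (f ∘ suc) v) (≤-trans (m≤n+m _ _) (≤-reflexive (sym (∑-allFin-suc f))))

_==_ : ∀ {n} → Fin n → Fin n → Bool
x == y = does (x Fin.≟ y)

==⇒≡ : ∀ {n} (x y : Fin n) → (x == y) ≡ true → x ≡ y
==⇒≡ x y h with x Fin.≟ y
... | yes p = p
==⇒≡ x y () | no _

==-refl : ∀ {n} (x : Fin n) → (x == x) ≡ true
==-refl x with x Fin.≟ x
... | yes _ = refl
... | no ¬p = contradiction refl ¬p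

≢⇒== : ∀ {n} {x y : Fin n} → x ≢ y → (x == y) ≡ false
≢⇒== {x = x} {y} h with x Fin.≟ y
... | yes p = contradiction p h
... | no _  = refl

==-sym : ∀ {n} (v w : Fin n) → (v == w) ≡ (w == v)
==-sym v w with v Fin.≟ w
... | yes refl = sym (==-refl v)
... | no ¬p    = sym (≢⇒== (¬p ∘ sym))

==-suc : ∀ {n} (x y : Fin n) → (suc x == suc y) ≡ (x == y)
==-suc x y with x Fin.≟ y
... | yes p = refl
... | no _  = refl

∑-δ : ∀ {n} (w : Fin n) (f : Fin n → ℕ) → ∑ (allFin n) (λ v → ⟦ v == w ⟧ * f v) ≡ f w
∑-δ {suc n} zero f = begin
  ∑ (allFin (suc n)) (λ v → ⟦ v == zero ⟧ * f v)                  ≡⟨ ∑-allFin-suc (λ v → ⟦ v == zero ⟧ * f v) ⟩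
  (f zero + 0) + ∑ (allFin n) (λ _ → 0)                            ≡⟨ cong₂ _+_ (+-identityʳ _) (∑-zero (allFin n) λ _ → refl) ⟩
  f zero + 0                                                       ≡⟨ +-identityʳ _ ⟩
  f zero ∎
  where open ≡-Reasoning
∑-δ {suc n} (suc w) f = begin
  ∑ (allFin (suc n)) (λ v → ⟦ v == suc w ⟧ * f v)                 ≡⟨ ∑-allFin-suc (λ v → ⟦ v == suc w ⟧ * f v) ⟩
  ∑ (allFin n) (λ v → ⟦ suc v == suc w ⟧ * f (suc v))             ≡⟨ ∑-cong (allFin n) (λ v → cong (λ b → ⟦ b ⟧ * f (suc v)) (==-suc v w)) ⟩
  ∑ (allFin n) (λ v → ⟦ v == w ⟧ * f (suc v))                     ≡⟨ ∑-δ w (f ∘ suc) ⟩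
  f (suc w) ∎
  where open ≡-Reasoning

∑-δ₁ : ∀ {n} (w : Fin n) → ∑ (allFin n) (λ v → ⟦ v == w ⟧) ≡ 1
∑-δ₁ {n} w = trans (∑-cong (allFin n) (λ v → sym (*-identityʳ ⟦ v == w ⟧))) (∑-δ w (λ _ → 1))

⟦∧⟧ : ∀ a b → ⟦ a ∧ b ⟧ ≡ ⟦ a ⟧ * ⟦ b ⟧
⟦∧⟧ true  b = sym (+-identityʳ _)
⟦∧⟧ false b = refl

⟦⟧≤1 : ∀ a → ⟦ a ⟧ ≤ 1
⟦⟧≤1 true  = ≤-refl
⟦⟧≤1 false = z≤n

⟦⟧-mono : ∀ {a b} → (a ≡ true → b ≡ true) → ⟦ a ⟧ ≤ ⟦ b ⟧
⟦⟧-mono {true}  h rewrite h refl = ≤-refl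
⟦⟧-mono {false} h = z≤n

⟦⟧+⟦not⟧ : ∀ a → ⟦ a ⟧ + ⟦ not a ⟧ ≡ 1
⟦⟧+⟦not⟧ true  = refl
⟦⟧+⟦not⟧ false = refl

⟦⟧*-mono : ∀ a {x y} → (a ≡ true → x ≤ y) → ⟦ a ⟧ * x ≤ ⟦ a ⟧ * y
⟦⟧*-mono true  h = *-monoʳ-≤ 1 (h refl)
⟦⟧*-mono false h = z≤n

⟦⟧*-≤ : ∀ a {x y} → (a ≡ true → x ≤ y) → ⟦ a ⟧ * x ≤ y
⟦⟧*-≤ true  h = ≤-trans (≤-reflexive (+-identityʳ _)) (h refl)
⟦⟧*-≤ false h = z≤n

∧-split : ∀ {a b} → (a ∧ b) ≡ true → a ≡ true × b ≡ true
∧-split {true} h = refl , h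

∨-split : ∀ {a b} → (a ∨ b) ≡ true → a ≡ true ⊎ b ≡ true
∨-split {true}  h = inj₁ refl
∨-split {false} h = inj₂ h

∧-intro : ∀ {a b} → a ≡ true → b ≡ true → (a ∧ b) ≡ true
∧-intro refl refl = refl

T⇒≡ : ∀ {b} → T b → b ≡ true
T⇒≡ {true} _ = refl

≡⇒T : ∀ {b} → b ≡ true → T b
≡⇒T refl = tt

true≢false : ∀ {b} → b ≡ true → b ≡ false → ⊥
true≢false refl ()

≤ᵇ-true : ∀ {a b} → a ≤ b → (a ≤ᵇ b) ≡ true
≤ᵇ-true p = T⇒≡ (≤⇒≤ᵇ p)

≤ᵇ-sound : ∀ {a b} → (a ≤ᵇ b) ≡ true → a ≤ b
≤ᵇ-sound {a} {b} p = ≤ᵇ⇒≤ a b (≡⇒T p)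

≤ᵇ-false : ∀ {a b} → b < a → (a ≤ᵇ b) ≡ false
≤ᵇ-false {a} {b} p with a ≤ᵇ b in eq
... | false = refl
... | true  = contradiction (≤ᵇ-sound eq) (<⇒≱ p)

≤ᵇ-refute : ∀ {a b} → (a ≤ᵇ b) ≡ false → b < a
≤ᵇ-refute {a} {b} p = ≰⇒> λ q → true≢false (≤ᵇ-true q) p

suc≤ᵇsuc : ∀ a b → (suc a ≤ᵇ suc b) ≡ (a ≤ᵇ b)
suc≤ᵇsuc zero    b = refl
suc≤ᵇsuc (suc a) b = refl

-- Products, and sums over arrival sequences

∏ : List α → (α → ℕ) → ℕ
∏ []       f = 1
∏ (x ∷ xs) f = f x * ∏ xs f

∏-mono : (xs : List α) {f g : α → ℕ} → (∀ x → f x ≤ g x) → ∏ xs f ≤ ∏ xs g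
∏-mono []       h = ≤-refl
∏-mono (x ∷ xs) h = *-mono-≤ (h x) (∏-mono xs h)

∏-≥1 : (xs : List α) {f : α → ℕ} → (∀ x → 1 ≤ f x) → 1 ≤ ∏ xs f
∏-≥1 []       h = ≤-refl
∏-≥1 (x ∷ xs) h = *-mono-≤ (h x) (∏-≥1 xs h)

∑-seqs-suc : ∀ m k (f : List (Fin m) → ℕ) →
             ∑ (seqs m (suc k)) f ≡ ∑ (seqs m k) (λ s → ∑ (allFin m) (λ i → f (i ∷ s)))
∑-seqs-suc m k f = trans (∑-concatMap (λ s → map (_∷ s) (allFin m)) (seqs m k) f)
  (∑-cong (seqs m k) λ s → ∑-map (_∷ s) (allFin m) f)

∑-seqs-mono : ∀ m k {f g : List (Fin m) → ℕ} →
              (∀ s → length s ≡ k → f s ≤ g s) → ∑ (seqs m k) f ≤ ∑ (seqs m k) g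
∑-seqs-mono m zero h = +-monoˡ-≤ 0 (h [] refl)
∑-seqs-mono m (suc k) {f} {g} h = begin
  ∑ (seqs m (suc k)) f                                   ≡⟨ ∑-seqs-suc m k f ⟩
  ∑ (seqs m k) (λ s → ∑ (allFin m) (λ i → f (i ∷ s)))   ≤⟨ ∑-seqs-mono m k (λ s l → ∑-mono (allFin m) (λ i → h (i ∷ s) (cong suc l))) ⟩
  ∑ (seqs m k) (λ s → ∑ (allFin m) (λ i → g (i ∷ s)))   ≡⟨ ∑-seqs-suc m k g ⟨
  ∑ (seqs m (suc k)) g                                   ∎
  where open ≤-Reasoning

-- Independence of the arrivals: the expectation of a product of weights, one per arrival,
-- factorises. The exponential-moment bound for explorations rests on this.
∑-seqs-∏ : ∀ m k (g : Fin m → ℕ) → ∑ (seqs m k) (λ s → ∏ s g) ≡ ∑ (allFin m) g ^ k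
∑-seqs-∏ m zero    g = refl
∑-seqs-∏ m (suc k) g = begin
  ∑ (seqs m (suc k)) (λ s → ∏ s g)                            ≡⟨ ∑-seqs-suc m k (λ s → ∏ s g) ⟩
  ∑ (seqs m k) (λ s → ∑ (allFin m) (λ i → g i * ∏ s g))       ≡⟨ ∑-cong (seqs m k) (λ s → ∑-*ʳ (allFin m) g (∏ s g)) ⟩
  ∑ (seqs m k) (λ s → ∑ (allFin m) g * ∏ s g)                 ≡⟨ ∑-*ˡ (seqs m k) (∑ (allFin m) g) (λ s → ∏ s g) ⟩
  ∑ (allFin m) g * ∑ (seqs m k) (λ s → ∏ s g)                 ≡⟨ cong (∑ (allFin m) g *_) (∑-seqs-∏ m k g) ⟩
  ∑ (allFin m) g ^ suc k                                       ∎
  where open ≡-Reasoning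

∑-seqs-const : ∀ m k c → ∑ (seqs m k) (λ _ → c) ≡ m ^ k * c
∑-seqs-const m zero    c = refl
∑-seqs-const m (suc k) c = begin
  ∑ (seqs m (suc k)) (λ _ → c)                    ≡⟨ ∑-seqs-suc m k (λ _ → c) ⟩
  ∑ (seqs m k) (λ s → ∑ (allFin m) (λ i → c))     ≡⟨ ∑-cong (seqs m k) (λ s → ∑-allFin-const m c) ⟩
  ∑ (seqs m k) (λ s → m * c)                      ≡⟨ ∑-seqs-const m k (m * c) ⟩
  m ^ k * (m * c)                                 ≡⟨ ring (m ^ k) m c ⟩
  m * m ^ k * c                                   ∎
  where open ≡-Reasoning
        ring : ∀ p m c → p * (m * c) ≡ m * p * c
        ring = solve-∀

-- Linearity of expectation; the factor `m` on the left avoids a division.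
∑-seqs-∑ : ∀ m k (f : Fin m → ℕ) → m * ∑ (seqs m k) (λ s → ∑ s f) ≡ k * m ^ k * ∑ (allFin m) f
∑-seqs-∑ m zero    f = *-zeroʳ m
∑-seqs-∑ m (suc k) f = begin
  m * ∑ (seqs m (suc k)) (λ s → ∑ s f)
    ≡⟨ cong (m *_) (∑-seqs-suc m k (λ s → ∑ s f)) ⟩
  m * ∑ (seqs m k) (λ s → ∑ (allFin m) (λ i → f i + ∑ s f))
    ≡⟨ cong (m *_) (∑-cong (seqs m k) (λ s → trans (∑-+ (allFin m) f (λ _ → ∑ s f)) (cong (F +_) (∑-allFin-const m (∑ s f))))) ⟩
  m * ∑ (seqs m k) (λ s → F + m * ∑ s f)
    ≡⟨ cong (m *_) (trans (∑-+ (seqs m k) (λ _ → F) (λ s → m * ∑ s f)) (cong₂ _+_ (∑-seqs-const m k F) (∑-*ˡ (seqs m k) m (λ s → ∑ s f)))) ⟩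
  m * (m ^ k * F + m * ∑ (seqs m k) (λ s → ∑ s f))
    ≡⟨ cong (λ z → m * (m ^ k * F + z)) (∑-seqs-∑ m k f) ⟩
  m * (m ^ k * F + k * m ^ k * F)
    ≡⟨ ring m (m ^ k) F k ⟩
  suc k * (m * m ^ k) * F ∎
  where open ≡-Reasoning
        F = ∑ (allFin m) f
        ring : ∀ m p F k → m * (p * F + k * p * F) ≡ suc k * (m * p) * F
        ring = solve-∀

-- Binomial tails

tailCount : ∀ m T i (p : Fin m → Bool) → ℕ
tailCount m T i p = ∑ (seqs m T) λ s → ⟦ i ≤ᵇ ∑ s (λ a → ⟦ p a ⟧) ⟧

-- The tail of a binomial distribution with success probability d/(d+d′), scaled by (d+d′)^T and
-- computed by conditioning on one trial. It depends on an event only through its number of edges.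
binTail : (d d′ T i : ℕ) → ℕ
binTail d d′ zero    zero    = 1
binTail d d′ zero    (suc i) = 0
binTail d d′ (suc T) zero    = (d + d′) * binTail d d′ T zero
binTail d d′ (suc T) (suc i) = d * binTail d d′ T i + d′ * binTail d d′ T (suc i)

≤ᵇ-step : ∀ i b x → ⟦ suc i ≤ᵇ ⟦ b ⟧ + x ⟧ ≡ ⟦ b ⟧ * ⟦ i ≤ᵇ x ⟧ + ⟦ not b ⟧ * ⟦ suc i ≤ᵇ x ⟧
≤ᵇ-step i true  x = trans (cong ⟦_⟧ (suc≤ᵇsuc i x)) (sym (trans (+-identityʳ _) (+-identityʳ _)))
≤ᵇ-step i false x = sym (+-identityʳ _)

∑-allFin-split : ∀ m (p : Fin m → Bool) x y →
  ∑ (allFin m) (λ a → ⟦ p a ⟧ * x + ⟦ not (p a) ⟧ * y) ≡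
  ∑ (allFin m) (λ a → ⟦ p a ⟧) * x + ∑ (allFin m) (λ a → ⟦ not (p a) ⟧) * y
∑-allFin-split m p x y = trans (∑-+ (allFin m) _ _) (cong₂ _+_ (∑-*ʳ (allFin m) _ x) (∑-*ʳ (allFin m) _ y))

∑-⟦⟧+∑-⟦not⟧ : ∀ m (p : Fin m → Bool) →
  ∑ (allFin m) (λ a → ⟦ p a ⟧) + ∑ (allFin m) (λ a → ⟦ not (p a) ⟧) ≡ m
∑-⟦⟧+∑-⟦not⟧ m p = trans (sym (∑-+ (allFin m) _ _))
  (trans (∑-cong (allFin m) (λ a → ⟦⟧+⟦not⟧ (p a))) (trans (∑-allFin-const m 1) (*-identityʳ m)))

binTail-zero : ∀ d d′ T → binTail d d′ T 0 ≡ (d + d′) ^ T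
binTail-zero d d′ zero    = refl
binTail-zero d d′ (suc T) = cong ((d + d′) *_) (binTail-zero d d′ T)

tailCount-zero : ∀ m T p → tailCount m T 0 p ≡ m ^ T
tailCount-zero m T p = trans (∑-seqs-const m T 1) (*-identityʳ _)

tailCount≡binTail : ∀ m T i (p : Fin m → Bool) →
  tailCount m T i p ≡ binTail (∑ (allFin m) (λ a → ⟦ p a ⟧)) (∑ (allFin m) (λ a → ⟦ not (p a) ⟧)) T i
tailCount≡binTail m T       zero    p = trans (tailCount-zero m T p)
  (trans (cong (_^ T) (sym (∑-⟦⟧+∑-⟦not⟧ m p))) (sym (binTail-zero _ _ T)))
tailCount≡binTail m zero    (suc i) p = refl
tailCount≡binTail m (suc T) (suc i) p = begin
  tailCount m (suc T) (suc i) p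
    ≡⟨ ∑-seqs-suc m T _ ⟩
  ∑ (seqs m T) (λ s → ∑ (allFin m) (λ a → ⟦ suc i ≤ᵇ ⟦ p a ⟧ + X s ⟧))
    ≡⟨ ∑-cong (seqs m T) (λ s → trans (∑-cong (allFin m) (λ a → ≤ᵇ-step i (p a) (X s)))
                                       (∑-allFin-split m p _ _)) ⟩
  ∑ (seqs m T) (λ s → d * ⟦ i ≤ᵇ X s ⟧ + d′ * ⟦ suc i ≤ᵇ X s ⟧)
    ≡⟨ trans (∑-+ (seqs m T) _ _) (cong₂ _+_ (∑-*ˡ (seqs m T) d _) (∑-*ˡ (seqs m T) d′ _)) ⟩
  d * tailCount m T i p + d′ * tailCount m T (suc i) p
    ≡⟨ cong₂ (λ x y → d * x + d′ * y) (tailCount≡binTail m T i p) (tailCount≡binTail m T (suc i) p) ⟩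
  d * binTail d d′ T i + d′ * binTail d d′ T (suc i) ∎
  where open ≡-Reasoning
        X = λ s → ∑ s (λ a → ⟦ p a ⟧)
        d = ∑ (allFin m) (λ a → ⟦ p a ⟧)
        d′ = ∑ (allFin m) (λ a → ⟦ not (p a) ⟧)

binTail-antitone : ∀ d d′ T i → binTail d d′ T (suc i) ≤ binTail d d′ T i
binTail-antitone d d′ zero    i       = z≤n
binTail-antitone d d′ (suc T) zero    = ≤-trans
  (+-monoʳ-≤ (d * binTail d d′ T 0) (*-monoʳ-≤ d′ (binTail-antitone d d′ T 0)))
  (≤-reflexive (sym (*-distribʳ-+ (binTail d d′ T 0) d d′)))
binTail-antitone d d′ (suc T) (suc i) =
  +-mono-≤ (*-monoʳ-≤ d (binTail-antitone d d′ T i)) (*-monoʳ-≤ d′ (binTail-antitone d d′ T (suc i)))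

-- Negative correlation of two tails

module _ (m : ℕ) (p q : Fin m → Bool) (disjoint : ∀ a → p a ≡ true → q a ≡ false) where
  private
    X Y : List (Fin m) → ℕ
    X s = ∑ s (λ a → ⟦ p a ⟧)
    Y s = ∑ s (λ a → ⟦ q a ⟧)
    joint : ℕ → ℕ → ℕ → ℕ
    joint T i j = ∑ (seqs m T) λ s → ⟦ i ≤ᵇ X s ⟧ * ⟦ j ≤ᵇ Y s ⟧
    r : Fin m → Bool
    r a = not (p a ∨ q a)
    d e t : ℕ
    d = ∑ (allFin m) (λ a → ⟦ p a ⟧)
    e = ∑ (allFin m) (λ a → ⟦ q a ⟧)
    t = ∑ (allFin m) (λ a → ⟦ r a ⟧)

    not-p : ∑ (allFin m) (λ a → ⟦ not (p a) ⟧) ≡ e + t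
    not-p = trans (∑-cong (allFin m) λ a → pt (p a) (q a) (disjoint a)) (∑-+ (allFin m) _ _)
      where pt : ∀ x y → (x ≡ true → y ≡ false) → ⟦ not x ⟧ ≡ ⟦ y ⟧ + ⟦ not (x ∨ y) ⟧
            pt true  y h rewrite h refl = refl
            pt false true  h = refl
            pt false false h = refl
    not-q : ∑ (allFin m) (λ a → ⟦ not (q a) ⟧) ≡ d + t
    not-q = trans (∑-cong (allFin m) λ a → pt (p a) (q a) (disjoint a)) (∑-+ (allFin m) _ _)
      where pt : ∀ x y → (x ≡ true → y ≡ false) → ⟦ not y ⟧ ≡ ⟦ x ⟧ + ⟦ not (x ∨ y) ⟧
            pt true  y h rewrite h refl = refl
            pt false true  h = refl
            pt false false h = refl

    joint-step : ∀ T i j → joint (suc T) (suc i) (suc j) ≡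
      d * joint T i (suc j) + e * joint T (suc i) j + t * joint T (suc i) (suc j)
    joint-step T i j = begin
      joint (suc T) (suc i) (suc j)
        ≡⟨ ∑-seqs-suc m T _ ⟩
      ∑ (seqs m T) (λ s → ∑ (allFin m) (λ a → ⟦ suc i ≤ᵇ ⟦ p a ⟧ + X s ⟧ * ⟦ suc j ≤ᵇ ⟦ q a ⟧ + Y s ⟧))
        ≡⟨ ∑-cong (seqs m T) (λ s → trans (∑-cong (allFin m) (λ a → pt s a))
             (trans (∑-+ (allFin m) _ _) (cong₂ _+_ (trans (∑-+ (allFin m) _ _)
               (cong₂ _+_ (∑-*ʳ (allFin m) _ _) (∑-*ʳ (allFin m) _ _))) (∑-*ʳ (allFin m) _ _)))) ⟩
      ∑ (seqs m T) (λ s → d * F s + e * G s + t * H s)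
        ≡⟨ trans (∑-+ (seqs m T) _ _) (cong₂ _+_ (trans (∑-+ (seqs m T) _ _)
               (cong₂ _+_ (∑-*ˡ (seqs m T) d F) (∑-*ˡ (seqs m T) e G))) (∑-*ˡ (seqs m T) t H)) ⟩
      d * joint T i (suc j) + e * joint T (suc i) j + t * joint T (suc i) (suc j) ∎
      where
      open ≡-Reasoning
      F G H : List (Fin m) → ℕ
      F s = ⟦ i ≤ᵇ X s ⟧ * ⟦ suc j ≤ᵇ Y s ⟧
      G s = ⟦ suc i ≤ᵇ X s ⟧ * ⟦ j ≤ᵇ Y s ⟧
      H s = ⟦ suc i ≤ᵇ X s ⟧ * ⟦ suc j ≤ᵇ Y s ⟧
      alg : ∀ x y b b′ c c′ → (x ≡ true → y ≡ false) →
            (⟦ x ⟧ * b + ⟦ not x ⟧ * b′) * (⟦ y ⟧ * c + ⟦ not y ⟧ * c′) ≡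
            ⟦ x ⟧ * (b * c′) + ⟦ y ⟧ * (b′ * c) + ⟦ not (x ∨ y) ⟧ * (b′ * c′)
      alg true  y b b′ c c′ h rewrite h refl = f b c′
        where f : ∀ b c′ → (b + 0 + 0) * (c′ + 0) ≡ b * c′ + 0 + 0 + 0
              f = solve-∀
      alg false true b b′ c c′ h = f b′ c
        where f : ∀ b c → (b + 0) * (c + 0 + 0) ≡ b * c + 0 + 0
              f = solve-∀
      alg false false b b′ c c′ h = f b′ c′
        where f : ∀ b c → (b + 0) * (c + 0) ≡ b * c + 0
              f = solve-∀
      pt : ∀ s a → ⟦ suc i ≤ᵇ ⟦ p a ⟧ + X s ⟧ * ⟦ suc j ≤ᵇ ⟦ q a ⟧ + Y s ⟧ ≡
                   ⟦ p a ⟧ * F s + ⟦ q a ⟧ * G s + ⟦ r a ⟧ * H s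
      pt s a = trans (cong₂ _*_ (≤ᵇ-step i (p a) (X s)) (≤ᵇ-step j (q a) (Y s)))
        (alg (p a) (q a) _ _ _ _ (disjoint a))

    B C : ℕ → ℕ → ℕ
    B = binTail d (e + t)
    C = binTail e (d + t)

    d+e+t≡m : d + (e + t) ≡ m
    d+e+t≡m = trans (cong (d +_) (sym not-p)) (∑-⟦⟧+∑-⟦not⟧ m p)

    e+d+t≡m : e + (d + t) ≡ m
    e+d+t≡m = trans (cong (e +_) (sym not-q)) (∑-⟦⟧+∑-⟦not⟧ m q)

    -- With β and γ the drops of the two tails between consecutive thresholds, the product of the
    -- two separate recursions exceeds the joint recursion by exactly `d * e * β * γ`. This is the
    -- whole induction step.
    poly : ∀ d e t B β C γ →
      (d + (e + t)) * (d * ((B + β) * C) + e * (B * (C + γ)) + t * (B * C)) + d * e * β * γ ≡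
      (d * (B + β) + (e + t) * B) * (e * (C + γ) + (d + t) * C)
    poly = solve-∀

    poly-≤ : ∀ {b b₁ c c₁} → b₁ ≤ b → c₁ ≤ c →
      (d + (e + t)) * (d * (b * c₁) + e * (b₁ * c) + t * (b₁ * c₁)) ≤
      (d * b + (e + t) * b₁) * (e * c + (d + t) * c₁)
    poly-≤ {b} {b₁} {c} {c₁} p q with m≤n⇒∃[o]m+o≡n p | m≤n⇒∃[o]m+o≡n q
    ... | β , refl | γ , refl = ≤-trans (m≤m+n _ (d * e * β * γ)) (≤-reflexive (poly d e t b₁ β c₁ γ))

    neg : ∀ T i j → m ^ T * joint T i j ≤ B T i * C T j
    neg T zero j = ≤-reflexive (cong₂ _*_
      (trans (cong (_^ T) (sym d+e+t≡m)) (sym (binTail-zero d (e + t) T)))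
      (trans (∑-cong (seqs m T) (λ s → +-identityʳ _))
        (trans (tailCount≡binTail m T j q) (cong (λ z → binTail e z T j) not-q))))
    neg T (suc i) zero = ≤-reflexive (trans (*-comm (m ^ T) _) (cong₂ _*_
      (trans (∑-cong (seqs m T) (λ s → *-identityʳ _))
        (trans (tailCount≡binTail m T (suc i) p) (cong (λ z → binTail d z T (suc i)) not-p)))
      (trans (cong (_^ T) (sym e+d+t≡m)) (sym (binTail-zero e (d + t) T)))))
    neg zero (suc i) (suc j) = z≤n
    neg (suc T) (suc i) (suc j) = begin
      m * m ^ T * joint (suc T) (suc i) (suc j)
        ≡⟨ cong (m * m ^ T *_) (joint-step T i j) ⟩
      m * m ^ T * (d * J₁ + e * J₂ + t * J₃)
        ≡⟨ distr m (m ^ T) d e t J₁ J₂ J₃ ⟩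
      m * (d * (m ^ T * J₁) + e * (m ^ T * J₂) + t * (m ^ T * J₃))
        ≤⟨ *-monoʳ-≤ m (+-mono-≤ (+-mono-≤ (*-monoʳ-≤ d (neg T i (suc j))) (*-monoʳ-≤ e (neg T (suc i) j)))
             (*-monoʳ-≤ t (neg T (suc i) (suc j)))) ⟩
      m * (d * (B T i * C T (suc j)) + e * (B T (suc i) * C T j) + t * (B T (suc i) * C T (suc j)))
        ≡⟨ cong (_* (d * (B T i * C T (suc j)) + e * (B T (suc i) * C T j) + t * (B T (suc i) * C T (suc j)))) (sym d+e+t≡m) ⟩
      (d + (e + t)) * (d * (B T i * C T (suc j)) + e * (B T (suc i) * C T j) + t * (B T (suc i) * C T (suc j)))
        ≤⟨ poly-≤ (binTail-antitone d (e + t) T i) (binTail-antitone e (d + t) T j) ⟩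
      B (suc T) (suc i) * C (suc T) (suc j) ∎
      where
      open ≤-Reasoning
      J₁ = joint T i (suc j)
      J₂ = joint T (suc i) j
      J₃ = joint T (suc i) (suc j)
      distr : ∀ m P d e t x y z → m * P * (d * x + e * y + t * z) ≡ m * (d * (P * x) + e * (P * y) + t * (P * z))
      distr = solve-∀

  -- Induction on `T` by conditioning on one arrival, which can raise at most one of the two counts.
  tails-negatively-correlated : ∀ T i j →
    m ^ T * ∑ (seqs m T) (λ s → ⟦ i ≤ᵇ ∑ s (λ a → ⟦ p a ⟧) ⟧ * ⟦ j ≤ᵇ ∑ s (λ a → ⟦ q a ⟧) ⟧)
    ≤ tailCount m T i p * tailCount m T j q
  tails-negatively-correlated T i j = ≤-trans (neg T i j) (≤-reflexive (cong₂ _*_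
    (sym (trans (tailCount≡binTail m T i p) (cong (λ z → binTail d z T i) not-p)))
    (sym (trans (tailCount≡binTail m T j q) (cong (λ z → binTail e z T j) not-q)))))

-- Lower bounds for binomial tails

module _ (d d′ : ℕ) where
  private
    b : ℕ → ℕ → ℕ
    b = binTail d d′
    m = d + d′

  binTail-suc : ∀ T j → m * b T j ≤ b (suc T) j
  binTail-suc T zero    = ≤-refl
  binTail-suc T (suc j) = ≤-trans (≤-reflexive (*-distribʳ-+ (b T (suc j)) d d′))
    (+-monoˡ-≤ _ (*-monoʳ-≤ d (binTail-antitone d d′ T j)))

  -- Successes in two consecutive independent blocks of trials add up.
  binTail-+ : ∀ T₁ T₂ i j → b T₁ i * b T₂ j ≤ b (T₁ + T₂) (i + j)
  binTail-+ zero     T₂ zero    j = ≤-reflexive (+-identityʳ _)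
  binTail-+ zero     T₂ (suc i) j = z≤n
  binTail-+ (suc T₁) T₂ zero    j = begin
    m * b T₁ 0 * b T₂ j    ≡⟨ *-assoc m _ _ ⟩
    m * (b T₁ 0 * b T₂ j)  ≤⟨ *-monoʳ-≤ m (binTail-+ T₁ T₂ 0 j) ⟩
    m * b (T₁ + T₂) j      ≤⟨ binTail-suc (T₁ + T₂) j ⟩
    b (suc (T₁ + T₂)) j    ∎
    where open ≤-Reasoning
  binTail-+ (suc T₁) T₂ (suc i) j = begin
    (d * b T₁ i + d′ * b T₁ (suc i)) * b T₂ j                 ≡⟨ ring d d′ (b T₁ i) (b T₁ (suc i)) (b T₂ j) ⟩
    d * (b T₁ i * b T₂ j) + d′ * (b T₁ (suc i) * b T₂ j)
      ≤⟨ +-mono-≤ (*-monoʳ-≤ d (binTail-+ T₁ T₂ i j)) (*-monoʳ-≤ d′ (binTail-+ T₁ T₂ (suc i) j)) ⟩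
    b (suc (T₁ + T₂)) (suc (i + j)) ∎
    where open ≤-Reasoning
          ring : ∀ d d′ x y z → (d * x + d′ * y) * z ≡ d * (x * z) + d′ * (y * z)
          ring = solve-∀

  binTail-one : ∀ k → b k 1 + d′ ^ k ≡ m ^ k
  binTail-one zero    = refl
  binTail-one (suc k) = begin
    d * b k 0 + d′ * b k 1 + d′ * d′ ^ k   ≡⟨ ring d d′ (b k 0) (b k 1) (d′ ^ k) ⟩
    d * b k 0 + d′ * (b k 1 + d′ ^ k)      ≡⟨ cong₂ (λ x y → d * x + d′ * y) (binTail-zero d d′ k) (binTail-one k) ⟩
    d * m ^ k + d′ * m ^ k                 ≡⟨ *-distribʳ-+ (m ^ k) d d′ ⟨
    m * m ^ k                              ∎
    where open ≡-Reasoning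
          ring : ∀ d d′ x y z → d * x + d′ * y + d′ * z ≡ d * x + d′ * (y + z)
          ring = solve-∀

  -- Bernoulli's inequality with denominators cleared: `k` trials all fail with probability at most
  -- 1/(1+x), where x = kd/m.
  bernoulli : ∀ k → d′ ^ k * (m + k * d) ≤ m ^ k * m
  bernoulli zero    = ≤-reflexive (cong (_+ 0) (+-identityʳ m))
  bernoulli (suc k) = begin
    d′ * d′ ^ k * (m + (d + k * d))              ≤⟨ m≤m+n _ (d′ ^ k * (d * (d + k * d))) ⟩
    d′ * d′ ^ k * (m + (d + k * d)) + d′ ^ k * (d * (d + k * d)) ≡⟨ ring d d′ (d′ ^ k) (k * d) ⟩
    m * (d′ ^ k * (m + k * d))                   ≤⟨ *-monoʳ-≤ m (bernoulli k) ⟩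
    m * (m ^ k * m)                              ≡⟨ *-assoc m _ m ⟨
    m * m ^ k * m                                ∎
    where open ≤-Reasoning
          ring : ∀ d d′ p x → d′ * p * (d + d′ + (d + x)) + p * (d * (d + x)) ≡ (d + d′) * (p * (d + d′ + x))
          ring = solve-∀

  -- By `bernoulli` some trial succeeds with probability at least x/(1+x), x = kd/m; the hypothesis
  -- says that this is at least 1/Z.
  binTail-one-lower : ∀ k Z → 0 < k * d → m + k * d ≤ Z * (k * d) → m ^ k ≤ Z * b k 1
  binTail-one-lower k Z pos h = *-cancelʳ-≤ (m ^ k) (Z * b k 1) x {{>-nonZero pos}} (begin
    m ^ k * x                ≡⟨ cong (_* x) (binTail-one k) ⟨
    (b k 1 + D) * x          ≡⟨ *-distribʳ-+ x (b k 1) D ⟩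
    b k 1 * x + D * x        ≤⟨ +-monoʳ-≤ (b k 1 * x) Dx≤ ⟩
    b k 1 * x + b k 1 * m    ≡⟨ ring (b k 1) x m ⟩
    b k 1 * (m + x)          ≤⟨ *-monoʳ-≤ (b k 1) h ⟩
    b k 1 * (Z * x)          ≡⟨ ring₂ (b k 1) Z x ⟩
    Z * b k 1 * x            ∎)
    where
    open ≤-Reasoning
    x = k * d
    D = d′ ^ k
    ring : ∀ b x m → b * x + b * m ≡ b * (m + x)
    ring = solve-∀
    ring₂ : ∀ b Z x → b * (Z * x) ≡ Z * b * x
    ring₂ = solve-∀
    Dx≤ : D * x ≤ b k 1 * m
    Dx≤ = +-cancelˡ-≤ (D * m) _ _ (begin
      D * m + D * x        ≡⟨ *-distribˡ-+ D m x ⟨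
      D * (m + x)          ≤⟨ bernoulli k ⟩
      m ^ k * m            ≡⟨ cong (_* m) (binTail-one k) ⟨
      (b k 1 + D) * m      ≡⟨ *-distribʳ-+ m (b k 1) D ⟩
      b k 1 * m + D * m    ≡⟨ +-comm _ (D * m) ⟩
      D * m + b k 1 * m    ∎)

  -- It is enough that each of `ℓ` disjoint blocks of `k` trials contains a success; the `r` trials
  -- left over cannot hurt.
  binTail-lower : ∀ k r ℓ Z → 0 < k * d → m + k * d ≤ Z * (k * d) →
                  m ^ (r + ℓ * k) ≤ Z ^ ℓ * b (r + ℓ * k) ℓ
  binTail-lower k r ℓ Z pos h = padded r
    where
    open ≤-Reasoning
    blocks : ∀ ℓ → m ^ (ℓ * k) ≤ Z ^ ℓ * b (ℓ * k) ℓ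
    blocks zero    = ≤-refl
    blocks (suc ℓ) = begin
      m ^ (k + ℓ * k)                              ≡⟨ ^-distribˡ-+-* m k (ℓ * k) ⟩
      m ^ k * m ^ (ℓ * k)                          ≤⟨ *-mono-≤ (binTail-one-lower k Z pos h) (blocks ℓ) ⟩
      Z * b k 1 * (Z ^ ℓ * b (ℓ * k) ℓ)            ≡⟨ ring Z (b k 1) (Z ^ ℓ) (b (ℓ * k) ℓ) ⟩
      Z * Z ^ ℓ * (b k 1 * b (ℓ * k) ℓ)            ≤⟨ *-monoʳ-≤ (Z * Z ^ ℓ) (binTail-+ k (ℓ * k) 1 ℓ) ⟩
      Z * Z ^ ℓ * b (k + ℓ * k) (suc ℓ)            ∎
      where ring : ∀ a b c d → a * b * (c * d) ≡ a * c * (b * d)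
            ring = solve-∀
    padded : ∀ r → m ^ (r + ℓ * k) ≤ Z ^ ℓ * b (r + ℓ * k) ℓ
    padded zero    = blocks ℓ
    padded (suc r) = begin
      m * m ^ (r + ℓ * k)                      ≤⟨ *-monoʳ-≤ m (padded r) ⟩
      m * (Z ^ ℓ * b (r + ℓ * k) ℓ)            ≡⟨ ring m (Z ^ ℓ) (b (r + ℓ * k) ℓ) ⟩
      Z ^ ℓ * (m * b (r + ℓ * k) ℓ)            ≤⟨ *-monoʳ-≤ (Z ^ ℓ) (binTail-suc (r + ℓ * k) ℓ) ⟩
      Z ^ ℓ * b (suc r + ℓ * k) ℓ              ∎
      where ring : ∀ a b c → a * (b * c) ≡ b * (a * c)
            ring = solve-∀

-- An elementary exponential bound

^-suc-half : ∀ n h r → r + h ≤ n → suc n ^ h * r ≤ n ^ h * (r + h)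
^-suc-half n zero    r le = ≤-reflexive (cong (λ z → 1 * z) (sym (+-identityʳ r)))
^-suc-half n (suc h) r le = begin
  suc n * suc n ^ h * r               ≡⟨ *-assoc (suc n) (suc n ^ h) r ⟩
  suc n * (suc n ^ h * r)             ≤⟨ *-monoʳ-≤ (suc n) (^-suc-half n h r (≤-trans (+-monoʳ-≤ r (n≤1+n h)) le)) ⟩
  suc n * (n ^ h * (r + h))           ≡⟨ ring₁ n (n ^ h) (r + h) ⟩
  n ^ h * (r + h) + n ^ h * (n * (r + h))  ≤⟨ +-monoˡ-≤ _ (*-monoʳ-≤ (n ^ h) (≤-trans (+-monoʳ-≤ r (n≤1+n h)) le)) ⟩
  n ^ h * n + n ^ h * (n * (r + h))   ≡⟨ ring₂ n (n ^ h) r h ⟩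
  n * n ^ h * (r + suc h)             ∎
  where open ≤-Reasoning
        ring₁ : ∀ n p x → suc n * (p * x) ≡ p * x + p * (n * x)
        ring₁ = solve-∀
        ring₂ : ∀ n p r h → p * n + p * (n * (r + h)) ≡ n * p * (r + suc h)
        ring₂ = solve-∀

halve : ∀ n → ∃ λ h → (n ≡ h + h) ⊎ (n ≡ suc (h + h))
halve zero    = 0 , inj₁ refl
halve (suc n) with halve n
... | h , inj₁ refl = h , inj₂ refl
... | h , inj₂ refl = suc h , inj₁ (cong suc (sym (+-suc h h)))

-- Stands in for (1+1/N)^N ≤ e. By `^-suc-half`, (1+1/N)^h ≤ 1+h/r ≤ 2 when h ≤ r = N-h; two such
-- halves give 4, and the extra factor for odd N is at most 2.
^-suc-≤ : ∀ n → suc (suc n) ^ suc n ≤ 8 * suc n ^ suc n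
^-suc-≤ n = go (halve N)
  where
  open ≤-Reasoning
  N = suc n
  half : ∀ h r → N ≡ r + h → h ≤ r → 0 < r → suc N ^ h ≤ 2 * N ^ h
  half h r eq h≤r pos = *-cancelʳ-≤ (suc N ^ h) (2 * N ^ h) r {{>-nonZero pos}} (begin
    suc N ^ h * r      ≤⟨ ^-suc-half N h r (≤-reflexive (sym eq)) ⟩
    N ^ h * (r + h)    ≤⟨ *-monoʳ-≤ (N ^ h) (+-monoʳ-≤ r h≤r) ⟩
    N ^ h * (r + r)    ≡⟨ ring (N ^ h) r ⟩
    2 * N ^ h * r      ∎)
    where ring : ∀ p r → p * (r + r) ≡ 2 * p * r
          ring = solve-∀
  sq : ∀ h → suc N ^ h ≤ 2 * N ^ h → suc N ^ (h + h) ≤ 4 * N ^ (h + h)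
  sq h q = begin
    suc N ^ (h + h)              ≡⟨ ^-distribˡ-+-* (suc N) h h ⟩
    suc N ^ h * suc N ^ h        ≤⟨ *-mono-≤ q q ⟩
    2 * N ^ h * (2 * N ^ h)      ≡⟨ ring (N ^ h) ⟩
    4 * (N ^ h * N ^ h)          ≡⟨ cong (4 *_) (^-distribˡ-+-* N h h) ⟨
    4 * N ^ (h + h)              ∎
    where ring : ∀ p → 2 * p * (2 * p) ≡ 4 * (p * p)
          ring = solve-∀
  go : (∃ λ h → (N ≡ h + h) ⊎ (N ≡ suc (h + h))) → suc N ^ N ≤ 8 * N ^ N
  go (zero  , inj₁ ())
  go (suc h , inj₁ eq) = begin
    suc N ^ N                  ≡⟨ cong (suc N ^_) eq ⟩
    suc N ^ (suc h + suc h)    ≤⟨ sq (suc h) (half (suc h) (suc h) eq ≤-refl z<s) ⟩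
    4 * N ^ (suc h + suc h)    ≡⟨ cong (λ z → 4 * N ^ z) eq ⟨
    4 * N ^ N                  ≤⟨ *-monoˡ-≤ (N ^ N) (m≤m+n 4 4) ⟩
    8 * N ^ N                  ∎
  go (h , inj₂ eq) = begin
    suc N ^ N                          ≡⟨ cong (suc N ^_) eq ⟩
    suc N * suc N ^ (h + h)            ≤⟨ *-mono-≤ (s≤s (m≤n+m N n)) (sq h (half h (suc h) eq (n≤1+n h) z<s)) ⟩
    (N + N) * (4 * N ^ (h + h))        ≡⟨ ring N (N ^ (h + h)) ⟩
    8 * (N * N ^ (h + h))              ≡⟨ cong (λ z → 8 * N ^ z) eq ⟨
    8 * N ^ N                          ∎
    where ring : ∀ N p → (N + N) * (4 * p) ≡ 8 * (N * p)
          ring = solve-∀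

^-distribʳ-* : ∀ k a b → (a * b) ^ k ≡ a ^ k * b ^ k
^-distribʳ-* zero    a b = refl
^-distribʳ-* (suc k) a b = trans (cong (a * b *_) (^-distribʳ-* k a b)) (ring a b (a ^ k) (b ^ k))
  where ring : ∀ a b x y → a * b * (x * y) ≡ a * x * (b * y)
        ring = solve-∀

-- Since (N+a+1)/(N+a) ≤ (N+1)/N, each unit of `a` multiplies the left side by at most (1+1/N)^N ≤
-- 8.
[n+a]^n≤8^a*n^n : ∀ n a → (n + a) ^ n ≤ 8 ^ a * n ^ n
[n+a]^n≤8^a*n^n zero    a       = ≤-trans (m^n>0 8 a) (≤-reflexive (sym (*-identityʳ _)))
[n+a]^n≤8^a*n^n (suc n) zero    = ≤-reflexive (trans (cong (_^ suc n) (+-identityʳ (suc n))) (sym (+-identityʳ _)))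
[n+a]^n≤8^a*n^n (suc n) (suc a) = *-cancelʳ-≤ _ _ (N ^ N) {{m^n≢0 N N}} (begin
  (N + suc a) ^ N * N ^ N           ≡⟨ ^-distribʳ-* N (N + suc a) N ⟨
  ((N + suc a) * N) ^ N             ≤⟨ ^-monoˡ-≤ N (≤-trans (m≤m+n _ a) (≤-reflexive (ring N a))) ⟩
  ((N + a) * suc N) ^ N             ≡⟨ ^-distribʳ-* N (N + a) (suc N) ⟩
  (N + a) ^ N * suc N ^ N           ≤⟨ *-mono-≤ ([n+a]^n≤8^a*n^n N a) (^-suc-≤ n) ⟩
  8 ^ a * N ^ N * (8 * N ^ N)       ≡⟨ ring₂ (8 ^ a) (N ^ N) ⟩
  8 * 8 ^ a * N ^ N * N ^ N         ∎)
  where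
  open ≤-Reasoning
  N = suc n
  ring : ∀ N a → (N + suc a) * N + a ≡ (N + a) * suc N
  ring = solve-∀
  ring₂ : ∀ p q → p * q * (8 * q) ≡ 8 * p * q * q
  ring₂ = solve-∀

-- Density and the optimal load

size : ∀ {n} → (Fin n → Bool) → ℕ
size {n} Z = ∑ (allFin n) λ v → ⟦ Z v ⟧

size-> : ∀ {n} (Z : Fin n → Bool) v → Z v ≡ true → 0 < size Z
size-> Z v h = ≤-trans (≤-reflexive (cong ⟦_⟧ (sym h))) (∑-allFin-term (λ v → ⟦ Z v ⟧) v)

load≡∑ : ∀ {n} (hs : List (Fin n)) v → load hs v ≡ ∑ hs (λ w → ⟦ w == v ⟧)
load≡∑ []       v = refl
load≡∑ (w ∷ hs) v with w Fin.≟ v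
... | yes _ = cong suc (load≡∑ hs v)
... | no _  = load≡∑ hs v

foldr-⊔-upper : {A : Set} (f : A → ℕ) {x : A} {xs : List A} → x ∈ xs → f x ≤ foldr _⊔_ 0 (map f xs)
foldr-⊔-upper f (here refl) = m≤m⊔n _ _
foldr-⊔-upper f (there p)   = ≤-trans (foldr-⊔-upper f p) (m≤n⊔m _ _)

foldr-⊔-least : {A : Set} (f : A → ℕ) (xs : List A) {b : ℕ} → (∀ x → f x ≤ b) → foldr _⊔_ 0 (map f xs) ≤ b
foldr-⊔-least f []       h = z≤n
foldr-⊔-least f (x ∷ xs) h = ⊔-lub (h x) (foldr-⊔-least f xs h)

load≤maxLoad : ∀ {n} (hs : List (Fin n)) v → load hs v ≤ maxLoad hs
load≤maxLoad hs v = foldr-⊔-upper (load hs) (∈-allFin v)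

maxLoad≤ : ∀ {n} (hs : List (Fin n)) {b} → (∀ v → load hs v ≤ b) → maxLoad hs ≤ b
maxLoad≤ {n} hs = foldr-⊔-least (load hs) (allFin n)

module _ {n : ℕ} (Z : Fin n → Bool) where
  inside : Fin n × Fin n → Bool
  inside e = Z (proj₁ e) ∧ Z (proj₂ e)

  ∑-targets≤ : ∀ r → ∑ r (λ w → ⟦ Z w ⟧) ≤ maxLoad r * size Z
  ∑-targets≤ r = begin
    ∑ r (λ w → ⟦ Z w ⟧)                                          ≡⟨ ∑-cong r (λ w → ∑-δ w (λ v → ⟦ Z v ⟧)) ⟨
    ∑ r (λ w → ∑ (allFin n) (λ v → ⟦ v == w ⟧ * ⟦ Z v ⟧))        ≡⟨ ∑-swap r (allFin n) _ ⟩
    ∑ (allFin n) (λ v → ∑ r (λ w → ⟦ v == w ⟧ * ⟦ Z v ⟧))        ≡⟨ ∑-cong (allFin n) (λ v → ∑-*ʳ r _ ⟦ Z v ⟧) ⟩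
    ∑ (allFin n) (λ v → ∑ r (λ w → ⟦ v == w ⟧) * ⟦ Z v ⟧)        ≤⟨ ∑-mono (allFin n) (λ v → *-monoˡ-≤ ⟦ Z v ⟧ (bound v)) ⟩
    ∑ (allFin n) (λ v → maxLoad r * ⟦ Z v ⟧)                     ≡⟨ ∑-*ˡ (allFin n) (maxLoad r) _ ⟩
    maxLoad r * size Z                                            ∎
    where
    open ≤-Reasoning
    bound : ∀ v → ∑ r (λ w → ⟦ v == w ⟧) ≤ maxLoad r
    bound v = ≤-trans (≤-reflexive (trans (∑-cong r (λ w → cong ⟦_⟧ (==-sym v w))) (sym (load≡∑ r v)))) (load≤maxLoad r v)

  private
    Covers : List (Fin n × Fin n) → List (Fin n) → Set
    Covers es r = ∑ es (λ e → ⟦ inside e ⟧) ≤ ∑ r (λ w → ⟦ Z w ⟧)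

    covers-step : ∀ es e rs → All (Covers es) rs →
                  All (Covers (e ∷ es)) (concatMap (λ r → (proj₁ e ∷ r) ∷ (proj₂ e ∷ r) ∷ []) rs)
    covers-step es e []       []       = []
    covers-step es e (r ∷ rs) (h ∷ hs) =
      +-mono-≤ (⟦⟧-mono {inside e} (λ q → proj₁ (∧-split {Z (proj₁ e)} q))) h ∷
      +-mono-≤ (⟦⟧-mono {inside e} (λ q → proj₂ (∧-split {Z (proj₁ e)} q))) h ∷
      covers-step es e rs hs

    orientations-cover : ∀ es → All (Covers es) (orientations es)
    orientations-cover []       = z≤n ∷ []
    orientations-cover (e ∷ es) = covers-step es e (orientations es) (orientations-cover es)

    -- Deals with the start value `length es` of the minimum in `Mstar`.
    length-bound : ∀ es → ∑ es (λ e → ⟦ inside e ⟧) ≤ length es * size Z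
    length-bound []       = z≤n
    length-bound (e ∷ es) = +-mono-≤ (one (Z (proj₁ e)) refl) (length-bound es)
      where one : ∀ b → Z (proj₁ e) ≡ b → ⟦ b ∧ Z (proj₂ e) ⟧ ≤ size Z
            one false h = z≤n
            one true  h = ≤-trans (⟦⟧≤1 (Z (proj₂ e))) (size-> Z (proj₁ e) h)

    foldr-⊓-bound : ∀ c base (rs : List (List (Fin n))) → c ≤ base * size Z → All (λ r → c ≤ maxLoad r * size Z) rs →
                    c ≤ foldr _⊓_ base (map maxLoad rs) * size Z
    foldr-⊓-bound c base []       h []       = h
    foldr-⊓-bound c base (r ∷ rs) h (p ∷ ps) =
      ≤-trans (⊓-glb {x = c} {maxLoad r * size Z} {rest * size Z} p (foldr-⊓-bound c base rs h ps))
        (≤-reflexive (sym (*-distribʳ-⊓ (size Z) (maxLoad r) rest)))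
      where rest = foldr _⊓_ base (map maxLoad rs)

  -- Whatever the orientation, an edge with both ends in `Z` loads a vertex of `Z`. This density
  -- bound is the only property of `Mstar` that the proof uses.
  inside≤Mstar : ∀ es → ∑ es (λ e → ⟦ inside e ⟧) ≤ Mstar es * size Z
  inside≤Mstar es = foldr-⊓-bound (∑ es (λ e → ⟦ inside e ⟧)) (length es) (orientations es) (length-bound es)
    (All.map {P = Covers es} (λ {r} h → ≤-trans h (∑-targets≤ r)) {orientations es} (orientations-cover es))

2ab≤a²+b² : ∀ a b → 2 * (a * b) ≤ a * a + b * b
2ab≤a²+b² a b with ≤-total a b
... | inj₁ p with m≤n⇒∃[o]m+o≡n p
... | c , refl = ≤-trans (m≤m+n _ (c * c)) (≤-reflexive (ring a c))
  where ring : ∀ a c → 2 * (a * (a + c)) + c * c ≡ a * a + (a + c) * (a + c)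
        ring = solve-∀
2ab≤a²+b² a b | inj₂ p with m≤n⇒∃[o]m+o≡n p
... | c , refl = ≤-trans (m≤m+n _ (c * c)) (≤-reflexive (ring b c))
  where ring : ∀ a c → 2 * ((a + c) * a) + c * c ≡ (a + c) * (a + c) + a * a
        ring = solve-∀

-- Links and degrees in the base graph

module Base {n : ℕ} (G : Graph n) where
  m : ℕ
  m = length (edges G)
  EI : List (Fin m)
  EI = allFin m
  V : List (Fin n)
  V = allFin n
  x y : Fin m → Fin n
  x e = proj₁ (edge G e)
  y e = proj₂ (edge G e)

  x≢y : ∀ e → x e ≢ y e
  x≢y e = Fin.<⇒≢ (All.lookup (simple G) (∈-lookup e))

  opt : List (Fin m) → ℕ
  opt s = Mstar (map (edge G) s)

  inside≤opt : ∀ (Z : Fin n → Bool) s → ∑ s (λ e → ⟦ Z (x e) ∧ Z (y e) ⟧) ≤ opt s * size Z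
  inside≤opt Z s = ≤-trans (≤-reflexive (sym (∑-map (edge G) s _))) (inside≤Mstar Z (map (edge G) s))

  link : Fin n → (Fin n → Bool) → Fin m → Bool
  link u B e = ((x e == u) ∧ B (y e)) ∨ ((y e == u) ∧ B (x e))

  deg : Fin n → (Fin n → Bool) → ℕ
  deg u B = ∑ EI λ e → ⟦ link u B e ⟧

  joins : Fin m → Fin n → Fin n → ℕ
  joins e u v = ⟦ u == x e ⟧ * ⟦ v == y e ⟧ + ⟦ u == y e ⟧ * ⟦ v == x e ⟧

  mult : Fin n → Fin n → ℕ
  mult u v = ∑ EI λ e → joins e u v

  ⟦link⟧ : ∀ u B e → ⟦ link u B e ⟧ ≡ ⟦ u == x e ⟧ * ⟦ B (y e) ⟧ + ⟦ u == y e ⟧ * ⟦ B (x e) ⟧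
  ⟦link⟧ u B e rewrite ==-sym u (x e) | ==-sym u (y e) with x e == u in p | y e == u in q
  ... | true  | true  = contradiction (trans (==⇒≡ (x e) u p) (sym (==⇒≡ (y e) u q))) (x≢y e)
  ... | true  | false = trans (cong ⟦_⟧ (Bool.∨-identityʳ _)) (sym (trans (+-identityʳ _) (+-identityʳ _)))
  ... | false | true  = sym (+-identityʳ _)
  ... | false | false = refl

  ∑-joins : ∀ u (f : Fin n → ℕ) e → ∑ V (λ v → f v * joins e u v) ≡
            ⟦ u == x e ⟧ * f (y e) + ⟦ u == y e ⟧ * f (x e)
  ∑-joins u f e = begin
    ∑ V (λ v → f v * joins e u v)
      ≡⟨ ∑-cong V (λ v → ring (f v) ⟦ u == x e ⟧ ⟦ v == y e ⟧ ⟦ u == y e ⟧ ⟦ v == x e ⟧) ⟩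
    ∑ V (λ v → ⟦ u == x e ⟧ * (⟦ v == y e ⟧ * f v) + ⟦ u == y e ⟧ * (⟦ v == x e ⟧ * f v))
      ≡⟨ trans (∑-+ V _ _) (cong₂ _+_ (∑-*ˡ V ⟦ u == x e ⟧ _) (∑-*ˡ V ⟦ u == y e ⟧ _)) ⟩
    ⟦ u == x e ⟧ * ∑ V (λ v → ⟦ v == y e ⟧ * f v) + ⟦ u == y e ⟧ * ∑ V (λ v → ⟦ v == x e ⟧ * f v)
      ≡⟨ cong₂ (λ a b → ⟦ u == x e ⟧ * a + ⟦ u == y e ⟧ * b) (∑-δ (y e) f) (∑-δ (x e) f) ⟩
    ⟦ u == x e ⟧ * f (y e) + ⟦ u == y e ⟧ * f (x e) ∎
    where open ≡-Reasoning
          ring : ∀ f a b c d → f * (a * b + c * d) ≡ a * (b * f) + c * (d * f)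
          ring = solve-∀

  ∑-link : ∀ (f : Fin n → ℕ) B e → ∑ V (λ u → f u * ⟦ link u B e ⟧) ≡ f (x e) * ⟦ B (y e) ⟧ + f (y e) * ⟦ B (x e) ⟧
  ∑-link f B e = begin
    ∑ V (λ u → f u * ⟦ link u B e ⟧)
      ≡⟨ ∑-cong V (λ u → trans (cong (f u *_) (⟦link⟧ u B e)) (ring (f u) ⟦ u == x e ⟧ ⟦ B (y e) ⟧ ⟦ u == y e ⟧ ⟦ B (x e) ⟧)) ⟩
    ∑ V (λ u → (⟦ u == x e ⟧ * f u) * ⟦ B (y e) ⟧ + (⟦ u == y e ⟧ * f u) * ⟦ B (x e) ⟧)
      ≡⟨ trans (∑-+ V _ _) (cong₂ _+_ (∑-*ʳ V _ ⟦ B (y e) ⟧) (∑-*ʳ V _ ⟦ B (x e) ⟧)) ⟩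
    ∑ V (λ u → ⟦ u == x e ⟧ * f u) * ⟦ B (y e) ⟧ + ∑ V (λ u → ⟦ u == y e ⟧ * f u) * ⟦ B (x e) ⟧
      ≡⟨ cong₂ (λ a b → a * ⟦ B (y e) ⟧ + b * ⟦ B (x e) ⟧) (∑-δ (x e) f) (∑-δ (y e) f) ⟩
    f (x e) * ⟦ B (y e) ⟧ + f (y e) * ⟦ B (x e) ⟧ ∎
    where open ≡-Reasoning
          ring : ∀ f a b c d → f * (a * b + c * d) ≡ (a * f) * b + (c * f) * d
          ring = solve-∀

  deg≡∑mult : ∀ u B → ∑ V (λ v → ⟦ B v ⟧ * mult u v) ≡ deg u B
  deg≡∑mult u B = begin
    ∑ V (λ v → ⟦ B v ⟧ * mult u v)                       ≡⟨ ∑-cong V (λ v → sym (∑-*ˡ EI ⟦ B v ⟧ _)) ⟩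
    ∑ V (λ v → ∑ EI (λ e → ⟦ B v ⟧ * joins e u v))    ≡⟨ ∑-swap V EI _ ⟩
    ∑ EI (λ e → ∑ V (λ v → ⟦ B v ⟧ * joins e u v))    ≡⟨ ∑-cong EI (λ e → trans (∑-joins u (λ v → ⟦ B v ⟧) e) (sym (⟦link⟧ u B e))) ⟩
    deg u B                                            ∎
    where open ≡-Reasoning

  link-mono : ∀ u {B B′ : Fin n → Bool} → (∀ v → B v ≡ true → B′ v ≡ true) → ∀ e → ⟦ link u B e ⟧ ≤ ⟦ link u B′ e ⟧
  link-mono u {B} {B′} h e = begin
    ⟦ link u B e ⟧                                                       ≡⟨ ⟦link⟧ u B e ⟩
    ⟦ u == x e ⟧ * ⟦ B (y e) ⟧ + ⟦ u == y e ⟧ * ⟦ B (x e) ⟧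
      ≤⟨ +-mono-≤ (*-monoʳ-≤ ⟦ u == x e ⟧ (⟦⟧-mono (h (y e)))) (*-monoʳ-≤ ⟦ u == y e ⟧ (⟦⟧-mono (h (x e)))) ⟩
    ⟦ u == x e ⟧ * ⟦ B′ (y e) ⟧ + ⟦ u == y e ⟧ * ⟦ B′ (x e) ⟧            ≡⟨ ⟦link⟧ u B′ e ⟨
    ⟦ link u B′ e ⟧                                                      ∎
    where open ≤-Reasoning

  deg-mono : ∀ u {B B′ : Fin n → Bool} → (∀ v → B v ≡ true → B′ v ≡ true) → deg u B ≤ deg u B′
  deg-mono u h = ∑-mono EI (link-mono u h)

  deg-cong : ∀ u {B B′ : Fin n → Bool} → (∀ v → B v ≡ B′ v) → deg u B ≡ deg u B′
  deg-cong u h = ≤-antisym (deg-mono u λ v p → trans (sym (h v)) p) (deg-mono u λ v p → trans (h v) p)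

  link-sound : ∀ u B e → link u B e ≡ true → (x e ≡ u × B (y e) ≡ true) ⊎ (y e ≡ u × B (x e) ≡ true)
  link-sound u B e l with ∨-split {(x e == u) ∧ B (y e)} l
  ... | inj₁ p = inj₁ (==⇒≡ (x e) u (proj₁ (∧-split {x e == u} p)) , proj₂ (∧-split {x e == u} p))
  ... | inj₂ p = inj₂ (==⇒≡ (y e) u (proj₁ (∧-split {y e == u} p)) , proj₂ (∧-split {y e == u} p))

  -- Supplies the disjointness needed for negative correlation: a linking edge has one end in `B`,
  -- so its other end is the only outside vertex that it links.
  link-disjoint : ∀ {u u′} B → u ≢ u′ → B u ≡ false → B u′ ≡ false →
                  ∀ e → link u B e ≡ true → link u′ B e ≡ false
  link-disjoint {u} {u′} B u≢u′ hu hu′ e l with link u′ B e in l′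
  ... | false = refl
  ... | true with link-sound u B e l | link-sound u′ B e l′
  ... | inj₁ (refl , _) | inj₁ (q , _) = contradiction q u≢u′
  ... | inj₂ (refl , _) | inj₂ (q , _) = contradiction q u≢u′
  ... | inj₁ (refl , _) | inj₂ (_ , b) = ⊥-elim (true≢false b hu)
  ... | inj₂ (refl , _) | inj₁ (_ , b) = ⊥-elim (true≢false b hu)

-- The elimination order

averaging : ∀ {n} (B : Fin n → Bool) (F : Fin n → ℕ) T → 0 < size B →
            ∑ (allFin n) (λ v → ⟦ B v ⟧ * F v) ≤ T * size B →
            ∃ λ v → B v ≡ true × F v ≤ T
averaging {n} B F T pos h with Fin.any? (λ v → (B v Bool.≟ true) ×-dec (F v ≤? T))
... | yes r = r
... | no ¬r = contradiction h (<⇒≱ (begin-strict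
  T * size B                                     <⟨ *-monoˡ-< (size B) {{>-nonZero pos}} (n<1+n T) ⟩
  suc T * size B                                 ≡⟨ *-comm (suc T) (size B) ⟩
  size B * suc T                                 ≡⟨ ∑-*ʳ (allFin n) (λ v → ⟦ B v ⟧) (suc T) ⟨
  ∑ (allFin n) (λ v → ⟦ B v ⟧ * suc T)           ≤⟨ ∑-mono (allFin n) (λ v → ⟦⟧*-mono (B v) (λ b → ≰⇒> (λ q → ¬r (v , b , q)))) ⟩
  ∑ (allFin n) (λ v → ⟦ B v ⟧ * F v)             ∎))
  where open ≤-Reasoning

-- The tangent line of 1/t at t = D/W turns N/(b+N) ≤ o/l into a bound that is quadratic in N.
tangent-bound : ∀ l D W N b o → 0 < b → l * N ≤ o * (b + N) →
                2 * (l * D * W) * N ≤ o * (D * D) + l * (W * W) * (b * N + N * N)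
tangent-bound l D W N b o 0<b h = *-cancelʳ-≤ _ _ z {{>-nonZero (≤-trans 0<b (m≤m+n b N))}} (begin
  2 * (l * D * W) * N * z                    ≡⟨ r₁ l D W N z ⟩
  l * N * (2 * (D * (z * W)))                ≤⟨ *-monoʳ-≤ (l * N) (2ab≤a²+b² D (z * W)) ⟩
  l * N * (D * D + z * W * (z * W))          ≡⟨ *-distribˡ-+ (l * N) (D * D) _ ⟩
  l * N * (D * D) + l * N * (z * W * (z * W))    ≤⟨ +-monoˡ-≤ _ (*-monoˡ-≤ (D * D) h) ⟩
  o * z * (D * D) + l * N * (z * W * (z * W))    ≡⟨ r₂ l D W N b o ⟩
  (o * (D * D) + l * (W * W) * (b * N + N * N)) * z ∎)
  where
  open ≤-Reasoning
  z = b + N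
  r₁ : ∀ l D W N z → 2 * (l * D * W) * N * z ≡ l * N * (2 * (D * (z * W)))
  r₁ = solve-∀
  r₂ : ∀ l D W N b o → o * (b + N) * (D * D) + l * N * ((b + N) * W * ((b + N) * W)) ≡
                       (o * (D * D) + l * (W * W) * (b * N + N * N)) * (b + N)
  r₂ = solve-∀

split-bound : ∀ W m M p q → 0 < W → 2 * (W * p) + q ≤ 8 * (m * M * W) → p ≤ 4 * (m * M) × q ≤ 8 * (m * M * W)
split-bound W m M p q 0<W h = *-cancelˡ-≤ {p} {4 * (m * M)} (2 * W) {{>-nonZero (*-mono-≤ {1} {2} (s≤s z≤n) 0<W)}} (begin
  2 * W * p            ≡⟨ *-assoc 2 W p ⟩
  2 * (W * p)          ≤⟨ m≤m+n _ q ⟩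
  2 * (W * p) + q      ≤⟨ h ⟩
  8 * (m * M * W)      ≡⟨ ring m M W ⟩
  2 * W * (4 * (m * M)) ∎) , ≤-trans (m≤n+m q _) h
  where open ≤-Reasoning
        ring : ∀ m M W → 8 * (m * M * W) ≡ 2 * W * (4 * (m * M))
        ring = solve-∀

combine : ∀ n W m M b p q → n * p ≤ 2 * (m * (M * b)) → n * q ≤ 4 * (m * M) * (W * b) →
          2 * W * n * p + n * q ≤ 8 * (m * M * W) * b
combine n W m M b p q hp hq = begin
  2 * W * n * p + n * q                               ≡⟨ cong (_+ n * q) (*-assoc (2 * W) n p) ⟩
  2 * W * (n * p) + n * q                             ≤⟨ +-mono-≤ (*-monoʳ-≤ (2 * W) hp) hq ⟩
  2 * W * (2 * (m * (M * b))) + 4 * (m * M) * (W * b) ≡⟨ ring W m M b ⟩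
  8 * (m * M * W) * b                                 ∎
  where open ≤-Reasoning
        ring : ∀ W m M b → 2 * W * (2 * (m * (M * b))) + 4 * (m * M) * (W * b) ≡ 8 * (m * M * W) * b
        ring = solve-∀

∑-weighted : {A : Set} (xs : List A) (W n : ℕ) (c f g : A → ℕ) →
  ∑ xs (λ v → c v * (2 * (W * (n * f v)) + n * g v)) ≡ 2 * W * n * ∑ xs (λ v → c v * f v) + n * ∑ xs (λ v → c v * g v)
∑-weighted xs W n c f g = trans (∑-cong xs (λ v → ring (c v) W n (f v) (g v)))
  (trans (∑-+ xs (λ v → 2 * W * n * (c v * f v)) (λ v → n * (c v * g v)))
    (cong₂ _+_ (∑-*ˡ xs (2 * W * n) (λ v → c v * f v)) (∑-*ˡ xs n (λ v → c v * g v))))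
  where ring : ∀ c W n d k → c * (2 * (W * (n * d)) + n * k) ≡ 2 * W * n * (c * d) + n * (c * k)
        ring = solve-∀

-- In expectations, with a = A/W = E[N]: the tangent point is t = D/W = b+1+a because E[N(b+N)] ≤
-- ba+a²+a = at, so the quadratic term collapses and 3Ma/t ≤ M remains. Hence 3a ≤ b+1+a ≤ 2b+a. The
-- 3 in the threshold 3M is what makes this end in a ≤ b.
second-moment-bound : ∀ M O Q W b A → let l = 3 * M; D = W * (b + 1) + A in
  0 < M → 0 < W → 0 < b → O ≤ M * W →
  2 * (l * D * W) * A ≤ O * (D * D) + l * (W * W) * (b * A + Q) →
  W * Q ≤ A * A + W * A → A ≤ W * b
second-moment-bound M O Q W b A 0<M 0<W 0<b hO hA hQ =
  *-cancelˡ-≤ 2 (+-cancelʳ-≤ A _ _ (*-cancelˡ-≤ M {{>-nonZero 0<M}} (begin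
    M * (2 * A + A)                  ≡⟨ ring₁ M A ⟩
    l * A                            ≤⟨ lA≤MD ⟩
    M * D                            ≤⟨ *-monoʳ-≤ M D≤ ⟩
    M * (2 * (W * b) + A)            ∎)))
  where
  open ≤-Reasoning
  l D : ℕ
  l = 3 * M
  D = W * (b + 1) + A
  0<D : 0 < D
  0<D = ≤-trans (*-mono-≤ 0<W (m≤n+m 1 b)) (m≤m+n _ A)
  ring₁ : ∀ M A → M * (2 * A + A) ≡ 3 * M * A
  ring₁ = solve-∀
  D≤ : D ≤ 2 * (W * b) + A
  D≤ = +-monoˡ-≤ A (≤-trans (*-monoʳ-≤ W (+-monoʳ-≤ b 0<b)) (≤-reflexive (ring W b)))
    where ring : ∀ W b → W * (b + b) ≡ 2 * (W * b)
          ring = solve-∀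
  WbA : W * (b * A + Q) ≤ A * D
  WbA = begin
    W * (b * A + Q)               ≡⟨ *-distribˡ-+ W (b * A) Q ⟩
    W * (b * A) + W * Q           ≤⟨ +-monoʳ-≤ (W * (b * A)) hQ ⟩
    W * (b * A) + (A * A + W * A) ≡⟨ ring W b A ⟩
    A * D                         ∎
    where ring : ∀ W b A → W * (b * A) + (A * A + W * A) ≡ A * (W * (b + 1) + A)
          ring = solve-∀
  r₁ : ∀ l A W D → l * A * (W * D) + l * W * (A * D) ≡ 2 * (l * D * W) * A
  r₁ = solve-∀
  r₂ : ∀ l W z → l * (W * W) * z ≡ l * W * (W * z)
  r₂ = solve-∀
  r₃ : ∀ M W D → M * W * (D * D) ≡ M * D * (W * D)
  r₃ = solve-∀
  lA≤MD : l * A ≤ M * D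
  lA≤MD = *-cancelʳ-≤ (l * A) (M * D) (W * D) {{>-nonZero (*-mono-≤ 0<W 0<D)}} (+-cancelʳ-≤ (l * W * (A * D)) _ _ (begin
    l * A * (W * D) + l * W * (A * D)      ≡⟨ r₁ l A W D ⟩
    2 * (l * D * W) * A                    ≤⟨ hA ⟩
    O * (D * D) + l * (W * W) * (b * A + Q)   ≡⟨ cong (O * (D * D) +_) (r₂ l W (b * A + Q)) ⟩
    O * (D * D) + l * W * (W * (b * A + Q))   ≤⟨ +-mono-≤ (*-monoˡ-≤ (D * D) hO) (*-monoʳ-≤ (l * W) WbA) ⟩
    M * W * (D * D) + l * W * (A * D)      ≡⟨ cong (_+ l * W * (A * D)) (r₃ M W D) ⟩
    M * D * (W * D) + l * W * (A * D)      ∎))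

module Elimination {n : ℕ} (G : Graph n) (M : ℕ) (0<M : 0 < M) (0<m : 0 < Base.m G)
  (optBound : ∑ (seqs (Base.m G) n) (Base.opt G) ≤ M * Base.m G ^ n) where
  open Base G

  W ℓ : ℕ
  W = m ^ n
  ℓ = 3 * M

  0<W : 0 < W
  0<W = m^n>0 m {{>-nonZero 0<m}} n

  heavy : ℕ → ℕ
  heavy d = binTail d (m ∸ d) n ℓ

  tail≡heavy : ∀ (p : Fin m → Bool) → tailCount m n ℓ p ≡ heavy (∑ EI λ e → ⟦ p e ⟧)
  tail≡heavy p = trans (tailCount≡binTail m n ℓ p) (cong (λ z → binTail d z n ℓ)
    (sym (trans (cong (_∸ d) (sym (∑-⟦⟧+∑-⟦not⟧ m p))) (m+n∸m≡n d _))))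
    where d = ∑ EI λ e → ⟦ p e ⟧

  -- Holds for a vertex when it is removed, and persists because `B` only shrinks afterwards.
  record Light (B : Fin n → Bool) (u : Fin n) : Set where
    constructor light
    field degree≤ : n * deg u B ≤ 4 * (m * M)

  module _ (B : Fin n → Bool) where
    b : ℕ
    b = size B

    internal : n * ∑ EI (λ e → ⟦ B (x e) ∧ B (y e) ⟧) ≤ m * (M * b)
    internal = *-cancelʳ-≤ _ _ W {{>-nonZero 0<W}} (begin
      n * E * W                                              ≡⟨ ring₁ n E W ⟩
      n * W * E                                              ≡⟨ ∑-seqs-∑ m n (λ e → ⟦ B (x e) ∧ B (y e) ⟧) ⟨
      m * ∑ (seqs m n) (λ s → ∑ s (λ e → ⟦ B (x e) ∧ B (y e) ⟧))  ≤⟨ *-monoʳ-≤ m (∑-mono (seqs m n) (inside≤opt B)) ⟩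
      m * ∑ (seqs m n) (λ s → opt s * b)                     ≡⟨ cong (m *_) (∑-*ʳ (seqs m n) opt b) ⟩
      m * (∑ (seqs m n) opt * b)                             ≤⟨ *-monoʳ-≤ m (*-monoˡ-≤ b optBound) ⟩
      m * (M * W * b)                                        ≡⟨ ring₂ m M W b ⟩
      m * (M * b) * W                                        ∎)
      where
      open ≤-Reasoning
      E = ∑ EI (λ e → ⟦ B (x e) ∧ B (y e) ⟧)
      ring₁ : ∀ n E W → n * E * W ≡ n * W * E
      ring₁ = solve-∀
      ring₂ : ∀ m M W b → m * (M * W * b) ≡ m * (M * b) * W
      ring₂ = solve-∀

    X : Fin n → List (Fin m) → ℕ
    X u s = ∑ s λ e → ⟦ link u B e ⟧

    H : Fin n → List (Fin m) → ℕ
    H u s = ⟦ not (B u) ⟧ * ⟦ ℓ ≤ᵇ X u s ⟧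

    N : List (Fin m) → ℕ
    N s = ∑ V λ u → H u s

    A : ℕ
    A = ∑ V λ u → ⟦ not (B u) ⟧ * heavy (deg u B)

    ∑-H : ∀ u → ∑ (seqs m n) (H u) ≡ ⟦ not (B u) ⟧ * heavy (deg u B)
    ∑-H u = trans (∑-*ˡ (seqs m n) ⟦ not (B u) ⟧ _) (cong (⟦ not (B u) ⟧ *_) (tail≡heavy (link u B)))

    ∑-N : ∑ (seqs m n) N ≡ A
    ∑-N = trans (∑-swap (seqs m n) V (λ s u → H u s)) (∑-cong V ∑-H)

    -- The dense set is B together with the outside vertices that send at least ℓ arrivals into it.
    N≤ : ∀ s → ℓ * N s ≤ opt s * (b + N s)
    N≤ s = begin
      ℓ * N s                                                ≡⟨ ∑-*ˡ V ℓ (λ u → H u s) ⟨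
      ∑ V (λ u → ℓ * H u s)                                  ≤⟨ ∑-mono V heavy≤ ⟩
      ∑ V (λ u → ∑ s (λ e → ⟦ U u ⟧ * ⟦ link u B e ⟧))      ≡⟨ ∑-swap V s _ ⟩
      ∑ s (λ e → ∑ V (λ u → ⟦ U u ⟧ * ⟦ link u B e ⟧))      ≤⟨ ∑-mono s edge≤ ⟩
      ∑ s (λ e → ⟦ Z (x e) ∧ Z (y e) ⟧)                      ≤⟨ inside≤opt Z s ⟩
      opt s * size Z                                         ≡⟨ cong (opt s *_) size-Z ⟩
      opt s * (b + N s)                                      ∎
      where
      open ≤-Reasoning
      U Z : Fin n → Bool
      U u = not (B u) ∧ (ℓ ≤ᵇ X u s)
      Z u = B u ∨ U u
      size-Z : size Z ≡ b + N s
      size-Z = trans (∑-cong V λ u → pt (B u) (ℓ ≤ᵇ X u s)) (∑-+ V _ _)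
        where pt : ∀ a c → ⟦ a ∨ not a ∧ c ⟧ ≡ ⟦ a ⟧ + ⟦ not a ⟧ * ⟦ c ⟧
              pt true  c = refl
              pt false c = sym (+-identityʳ _)
      heavy≤ : ∀ u → ℓ * H u s ≤ ∑ s (λ e → ⟦ U u ⟧ * ⟦ link u B e ⟧)
      heavy≤ u = begin
        ℓ * H u s                   ≡⟨ cong (ℓ *_) (⟦∧⟧ (not (B u)) _) ⟨
        ℓ * ⟦ U u ⟧                 ≡⟨ *-comm ℓ ⟦ U u ⟧ ⟩
        ⟦ U u ⟧ * ℓ                 ≤⟨ ⟦⟧*-mono (U u) (λ q → ≤ᵇ-sound (proj₂ (∧-split {not (B u)} q))) ⟩
        ⟦ U u ⟧ * X u s             ≡⟨ ∑-*ˡ s ⟦ U u ⟧ _ ⟨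
        ∑ s (λ e → ⟦ U u ⟧ * ⟦ link u B e ⟧) ∎
      edge≤ : ∀ e → ∑ V (λ u → ⟦ U u ⟧ * ⟦ link u B e ⟧) ≤ ⟦ Z (x e) ∧ Z (y e) ⟧
      edge≤ e = ≤-trans (≤-reflexive (∑-link (λ u → ⟦ U u ⟧) B e)) (pt (B (x e)) (B (y e)) _ _)
        where pt : ∀ a a′ c c′ → ⟦ not a ∧ c ⟧ * ⟦ a′ ⟧ + ⟦ not a′ ∧ c′ ⟧ * ⟦ a ⟧ ≤
                                 ⟦ (a ∨ not a ∧ c) ∧ (a′ ∨ not a′ ∧ c′) ⟧
              pt true  true  c c′ = z≤n
              pt true  false c c′ = ≤-reflexive (*-identityʳ _)
              pt false true  true  c′ = ≤-refl
              pt false true  false c′ = z≤n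
              pt false false c c′ = ≤-trans (≤-reflexive (cong₂ _+_ (*-zeroʳ ⟦ c ⟧) (*-zeroʳ ⟦ c′ ⟧))) z≤n

    -- The second summand is the diagonal, where an indicator equals its square. Off the diagonal,
    -- either one factor vanishes or the links are disjoint and the tails negatively correlated.
    pair-bound : ∀ u v → W * ∑ (seqs m n) (λ s → H u s * H v s) ≤
                 ⟦ not (B u) ⟧ * heavy (deg u B) * (⟦ not (B v) ⟧ * heavy (deg v B)) +
                 ⟦ v == u ⟧ * (W * (⟦ not (B v) ⟧ * heavy (deg v B)))
    pair-bound u v with v Fin.≟ u
    ... | yes refl = begin
      W * ∑ (seqs m n) (λ s → H u s * H u s)  ≡⟨ cong (W *_) (∑-cong (seqs m n) (λ s → idem (not (B u)) (ℓ ≤ᵇ X u s))) ⟩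
      W * ∑ (seqs m n) (H u)                  ≡⟨ cong (W *_) (∑-H u) ⟩
      W * h                                   ≡⟨ *-identityˡ (W * h) ⟨
      1 * (W * h)                             ≤⟨ m≤n+m (1 * (W * h)) (h * h) ⟩
      h * h + 1 * (W * h)                     ∎
      where
      open ≤-Reasoning
      h = ⟦ not (B u) ⟧ * heavy (deg u B)
      idem : ∀ a c → ⟦ a ⟧ * ⟦ c ⟧ * (⟦ a ⟧ * ⟦ c ⟧) ≡ ⟦ a ⟧ * ⟦ c ⟧
      idem true  true  = refl
      idem true  false = refl
      idem false c     = refl
    ... | no v≢u with B u in bu | B v in bv
    ... | true  | _     = ≤-trans (≤-reflexive (trans (cong (W *_) (∑-zero (seqs m n) λ _ → refl)) (*-zeroʳ W))) z≤n
    ... | false | true  = ≤-trans (≤-reflexive (trans (cong (W *_) (∑-zero (seqs m n) λ s → *-zeroʳ (⟦ ℓ ≤ᵇ X u s ⟧ + 0))) (*-zeroʳ W))) z≤n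
    ... | false | false = begin
      W * ∑ (seqs m n) (λ s → 1 * ⟦ ℓ ≤ᵇ X u s ⟧ * (1 * ⟦ ℓ ≤ᵇ X v s ⟧))
        ≡⟨ cong (W *_) (∑-cong (seqs m n) λ s → cong₂ _*_ (*-identityˡ ⟦ ℓ ≤ᵇ X u s ⟧) (*-identityˡ ⟦ ℓ ≤ᵇ X v s ⟧)) ⟩
      W * ∑ (seqs m n) (λ s → ⟦ ℓ ≤ᵇ X u s ⟧ * ⟦ ℓ ≤ᵇ X v s ⟧)
        ≤⟨ tails-negatively-correlated m (link u B) (link v B) (link-disjoint B (v≢u ∘ sym) bu bv) n ℓ ℓ ⟩
      tailCount m n ℓ (link u B) * tailCount m n ℓ (link v B)
        ≡⟨ cong₂ _*_ (trans (tail≡heavy (link u B)) (sym (*-identityˡ (heavy (deg u B)))))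
                     (trans (tail≡heavy (link v B)) (sym (*-identityˡ (heavy (deg v B))))) ⟩
      1 * heavy (deg u B) * (1 * heavy (deg v B))
        ≡⟨ +-identityʳ _ ⟨
      1 * heavy (deg u B) * (1 * heavy (deg v B)) + 0 ∎
      where open ≤-Reasoning

    second-moment : W * ∑ (seqs m n) (λ s → N s * N s) ≤ A * A + W * A
    second-moment = begin
      W * ∑ (seqs m n) (λ s → N s * N s)
        ≡⟨ cong (W *_) (trans (∑-cong (seqs m n) square) (trans (∑-swap (seqs m n) V _) (∑-cong V λ u → ∑-swap (seqs m n) V _))) ⟩
      W * ∑ V (λ u → ∑ V (λ v → P u v))
        ≡⟨ trans (sym (∑-*ˡ V W _)) (∑-cong V λ u → sym (∑-*ˡ V W _)) ⟩
      ∑ V (λ u → ∑ V (λ v → W * P u v))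
        ≤⟨ ∑-mono V (λ u → ∑-mono V (pair-bound u)) ⟩
      ∑ V (λ u → ∑ V (λ v → h u * h v + ⟦ v == u ⟧ * (W * h v)))
        ≡⟨ ∑-cong V (λ u → trans (∑-+ V _ _) (cong₂ _+_ (∑-*ˡ V (h u) h) (∑-δ u (λ v → W * h v)))) ⟩
      ∑ V (λ u → h u * A + W * h u)
        ≡⟨ trans (∑-+ V _ _) (cong₂ _+_ (∑-*ʳ V h A) (∑-*ˡ V W h)) ⟩
      A * A + W * A ∎
      where
      open ≤-Reasoning
      h : Fin n → ℕ
      h u = ⟦ not (B u) ⟧ * heavy (deg u B)
      P : Fin n → Fin n → ℕ
      P u v = ∑ (seqs m n) (λ s → H u s * H v s)
      square : ∀ s → N s * N s ≡ ∑ V (λ u → ∑ V (λ v → H u s * H v s))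
      square s = trans (sym (∑-*ʳ V (λ u → H u s) (N s))) (∑-cong V λ u → sym (∑-*ˡ V (H u s) (λ v → H v s)))

    -- Heuristically, if more than `b` outside vertices were heavy, `B` together with them would
    -- have density above 3M/2, more than the expected optimum. The second moment excludes that a
    -- few exceptional sequences carry the expectation of `N`.
    A≤ : 0 < b → A ≤ W * b
    A≤ 0<b = second-moment-bound M (∑ (seqs m n) opt) (∑ (seqs m n) (λ s → N s * N s)) W b A 0<M 0<W 0<b optBound summed second-moment
      where
      open ≤-Reasoning
      D = W * (b + 1) + A
      summed : 2 * (ℓ * D * W) * A ≤ ∑ (seqs m n) opt * (D * D) + ℓ * (W * W) * (b * A + ∑ (seqs m n) (λ s → N s * N s))
      summed = begin
        2 * (ℓ * D * W) * A    ≡⟨ trans (cong (2 * (ℓ * D * W) *_) (sym ∑-N)) (sym (∑-*ˡ (seqs m n) (2 * (ℓ * D * W)) N)) ⟩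
        ∑ (seqs m n) (λ s → 2 * (ℓ * D * W) * N s) ≤⟨ ∑-mono (seqs m n) (λ s → tangent-bound ℓ D W (N s) b (opt s) 0<b (N≤ s)) ⟩
        ∑ (seqs m n) (λ s → opt s * (D * D) + ℓ * (W * W) * (b * N s + N s * N s))
          ≡⟨ trans (∑-+ (seqs m n) _ _) (cong₂ _+_ (∑-*ʳ (seqs m n) opt (D * D)) (∑-*ˡ (seqs m n) (ℓ * (W * W)) _)) ⟩
        ∑ (seqs m n) opt * (D * D) + ℓ * (W * W) * ∑ (seqs m n) (λ s → b * N s + N s * N s)
          ≡⟨ cong (λ q → ∑ (seqs m n) opt * (D * D) + ℓ * (W * W) * q) (trans (∑-+ (seqs m n) (λ s → b * N s) _)
               (cong (_+ ∑ (seqs m n) (λ s → N s * N s)) (trans (∑-*ˡ (seqs m n) b N) (cong (b *_) ∑-N)))) ⟩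
        ∑ (seqs m n) opt * (D * D) + ℓ * (W * W) * (b * A + ∑ (seqs m n) (λ s → N s * N s)) ∎

    -- Counts edges, not arrivals: each edge from a removed vertex `u` to `v` is weighted by `W`
    -- times the probability that `u` is heavy towards `B`. This sum over edges is the quantity that
    -- later bounds the rejections meeting in a tail.
    back : Fin n → ℕ
    back v = ∑ V λ u → ⟦ not (B u) ⟧ * (mult u v * heavy (deg u B))

    record Removable (v : Fin n) : Set where
      constructor removable
      field
        degree≤ : n * deg v B ≤ 4 * (m * M)
        back≤   : n * back v ≤ 8 * (m * M * W)

    ∑-deg : n * ∑ V (λ v → ⟦ B v ⟧ * deg v B) ≤ 2 * (m * (M * b))
    ∑-deg = begin
      n * ∑ V (λ v → ⟦ B v ⟧ * deg v B)
        ≡⟨ cong (n *_) (trans (∑-cong V λ v → sym (∑-*ˡ EI ⟦ B v ⟧ _)) (∑-swap V EI _)) ⟩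
      n * ∑ EI (λ e → ∑ V (λ v → ⟦ B v ⟧ * ⟦ link v B e ⟧))
        ≡⟨ cong (n *_) (trans (∑-cong EI pt) (∑-*ˡ EI 2 _)) ⟩
      n * (2 * ∑ EI (λ e → ⟦ B (x e) ∧ B (y e) ⟧))
        ≡⟨ ring n _ ⟩
      2 * (n * ∑ EI (λ e → ⟦ B (x e) ∧ B (y e) ⟧))
        ≤⟨ *-monoʳ-≤ 2 internal ⟩
      2 * (m * (M * b)) ∎
      where
      open ≤-Reasoning
      ring : ∀ n q → n * (2 * q) ≡ 2 * (n * q)
      ring = solve-∀
      pt : ∀ e → ∑ V (λ v → ⟦ B v ⟧ * ⟦ link v B e ⟧) ≡ 2 * ⟦ B (x e) ∧ B (y e) ⟧
      pt e = trans (∑-link (λ u → ⟦ B u ⟧) B e) (trans (r ⟦ B (x e) ⟧ ⟦ B (y e) ⟧) (cong (2 *_) (sym (⟦∧⟧ (B (x e)) _))))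
        where r : ∀ a c → a * c + c * a ≡ 2 * (a * c)
              r = solve-∀

    -- Double counting: an outside vertex `u` contributes its heaviness once per edge into `B`,
    -- lightness bounds the number of these edges, and `A≤` bounds the total heaviness.
    ∑-back : (∀ u → B u ≡ false → Light B u) → 0 < b →
             n * ∑ V (λ v → ⟦ B v ⟧ * back v) ≤ 4 * (m * M) * (W * b)
    ∑-back out 0<b = begin
      n * ∑ V (λ v → ⟦ B v ⟧ * back v)
        ≡⟨ cong (n *_) (trans (∑-cong V λ v → sym (∑-*ˡ V ⟦ B v ⟧ _)) (∑-swap V V _)) ⟩
      n * ∑ V (λ u → ∑ V (λ v → ⟦ B v ⟧ * (⟦ not (B u) ⟧ * (mult u v * heavy (deg u B)))))
        ≡⟨ cong (n *_) (∑-cong V col) ⟩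
      n * ∑ V (λ u → deg u B * (⟦ not (B u) ⟧ * heavy (deg u B)))
        ≡⟨ trans (sym (∑-*ˡ V n _)) (∑-cong V λ u → sym (*-assoc n (deg u B) _)) ⟩
      ∑ V (λ u → n * deg u B * (⟦ not (B u) ⟧ * heavy (deg u B)))
        ≤⟨ ∑-mono V each ⟩
      ∑ V (λ u → 4 * (m * M) * (⟦ not (B u) ⟧ * heavy (deg u B)))
        ≡⟨ ∑-*ˡ V (4 * (m * M)) _ ⟩
      4 * (m * M) * A
        ≤⟨ *-monoʳ-≤ (4 * (m * M)) (A≤ 0<b) ⟩
      4 * (m * M) * (W * b) ∎
      where
      open ≤-Reasoning
      col : ∀ u → ∑ V (λ v → ⟦ B v ⟧ * (⟦ not (B u) ⟧ * (mult u v * heavy (deg u B)))) ≡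
                  deg u B * (⟦ not (B u) ⟧ * heavy (deg u B))
      col u = trans (∑-cong V λ v → r ⟦ B v ⟧ ⟦ not (B u) ⟧ (mult u v) (heavy (deg u B)))
        (trans (∑-*ʳ V _ (⟦ not (B u) ⟧ * heavy (deg u B))) (cong (_* (⟦ not (B u) ⟧ * heavy (deg u B))) (deg≡∑mult u B)))
        where r : ∀ a c j h → a * (c * (j * h)) ≡ a * j * (c * h)
              r = solve-∀
      each : ∀ u → n * deg u B * (⟦ not (B u) ⟧ * heavy (deg u B)) ≤ 4 * (m * M) * (⟦ not (B u) ⟧ * heavy (deg u B))
      each u with B u in bu
      ... | true  = ≤-reflexive (trans (*-zeroʳ (n * deg u B)) (sym (*-zeroʳ (4 * (m * M)))))
      ... | false = *-monoˡ-≤ (1 * heavy (deg u B)) (Light.degree≤ (out u bu))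

    pick : (∀ u → B u ≡ false → Light B u) → 0 < b → ∃ λ v → B v ≡ true × Removable v
    pick out 0<b = let v , bv , h = averaging B F (8 * (m * M * W)) 0<b total in
      let p , q = split-bound W m M (n * deg v B) (n * back v) 0<W h in v , bv , removable p q
      where
      F : Fin n → ℕ
      -- The factor 2W gives both summands the same bound 4mMW on their averages over `B`; a vertex
      -- not above the joint average then exceeds neither bound by more than a factor 2.
      F v = 2 * (W * (n * deg v B)) + n * back v
      open ≤-Reasoning
      total : ∑ V (λ v → ⟦ B v ⟧ * F v) ≤ 8 * (m * M * W) * b
      total = begin
        ∑ V (λ v → ⟦ B v ⟧ * F v)
          ≡⟨ ∑-weighted V W n (λ v → ⟦ B v ⟧) (λ v → deg v B) back ⟩
        2 * W * n * ∑ V (λ v → ⟦ B v ⟧ * deg v B) + n * ∑ V (λ v → ⟦ B v ⟧ * back v)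
          ≤⟨ combine n W m M b (∑ V (λ v → ⟦ B v ⟧ * deg v B)) (∑ V (λ v → ⟦ B v ⟧ * back v)) ∑-deg (∑-back out 0<b) ⟩
        8 * (m * M * W) * b ∎

  Removable-cong : ∀ {B B′ : Fin n → Bool} → (∀ u → B u ≡ B′ u) → ∀ v → Removable B v → Removable B′ v
  Removable-cong {B} {B′} h v (removable p q) = removable
    (≤-trans (≤-reflexive (cong (n *_) (sym (deg-cong v h)))) p)
    (≤-trans (≤-reflexive (cong (n *_) (∑-cong V λ u →
      cong₂ (λ c d → ⟦ not c ⟧ * (mult u v * heavy d)) (sym (h u)) (sym (deg-cong u h))))) q)

  -- Vertices eliminated earlier have larger ht.
  record Order (B : Fin n → Bool) (j : ℕ) : Set where
    field
      ht        : Fin n → ℕ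
      ht≤       : ∀ v → B v ≡ true → ht v ≤ j
      injective : ∀ u v → B u ≡ true → B v ≡ true → ht u ≡ ht v → u ≡ v
      removal   : ∀ v → B v ≡ true → Removable (λ u → B u ∧ (ht u ≤ᵇ ht v)) v

  without : (Fin n → Bool) → Fin n → Fin n → Bool
  without B w u = B u ∧ not (u == w)

  extend : ∀ j B w → B w ≡ true → Removable B w → Order (without B w) j → Order B (suc j)
  extend j B w bw rem o = record { ht = h ; ht≤ = h≤ ; injective = inj ; removal = remv }
    where
    open Order o renaming (ht to h′; ht≤ to h′≤; injective to inj′; removal to rem′)
    h : Fin n → ℕ
    h u = if u == w then suc j else h′ u
    B′-intro : ∀ u → u ≢ w → B u ≡ true → without B w u ≡ true
    B′-intro u u≢w bu = ∧-intro bu (cong not (≢⇒== u≢w))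
    h≤ : ∀ u → B u ≡ true → h u ≤ suc j
    h≤ u bu with u Fin.≟ w
    ... | yes _  = ≤-refl
    ... | no u≢w = ≤-trans (h′≤ u (B′-intro u u≢w bu)) (n≤1+n j)
    inj : ∀ u v → B u ≡ true → B v ≡ true → h u ≡ h v → u ≡ v
    inj u v bu bv eq with u Fin.≟ w | v Fin.≟ w
    ... | yes refl | yes refl = refl
    ... | yes refl | no v≢w   = contradiction (≤-trans (≤-reflexive eq) (h′≤ v (B′-intro v v≢w bv))) (<⇒≱ (n<1+n j))
    ... | no u≢w   | yes refl = contradiction (≤-trans (≤-reflexive (sym eq)) (h′≤ u (B′-intro u u≢w bu))) (<⇒≱ (n<1+n j))
    ... | no u≢w   | no v≢w   = inj′ u v (B′-intro u u≢w bu) (B′-intro v v≢w bv) eq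
    below-w : ∀ u → B u ≡ B u ∧ (h u ≤ᵇ h w)
    below-w u with B u in bu
    ... | false = refl
    ... | true  = sym (≤ᵇ-true (subst (h u ≤_) (cong (λ c → if c then suc j else h′ w) (sym (==-refl w))) (h≤ u bu)))
    below-v : ∀ v → B v ≡ true → v ≢ w → ∀ u → without B w u ∧ (h′ u ≤ᵇ h′ v) ≡ B u ∧ (h u ≤ᵇ h v)
    below-v v bv v≢w u rewrite ≢⇒== v≢w with B u | u Fin.≟ w
    ... | false | _      = refl
    ... | true  | yes _  = sym (≤ᵇ-false (s≤s (h′≤ v (B′-intro v v≢w bv))))
    ... | true  | no _   = refl
    remv : ∀ v → B v ≡ true → Removable (λ u → B u ∧ (h u ≤ᵇ h v)) v
    remv v bv = cases (v Fin.≟ w)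
      where cases : Dec (v ≡ w) → Removable (λ u → B u ∧ (h u ≤ᵇ h v)) v
            cases (yes refl) = Removable-cong below-w w rem
            cases (no v≢w)   = Removable-cong (below-v v bv v≢w) v (rem′ v (B′-intro v v≢w bv))

  order : ∀ j B → size B ≡ j → (∀ u → B u ≡ false → Light B u) → Order B j
  order zero B sz out = record
    { ht = λ _ → 0
    ; ht≤ = λ _ _ → z≤n
    ; injective = λ u v bu → contradiction (size-> B u bu) (λ p → <⇒≢ p (sym sz))
    ; removal = λ v bv → contradiction (size-> B v bv) (λ p → <⇒≢ p (sym sz)) }
  order (suc j) B sz out =
    let w , bw , rem = pick B out (≤-trans (s≤s z≤n) (≤-reflexive (sym sz)))
    in extend j B w bw rem (order j (without B w) (size-without w bw) (light-without w rem))
    where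
    size-without : ∀ w → B w ≡ true → size (without B w) ≡ j
    size-without w bw = suc-injective (trans (trans (+-comm 1 _) (trans (cong (size (without B w) +_) (sym (∑-δ₁ w)))
      (trans (sym (∑-+ V _ _)) (∑-cong V pt)))) sz)
      where pt : ∀ u → ⟦ without B w u ⟧ + ⟦ u == w ⟧ ≡ ⟦ B u ⟧
            pt u with u Fin.≟ w
            ... | yes refl rewrite bw = refl
            ... | no _ = trans (+-identityʳ _) (cong ⟦_⟧ (Bool.∧-identityʳ (B u)))
    light-without : ∀ w → Removable B w → ∀ u → without B w u ≡ false → Light (without B w) u
    light-without w rem u p =
      light (≤-trans (*-monoʳ-≤ n (deg-mono u {without B w} {B} (λ v q → proj₁ (∧-split q)))) (Light.degree≤ (cases (B u) refl (u Fin.≟ w))))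
      where cases : ∀ c → B u ≡ c → Dec (u ≡ w) → Light B u
            cases false bu _          = out u bu
            cases true  bu (yes refl) = light (Removable.degree≤ rem)
            cases true  bu (no u≢w)   = ⊥-elim (true≢false (∧-intro bu (cong not (≢⇒== u≢w))) p)

-- Orientation along the elimination order

module Orientation {n : ℕ} (G : Graph n) (M : ℕ) (0<M : 0 < M) (0<m : 0 < Base.m G)
  (optBound : ∑ (seqs (Base.m G) n) (Base.opt G) ≤ M * Base.m G ^ n)
  (ht : Fin n → ℕ) (ht-injective : ∀ u v → ht u ≡ ht v → u ≡ v)
  (removal : ∀ v → Elimination.Removable G M 0<M 0<m optBound (λ u → ht u ≤ᵇ ht v) v) where
  open Base G
  open Elimination G M 0<M 0<m optBound using (heavy; W; removable; back)

  below : Fin n → Fin n → Bool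
  below v u = ht u ≤ᵇ ht v

  dir : Fin m → Bool
  dir e = ht (y e) ≤ᵇ ht (x e)

  hd tl : Fin m → Fin n
  hd e = target (dir e) (edge G e)
  tl e = target (not (dir e)) (edge G e)

  tl<hd : ∀ e → ht (tl e) < ht (hd e)
  tl<hd e with ht (y e) ≤ᵇ ht (x e) in c
  ... | true  = ≤∧≢⇒< (≤ᵇ-sound c) (λ p → x≢y e (sym (ht-injective _ _ p)))
  ... | false = ≤ᵇ-refute c

  ends : ∀ e → (hd e ≡ x e × tl e ≡ y e) ⊎ (hd e ≡ y e × tl e ≡ x e)
  ends e with dir e
  ... | true  = inj₁ (refl , refl)
  ... | false = inj₂ (refl , refl)

  hd-from-ht : ∀ e → ht (y e) ≤ ht (x e) → hd e ≡ x e × tl e ≡ y e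
  hd-from-ht e p rewrite ≤ᵇ-true p = refl , refl

  hd-from-ht′ : ∀ e → ht (x e) < ht (y e) → hd e ≡ y e × tl e ≡ x e
  hd-from-ht′ e p rewrite ≤ᵇ-false p = refl , refl

  link-intro : ∀ e (B : Fin n → Bool) → B (tl e) ≡ true → link (hd e) B e ≡ true
  link-intro e B h with dir e
  ... | true  rewrite ==-refl (x e) | h = refl
  ... | false rewrite ==-refl (y e) | h with (x e == y e) ∧ B (y e)
  ... | true  = refl
  ... | false = refl

  link-elim : ∀ u v e → ht v < ht u → link u (below v) e ≡ true → hd e ≡ u × ht (tl e) ≤ ht v
  link-elim u v e lt l with link-sound u (below v) e l
  ... | inj₁ (refl , b) = let p , q = hd-from-ht e (≤-trans (≤ᵇ-sound b) (<⇒≤ lt)) in p , subst (λ z → ht z ≤ ht v) (sym q) (≤ᵇ-sound b)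
  ... | inj₂ (refl , b) = let p , q = hd-from-ht′ e (≤-<-trans (≤ᵇ-sound b) lt) in p , subst (λ z → ht z ≤ ht v) (sym q) (≤ᵇ-sound b)

  out : Fin n → ℕ
  out w = ∑ EI λ e → ⟦ hd e == w ⟧

  reach : Fin m → ℕ
  reach e = ∑ EI λ e′ → ⟦ (hd e′ == hd e) ∧ (ht (tl e′) ≤ᵇ ht (tl e)) ⟧

  out≤ : ∀ w → n * out w ≤ 4 * (m * M)
  out≤ w = ≤-trans (*-monoʳ-≤ n (∑-mono EI λ e → ⟦⟧-mono (pt e)))
    (Elimination.Removable.degree≤ {G = G} {M} {0<M} {0<m} {optBound} {below w} {w} (removal w))
    where pt : ∀ e → (hd e == w) ≡ true → link w (below w) e ≡ true
          pt e h with ==⇒≡ (hd e) w h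
          ... | refl = link-intro e (below (hd e)) (≤ᵇ-true (<⇒≤ (tl<hd e)))

  -- `below (tl e)` is what remained just before the tail of `e` was removed, so `heavy (reach e)`
  -- is the heaviness of the head of `e` at that moment, as it occurs in `back`.
  reach≡deg : ∀ e → reach e ≡ deg (hd e) (below (tl e))
  reach≡deg e = ≤-antisym (∑-mono EI λ e′ → ⟦⟧-mono (to e′)) (∑-mono EI λ e′ → ⟦⟧-mono (from e′))
    where
    to : ∀ e′ → (hd e′ == hd e) ∧ (ht (tl e′) ≤ᵇ ht (tl e)) ≡ true → link (hd e) (below (tl e)) e′ ≡ true
    to e′ h = subst (λ z → link z (below (tl e)) e′ ≡ true) (==⇒≡ (hd e′) (hd e) (proj₁ (∧-split h)))
      (link-intro e′ (below (tl e)) (proj₂ (∧-split {hd e′ == hd e} h)))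
    from : ∀ e′ → link (hd e) (below (tl e)) e′ ≡ true → (hd e′ == hd e) ∧ (ht (tl e′) ≤ᵇ ht (tl e)) ≡ true
    from e′ l = let p , q = link-elim (hd e) (tl e) e′ (tl<hd e) l in
      ∧-intro (trans (cong (_== hd e) p) (==-refl (hd e))) (≤ᵇ-true q)

  -- The bound on `back` at the removal of `w`: an edge with tail `w` has its head among the
  -- vertices already removed and is counted there.
  incoming≤ : ∀ w → n * ∑ EI (λ e → ⟦ tl e == w ⟧ * heavy (reach e)) ≤ 8 * (m * M * W)
  incoming≤ w = ≤-trans (*-monoʳ-≤ n (≤-trans (∑-mono EI pt) (≤-reflexive (sym expand))))
    (Elimination.Removable.back≤ {G = G} {M} {0<M} {0<m} {optBound} {below w} {w} (removal w))
    where
    term : Fin m → Fin n → ℕ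
    term e u = ⟦ not (below w u) ⟧ * (joins e u w * heavy (deg u (below w)))
    expand : back (below w) w ≡ ∑ EI (λ e → ∑ V (term e))
    expand = trans (∑-cong V λ u → trans (cong (⟦ not (below w u) ⟧ *_) (sym (∑-*ʳ EI (λ e → joins e u w) (heavy (deg u (below w))))))
      (sym (∑-*ˡ EI ⟦ not (below w u) ⟧ _))) (∑-swap V EI _)
    joins-ends : ∀ e → 1 ≤ joins e (hd e) (tl e)
    joins-ends e with ends e
    ... | inj₁ (p , q) rewrite p | q | ==-refl (x e) | ==-refl (y e) = s≤s z≤n
    ... | inj₂ (p , q) rewrite p | q | ==-refl (x e) | ==-refl (y e) = m≤n+m 1 _
    pt : ∀ e → ⟦ tl e == w ⟧ * heavy (reach e) ≤ ∑ V (term e)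
    pt e = ⟦⟧*-≤ (tl e == w) λ h → ≤-trans (at w (==⇒≡ (tl e) w h)) (∑-allFin-term (term e) (hd e))
      where
      at : ∀ w → tl e ≡ w → heavy (reach e) ≤ ⟦ not (below w (hd e)) ⟧ * (joins e (hd e) w * heavy (deg (hd e) (below w)))
      at .(tl e) refl rewrite ≤ᵇ-false (tl<hd e) = begin
        heavy (reach e)                                                          ≡⟨ cong heavy (reach≡deg e) ⟩
        heavy (deg (hd e) (below (tl e)))                                        ≤⟨ m≤n*m (heavy (deg (hd e) (below (tl e)))) (joins e (hd e) (tl e)) {{>-nonZero (joins-ends e)}} ⟩
        joins e (hd e) (tl e) * heavy (deg (hd e) (below (tl e)))                ≡⟨ *-identityˡ _ ⟨
        1 * (joins e (hd e) (tl e) * heavy (deg (hd e) (below (tl e))))          ∎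
        where open ≤-Reasoning

-- Classes of edges

argmax : ∀ {m} (p : Fin m → Bool) (f : Fin m → ℕ) →
         (∀ e → p e ≡ false) ⊎ (∃ λ e → p e ≡ true × (∀ e′ → p e′ ≡ true → f e′ ≤ f e))
argmax {zero}  p f = inj₁ λ ()
argmax {suc m} p f with p zero in p0 | argmax (p ∘ suc) (f ∘ suc)
... | false | inj₁ none = inj₁ λ { zero → p0 ; (suc e) → none e }
... | false | inj₂ (e , pe , mx) = inj₂ (suc e , pe , λ { zero q → ⊥-elim (true≢false q p0) ; (suc e′) q → mx e′ q })
... | true  | inj₁ none = inj₂ (zero , p0 , λ { zero q → ≤-refl ; (suc e′) q → ⊥-elim (true≢false q (none e′)) })
... | true  | inj₂ (e , pe , mx) with ≤-total (f zero) (f (suc e))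
... | inj₁ le = inj₂ (suc e , pe , λ { zero q → le ; (suc e′) q → mx e′ q })
... | inj₂ ge = inj₂ (zero , p0 , λ { zero q → ≤-refl ; (suc e′) q → ≤-trans (mx e′ q) ge })

-- Each value is the square of the one before, so rounding a rate to a tower at most doubles an
-- exponent, while the index `R` of order log log n already reaches `n`.
tower : ℕ → ℕ
tower j = 2 ^ (2 ^ j)

Z-suc : ∀ j → tower (suc j) ≡ tower j * tower j
Z-suc j = trans (cong (λ z → 2 ^ (2 ^ j + z)) (+-identityʳ (2 ^ j))) (^-distribˡ-+-* 2 (2 ^ j) (2 ^ j))

Z-mono : ∀ {i j} → i ≤ j → tower i ≤ tower j
Z-mono p = ^-monoʳ-≤ 2 (^-monoʳ-≤ 2 p)

2≤Z : ∀ j → 2 ≤ tower j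
2≤Z j = Z-mono {0} {j} z≤n

module _ (a b : ℕ) where
  classOf : ℕ → ℕ
  classOf zero    = 0
  classOf (suc j) = if a * tower (suc j) ≤ᵇ b then suc j else classOf j

  classOf≤ : ∀ R → classOf R ≤ R
  classOf≤ zero    = z≤n
  classOf≤ (suc j) with a * tower (suc j) ≤ᵇ b
  ... | true  = ≤-refl
  ... | false = ≤-trans (classOf≤ j) (n≤1+n j)

  classOf-fits : ∀ R → a * tower 0 ≤ b → a * tower (classOf R) ≤ b
  classOf-fits zero    h = h
  classOf-fits (suc j) h with a * tower (suc j) ≤ᵇ b in c
  ... | true  = ≤ᵇ-sound c
  ... | false = classOf-fits j h

  classOf-maximal : ∀ R → classOf R ≡ R ⊎ b < a * tower (suc (classOf R))
  classOf-maximal zero    = inj₁ refl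
  classOf-maximal (suc j) with a * tower (suc j) ≤ᵇ b in c
  ... | true  = inj₁ refl
  ... | false with classOf-maximal j
  ... | inj₁ p = inj₂ (subst (λ i → b < a * tower (suc i)) (sym p) (≤ᵇ-refute c))
  ... | inj₂ q = inj₂ q

-- Blocks of `n / l` trials. The 4 in the hypothesis consists of a factor 2 for rounding `n / l` and
-- a factor 2 that remains as mean above 2/z per block, which with 2 ≤ z gives a success in the
-- block with probability at least 1/z.
binTail-class : ∀ m n d l z → d ≤ m → 0 < l → l ≤ n → 2 ≤ z → m * (4 * l) < n * d * z →
                m ^ n ≤ z ^ l * binTail d (m ∸ d) n l
binTail-class m n d l z d≤m 0<l l≤n 2≤z h =
  subst (λ t → m ^ t ≤ z ^ l * binTail d (m ∸ d) t l) (sym n≡)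
    (subst (λ t → t ^ (r + l * k) ≤ z ^ l * binTail d (m ∸ d) (r + l * k) l) (m+[n∸m]≡n d≤m)
      (binTail-lower d (m ∸ d) k r l z kd>0 (subst (λ t → t + k * d ≤ z * (k * d)) (sym (m+[n∸m]≡n d≤m)) m+kd≤)))
  where
  open ≤-Reasoning
  instance _ = >-nonZero 0<l
  k r : ℕ
  k = n / l
  r = n % l
  n≡ : n ≡ r + l * k
  n≡ = trans (m≡m%n+[m/n]*n n l) (cong (r +_) (*-comm k l))
  n≤ : n ≤ 2 * (l * k)
  n≤ = begin
    n                ≡⟨ n≡ ⟩
    r + l * k        ≤⟨ +-monoˡ-≤ (l * k) (≤-trans (<⇒≤ (m%n<n n l)) (m≤m*n l k {{>-nonZero (m≥n⇒m/n>0 l≤n)}})) ⟩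
    l * k + l * k    ≡⟨ cong (l * k +_) (+-identityʳ (l * k)) ⟨
    2 * (l * k)      ∎
  2m< : 2 * m < z * (k * d)
  2m< = *-cancelˡ-< (2 * l) _ _ (begin-strict
    2 * l * (2 * m)              ≡⟨ r₁ l m ⟩
    m * (4 * l)                  <⟨ h ⟩
    n * d * z                    ≤⟨ *-monoˡ-≤ z (*-monoˡ-≤ d n≤) ⟩
    2 * (l * k) * d * z          ≡⟨ r₂ l k d z ⟩
    2 * l * (z * (k * d))        ∎)
    where r₁ : ∀ l m → 2 * l * (2 * m) ≡ m * (4 * l)
          r₁ = solve-∀
          r₂ : ∀ l k d z → 2 * (l * k) * d * z ≡ 2 * l * (z * (k * d))
          r₂ = solve-∀
  kd>0 : 0 < k * d
  kd>0 with k * d in eq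
  ... | zero  = contradiction (≤-trans 2m< (≤-reflexive (trans (cong (z *_) eq) (*-zeroʳ z)))) λ ()
  ... | suc _ = s≤s z≤n
  m+kd≤ : m + k * d ≤ z * (k * d)
  m+kd≤ = *-cancelˡ-≤ 2 (begin
    2 * (m + k * d)                  ≡⟨ *-distribˡ-+ 2 m (k * d) ⟩
    2 * m + 2 * (k * d)              ≤⟨ +-mono-≤ (<⇒≤ 2m<) (*-monoˡ-≤ (k * d) 2≤z) ⟩
    z * (k * d) + z * (k * d)        ≡⟨ cong (z * (k * d) +_) (+-identityʳ _) ⟨
    2 * (z * (k * d))                ∎)

cancel-sequences : ∀ n W D g Q m M → 0 < W → 0 < M → n * W * g * D ≤ Q * (8 * (m * M * W) + m * W) → n * (g * D) ≤ 9 * (m * M) * Q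
cancel-sequences n W D g Q m M 0<W 0<M h = *-cancelʳ-≤ _ _ W {{>-nonZero 0<W}} (begin
  n * (g * D) * W                        ≡⟨ r₁ n g D W ⟩
  n * W * g * D                          ≤⟨ h ⟩
  Q * (8 * (m * M * W) + m * W)          ≤⟨ *-monoʳ-≤ Q (+-monoʳ-≤ (8 * (m * M * W)) (*-monoˡ-≤ W (m≤m*n m M {{>-nonZero 0<M}}))) ⟩
  Q * (8 * (m * M * W) + m * M * W)      ≡⟨ r₂ m M W Q ⟩
  9 * (m * M) * Q * W                    ∎)
  where
  open ≤-Reasoning
  r₁ : ∀ n g D W → n * (g * D) * W ≡ n * W * g * D
  r₁ = solve-∀
  r₂ : ∀ m M W Q → Q * (8 * (m * M * W) + m * M * W) ≡ 9 * (m * M) * Q * W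
  r₂ = solve-∀

scale-down : ∀ c n m M Y Q a → 0 < n → m ≤ n * Y → n * a ≤ c * (m * M) * Q → a ≤ c * (Y * M) * Q
scale-down c n m M Y Q a 0<n h p = *-cancelˡ-≤ n {{>-nonZero 0<n}} (begin
  n * a                      ≤⟨ p ⟩
  c * (m * M) * Q            ≤⟨ *-monoˡ-≤ Q (*-monoʳ-≤ c (*-monoˡ-≤ M h)) ⟩
  c * (n * Y * M) * Q        ≡⟨ r c n Y M Q ⟩
  n * (c * (Y * M) * Q)      ∎)
  where
  open ≤-Reasoning
  r : ∀ c n Y M Q → c * (n * Y * M) * Q ≡ n * (c * (Y * M) * Q)
  r = solve-∀

module Classes {m n : ℕ} (M R : ℕ) (0<M : 0 < M) (0<m : 0 < m) (3M≤n : 3 * M ≤ n) (n≤ZR : n ≤ tower R)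
  (hd tl : Fin m → Fin n) (ht : Fin n → ℕ) where

  EI : List (Fin m)
  EI = allFin m

  out : Fin n → ℕ
  out w = ∑ EI λ e → ⟦ hd e == w ⟧

  reach : Fin m → ℕ
  reach e = ∑ EI λ e′ → ⟦ (hd e′ == hd e) ∧ (ht (tl e′) ≤ᵇ ht (tl e)) ⟧

  heavy : ℕ → ℕ
  heavy d = binTail d (m ∸ d) n (3 * M)

  module _ (out≤ : ∀ w → n * out w ≤ 4 * (m * M))
           (incoming≤ : ∀ w → n * ∑ EI (λ e → ⟦ tl e == w ⟧ * heavy (reach e)) ≤ 8 * (m * M * m ^ n)) where

    -- `κ` is the rate 4l of `binTail-class` for l = 3M. The capacity `k` has a part 2(3M), which
    -- compares rejection with heaviness, and a part `g`, whose surplus `2 ^ g` pays for all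
    -- branching constants.
    W κ g k Y₀ Y : ℕ
    W = m ^ n
    κ = 4 * (3 * M)
    g = 58 * M
    k = g + 2 * (3 * M)

    0<n : 0 < n
    0<n = ≤-trans (*-mono-≤ {1} {3} (s≤s z≤n) 0<M) 3M≤n

    private instance
      n≢0 : NonZero n
      n≢0 = >-nonZero 0<n

    -- Two roundings of m/n: the charge for an edge of an exploration must not exceed m/n, hence
    -- `Y₀`; degree bounds need at least m/n, hence `Y`. An arrived edge gets weight `1 + Y₀`, which
    -- is `Y`.
    Y₀ = m / n
    Y = suc Y₀

    0<W : 0 < W
    0<W = m^n>0 m {{>-nonZero 0<m}} n

    m≤nY : m ≤ n * Y
    m≤nY = begin
      m                   ≡⟨ m≡m%n+[m/n]*n m n ⟩
      m % n + m / n * n   ≤⟨ +-monoˡ-≤ (m / n * n) (<⇒≤ (m%n<n m n)) ⟩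
      n + m / n * n       ≡⟨ *-comm Y n ⟩
      n * Y               ∎
      where open ≤-Reasoning

    nY₀≤m : n * Y₀ ≤ m
    nY₀≤m = begin
      n * (m / n)            ≡⟨ *-comm n (m / n) ⟩
      m / n * n              ≤⟨ m≤n+m _ (m % n) ⟩
      m % n + m / n * n      ≡⟨ m≡m%n+[m/n]*n m n ⟨
      m                      ∎
      where open ≤-Reasoning

    cls : Fin m → ℕ
    cls e = classOf (n * reach e) (m * κ) R

    cls≤R : ∀ e → cls e ≤ R
    cls≤R e = classOf≤ (n * reach e) (m * κ) R

    reach≤out : ∀ e → reach e ≤ out (hd e)
    reach≤out e = ∑-mono EI λ e′ → ⟦⟧-mono (λ h → proj₁ (∧-split h))

    fits : ∀ e → n * reach e * tower (cls e) ≤ m * κ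
    fits e = classOf-fits (n * reach e) (m * κ) R (begin
      n * reach e * 2            ≤⟨ *-monoˡ-≤ 2 (≤-trans (*-monoʳ-≤ n (reach≤out e)) (out≤ (hd e))) ⟩
      4 * (m * M) * 2            ≤⟨ m≤m+n _ (4 * (m * M)) ⟩
      4 * (m * M) * 2 + 4 * (m * M)  ≡⟨ ring m M ⟩
      m * κ                      ∎)
      where
      open ≤-Reasoning
      ring : ∀ m M → 4 * (m * M) * 2 + 4 * (m * M) ≡ m * (4 * (3 * M))
      ring = solve-∀

    inClass : Fin n → ℕ → Fin m → Bool
    inClass u c e = (hd e == u) ∧ (c ≤ᵇ cls e)

    -- Among the edges counted take one whose tail has the largest height. Its `reach` includes all
    -- the others, and its own class limits its `reach`.
    class-size : ∀ u c → n * ∑ EI (λ e → ⟦ inClass u c e ⟧) * tower c ≤ m * κ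
    class-size u c with argmax (inClass u c) (ht ∘ tl)
    ... | inj₁ none = ≤-trans (≤-reflexive (trans (cong (λ q → n * q * tower c) (∑-zero EI λ e → cong ⟦_⟧ (none e)))
                        (cong (_* tower c) (*-zeroʳ n)))) z≤n
    ... | inj₂ (e , q , mx) = ≤-trans (*-mono-≤ (*-monoʳ-≤ n (∑-mono EI λ e′ → ⟦⟧-mono (sub e′)))
                                              (Z-mono (≤ᵇ-sound {c} (proj₂ (∧-split {hd e == u} q))))) (fits e)
      where sub : ∀ e′ → inClass u c e′ ≡ true → (hd e′ == hd e) ∧ (ht (tl e′) ≤ᵇ ht (tl e)) ≡ true
            sub e′ h with ==⇒≡ (hd e) u (proj₁ (∧-split q))
            ... | refl = ∧-intro (proj₁ (∧-split h)) (≤ᵇ-true (mx e′ h))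

    Q : ℕ
    Q = tower R ^ k

    -- `tower c` to the power -k over the common denominator `Q`: up to a factor `8 ^ κ`, a bound on
    -- the probability that a head accepts `k` arrivals of class at least `c`.
    ω : ℕ → ℕ
    ω c = 2 ^ ((2 ^ R ∸ 2 ^ c) * k)

    Z^k*ω : ∀ c → c ≤ R → tower c ^ k * ω c ≡ Q
    Z^k*ω c c≤R = begin
      tower c ^ k * ω c                              ≡⟨ cong (_* ω c) (^-*-assoc 2 (2 ^ c) k) ⟩
      2 ^ (2 ^ c * k) * 2 ^ ((2 ^ R ∸ 2 ^ c) * k) ≡⟨ ^-distribˡ-+-* 2 (2 ^ c * k) _ ⟨
      2 ^ (2 ^ c * k + (2 ^ R ∸ 2 ^ c) * k)       ≡⟨ cong (2 ^_) (*-distribʳ-+ k (2 ^ c) _) ⟨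
      2 ^ ((2 ^ c + (2 ^ R ∸ 2 ^ c)) * k)         ≡⟨ cong (λ z → 2 ^ (z * k)) (m+[n∸m]≡n (^-monoʳ-≤ 2 c≤R)) ⟩
      2 ^ (2 ^ R * k)                            ≡⟨ ^-*-assoc 2 (2 ^ R) k ⟨
      Q                                          ∎
      where open ≡-Reasoning

    reach≤m : ∀ e → reach e ≤ m
    reach≤m e = ≤-trans (m≤m+n _ _) (≤-reflexive (∑-⟦⟧+∑-⟦not⟧ m (λ e′ → (hd e′ == hd e) ∧ (ht (tl e′) ≤ᵇ ht (tl e)))))

    -- Rejection is rarer by `2 ^ g` than heaviness plus 1/n. Below the top class, maximality of the
    -- class makes the heaviness at least `tower (suc c)` to the power -3M, which is `tower c` to
    -- the power -6M. In the top class `tower R` is at least `n`, and the summand 1/n suffices.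
    edge-weight : ∀ e → n * W * 2 ^ g * ω (cls e) ≤ Q * (n * heavy (reach e) + W)
    edge-weight e with classOf-maximal (n * reach e) (m * κ) R
    ... | inj₁ top = begin
      n * W * 2 ^ g * ω (cls e)            ≡⟨ cong (λ c → n * W * 2 ^ g * ω c) top ⟩
      n * W * 2 ^ g * ω R                  ≡⟨ cong (λ z → n * W * 2 ^ g * 2 ^ (z * k)) (n∸n≡0 (2 ^ R)) ⟩
      n * W * 2 ^ g * 1                    ≡⟨ ring n W (2 ^ g) ⟩
      n * 2 ^ g * W                        ≤⟨ *-monoˡ-≤ W (*-mono-≤ n≤ZR (^-monoˡ-≤ g (2≤Z R))) ⟩
      tower R * tower R ^ g * W                    ≤⟨ *-monoˡ-≤ W (^-monoʳ-≤ (tower R) {{>-nonZero (≤-trans (s≤s z≤n) (2≤Z R))}} 1+g≤k) ⟩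
      Q * W                                ≤⟨ *-monoʳ-≤ Q (m≤n+m W (n * heavy (reach e))) ⟩
      Q * (n * heavy (reach e) + W)        ∎
      where
      open ≤-Reasoning
      ring : ∀ n W a → n * W * a * 1 ≡ n * a * W
      ring = solve-∀
      1+g≤k : suc g ≤ k
      1+g≤k = ≤-trans (≤-reflexive (+-comm 1 g)) (+-monoʳ-≤ g (*-mono-≤ {1} {2} {1} {3 * M} (s≤s z≤n) (*-mono-≤ {1} {3} {1} {M} (s≤s z≤n) 0<M)))
    ... | inj₂ next = begin
      n * W * 2 ^ g * ω c                            ≤⟨ *-monoˡ-≤ (ω c) (*-mono-≤ (*-monoʳ-≤ n W≤) (^-monoˡ-≤ g (2≤Z c))) ⟩
      n * (tower (suc c) ^ l * heavy (reach e)) * tower c ^ g * ω c   ≡⟨ cong (λ z → n * (z * heavy (reach e)) * tower c ^ g * ω c) Zl ⟩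
      n * (tower c ^ (2 * l) * heavy (reach e)) * tower c ^ g * ω c   ≡⟨ ring n (tower c ^ (2 * l)) (heavy (reach e)) (tower c ^ g) (ω c) ⟩
      tower c ^ g * tower c ^ (2 * l) * ω c * (n * heavy (reach e))   ≡⟨ cong (λ z → z * ω c * (n * heavy (reach e))) (^-distribˡ-+-* (tower c) g (2 * l)) ⟨
      tower c ^ k * ω c * (n * heavy (reach e))          ≡⟨ cong (_* (n * heavy (reach e))) (Z^k*ω c (cls≤R e)) ⟩
      Q * (n * heavy (reach e))                      ≤⟨ *-monoʳ-≤ Q (m≤m+n _ W) ⟩
      Q * (n * heavy (reach e) + W)                  ∎
      where
      open ≤-Reasoning
      c l : ℕ
      c = cls e
      l = 3 * M
      W≤ : W ≤ tower (suc c) ^ l * heavy (reach e)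
      W≤ = binTail-class m n (reach e) l (tower (suc c)) (reach≤m e) (*-mono-≤ {1} {3} (s≤s z≤n) 0<M) 3M≤n (2≤Z (suc c)) next
      Zl : tower (suc c) ^ l ≡ tower c ^ (2 * l)
      Zl = trans (cong (_^ l) (trans (Z-suc c) (cong (tower c *_) (sym (*-identityʳ (tower c)))))) (^-*-assoc (tower c) 2 l)
      ring : ∀ n a h b w → n * (a * h) * b * w ≡ b * a * w * (n * h)
      ring = solve-∀

    into : Fin n → ℕ
    into w = ∑ EI λ e → ⟦ tl e == w ⟧ * ω (cls e)

    -- Of the 9, 8 comes from `incoming≤` and 1 from the summand 1/n of `edge-weight`, added over at
    -- most `m` edges.
    into≤ : ∀ w → 2 ^ g * into w ≤ 9 * (Y * M) * Q
    into≤ w = scale-down 9 n m M Y Q (2 ^ g * into w) 0<n m≤nY (cancel-sequences n W (into w) (2 ^ g) Q m M 0<W 0<M (begin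
      n * W * 2 ^ g * into w
        ≡⟨ ∑-*ˡ EI (n * W * 2 ^ g) (λ e → ⟦ tl e == w ⟧ * ω (cls e)) ⟨
      ∑ EI (λ e → n * W * 2 ^ g * (⟦ tl e == w ⟧ * ω (cls e)))
        ≤⟨ ∑-mono EI each ⟩
      ∑ EI (λ e → Q * (n * (⟦ tl e == w ⟧ * heavy (reach e)) + W))
        ≡⟨ ∑-*ˡ EI Q (λ e → n * (⟦ tl e == w ⟧ * heavy (reach e)) + W) ⟩
      Q * ∑ EI (λ e → n * (⟦ tl e == w ⟧ * heavy (reach e)) + W)
        ≡⟨ cong (Q *_) (trans (∑-+ EI (λ e → n * (⟦ tl e == w ⟧ * heavy (reach e))) (λ _ → W))
             (cong₂ _+_ (∑-*ˡ EI n (λ e → ⟦ tl e == w ⟧ * heavy (reach e))) (∑-allFin-const m W))) ⟩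
      Q * (n * ∑ EI (λ e → ⟦ tl e == w ⟧ * heavy (reach e)) + m * W)
        ≤⟨ *-monoʳ-≤ Q (+-monoˡ-≤ (m * W) (incoming≤ w)) ⟩
      Q * (8 * (m * M * W) + m * W) ∎))
      where
      open ≤-Reasoning
      each : ∀ e → n * W * 2 ^ g * (⟦ tl e == w ⟧ * ω (cls e)) ≤ Q * (n * (⟦ tl e == w ⟧ * heavy (reach e)) + W)
      each e with tl e == w
      ... | false = ≤-trans (≤-reflexive (*-zeroʳ (n * W * 2 ^ g))) z≤n
      ... | true  = subst₂ _≤_ (cong (n * W * 2 ^ g *_) (sym (*-identityˡ (ω (cls e)))))
                      (cong (λ z → Q * (n * z + W)) (sym (*-identityˡ (heavy (reach e))))) (edge-weight e)

    out-bound : ∀ w → out w ≤ 4 * (Y * M)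
    out-bound w = ≤-trans (scale-down 4 n m M Y 1 (out w) 0<n m≤nY
      (≤-trans (out≤ w) (≤-reflexive (sym (*-identityʳ (4 * (m * M))))))) (≤-reflexive (*-identityʳ (4 * (Y * M))))

-- Greedy orientation of a rejected component

∑-mono-∈ : {A : Set} (xs : List A) {f g : A → ℕ} → (∀ {x} → x ∈ xs → f x ≤ g x) → ∑ xs f ≤ ∑ xs g
∑-mono-∈ []       h = z≤n
∑-mono-∈ (x ∷ xs) h = +-mono-≤ (h (here refl)) (∑-mono-∈ xs (h ∘ there))

elem : ∀ {n} → Fin n → List (Fin n) → Bool
elem v []       = false
elem v (x ∷ xs) = (v == x) ∨ elem v xs

size-elem : ∀ {n} (xs : List (Fin n)) → size (λ v → elem v xs) ≤ length xs
size-elem {n} []       = ≤-reflexive (∑-zero (allFin n) λ _ → refl)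
size-elem {n} (x ∷ xs) = begin
  ∑ (allFin n) (λ v → ⟦ (v == x) ∨ elem v xs ⟧)         ≤⟨ ∑-mono (allFin n) (λ v → pt (v == x) (elem v xs)) ⟩
  ∑ (allFin n) (λ v → ⟦ v == x ⟧ + ⟦ elem v xs ⟧)       ≡⟨ ∑-+ (allFin n) _ _ ⟩
  ∑ (allFin n) (λ v → ⟦ v == x ⟧) + size (λ v → elem v xs) ≤⟨ +-mono-≤ (≤-reflexive (∑-δ₁ x)) (size-elem xs) ⟩
  suc (length xs)                                       ∎
  where open ≤-Reasoning
        pt : ∀ a b → ⟦ a ∨ b ⟧ ≤ ⟦ a ⟧ + ⟦ b ⟧
        pt true  b = s≤s z≤n
        pt false b = ≤-refl

module Levels {n : ℕ} {A : Set} (rs : List A) (place other : A → Fin n) (μ : ℕ) (0<μ : 0 < μ)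
  (dense : ∀ Z → ∑ rs (λ r → ⟦ Z (place r) ∧ Z (other r) ⟧) ≤ μ * size Z)
  (threshold : ∀ v a → ∑ rs (λ r → ⟦ place r == v ⟧) ≤
               a + ∑ rs (λ r → ⟦ (place r == v) ∧ (a ≤ᵇ ∑ rs (λ r′ → ⟦ place r′ == other r ⟧)) ⟧))
  (D : Fin n → Bool) (closed : ∀ {r} → r ∈ rs → D (place r) ≡ true → D (other r) ≡ true)
  (hs : List (Fin n))
  (heads : ∀ {r} → r ∈ rs → D (place r) ≡ true → elem (place r) hs ≡ false → elem (other r) hs ≡ true) where
  private
    V = allFin n
    gl : Fin n → ℕ
    gl v = ∑ rs (λ r → ⟦ place r == v ⟧)
    L = 2 * μ
    H = length hs

    -- The arrivals given to `Y` with other end in `Z` lie inside `Z`, so there are at most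
    -- `μ * size Z` of them, but at least `2 * μ` for each vertex of `Y`.
    expansion : ∀ (Y Z : Fin n → Bool) → (∀ v → Y v ≡ true → Z v ≡ true) →
                (∀ v → Y v ≡ true → L ≤ ∑ rs (λ r → ⟦ (place r == v) ∧ Z (other r) ⟧)) →
                2 * size Y ≤ size Z
    expansion Y Z sub h = *-cancelˡ-≤ μ {{>-nonZero 0<μ}} (begin
      μ * (2 * size Y)                                              ≡⟨ ring μ (size Y) ⟩
      size Y * L                                                    ≡⟨ ∑-*ʳ V (λ v → ⟦ Y v ⟧) L ⟨
      ∑ V (λ v → ⟦ Y v ⟧ * L)                                       ≤⟨ ∑-mono V (λ v → ⟦⟧*-mono (Y v) (h v)) ⟩
      ∑ V (λ v → ⟦ Y v ⟧ * ∑ rs (λ r → ⟦ (place r == v) ∧ Z (other r) ⟧))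
        ≡⟨ trans (∑-cong V (λ v → sym (∑-*ˡ rs ⟦ Y v ⟧ _))) (∑-swap V rs _) ⟩
      ∑ rs (λ r → ∑ V (λ v → ⟦ Y v ⟧ * ⟦ (place r == v) ∧ Z (other r) ⟧))
        ≤⟨ ∑-mono rs each ⟩
      ∑ rs (λ r → ⟦ Z (place r) ∧ Z (other r) ⟧)                    ≤⟨ dense Z ⟩
      μ * size Z                                                    ∎)
      where
      open ≤-Reasoning
      ring : ∀ μ y → μ * (2 * y) ≡ y * (2 * μ)
      ring = solve-∀
      each : ∀ r → ∑ V (λ v → ⟦ Y v ⟧ * ⟦ (place r == v) ∧ Z (other r) ⟧) ≤ ⟦ Z (place r) ∧ Z (other r) ⟧
      each r = begin
        ∑ V (λ v → ⟦ Y v ⟧ * ⟦ (place r == v) ∧ Z (other r) ⟧)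
          ≤⟨ ∑-mono V (λ v → pt v (place r == v) refl) ⟩
        ∑ V (λ v → ⟦ v == place r ⟧ * ⟦ Z (place r) ∧ Z (other r) ⟧)
          ≡⟨ ∑-δ (place r) (λ _ → ⟦ Z (place r) ∧ Z (other r) ⟧) ⟩
        ⟦ Z (place r) ∧ Z (other r) ⟧ ∎
        where
        pt : ∀ v c → (place r == v) ≡ c → ⟦ Y v ⟧ * ⟦ c ∧ Z (other r) ⟧ ≤ ⟦ v == place r ⟧ * ⟦ Z (place r) ∧ Z (other r) ⟧
        pt v false q = ≤-trans (≤-reflexive (*-zeroʳ ⟦ Y v ⟧)) z≤n
        pt v true  q with ==⇒≡ (place r) v q
        ... | refl rewrite ==-refl (place r) = ≤-trans (⟦⟧*-≤ (Y (place r)) λ y → ≤-reflexive (cong (λ c → ⟦ c ∧ Z (other r) ⟧) (sym (sub (place r) y))))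
                (≤-reflexive (sym (+-identityʳ _)))

    S : ℕ → Fin n → Bool
    S i v = D v ∧ (i * L ≤ᵇ gl v)

    at : ∀ {r v} → (place r == v) ≡ true → D v ≡ true → D (place r) ≡ true
    at {r} {v} q d = subst (λ z → D z ≡ true) (sym (==⇒≡ (place r) v q)) d

    shrink : ∀ i → 2 * size (S (suc i)) ≤ size (S i)
    shrink i = expansion (S (suc i)) (S i) sub many
      where
      open ≤-Reasoning
      sub : ∀ v → S (suc i) v ≡ true → S i v ≡ true
      sub v h = ∧-intro (proj₁ (∧-split h)) (≤ᵇ-true (≤-trans (m≤n+m _ L) (≤ᵇ-sound {suc i * L} (proj₂ (∧-split {D v} h)))))
      many : ∀ v → S (suc i) v ≡ true → L ≤ ∑ rs (λ r → ⟦ (place r == v) ∧ S i (other r) ⟧)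
      many v h = +-cancelˡ-≤ (i * L) _ _ (begin
        i * L + L       ≡⟨ +-comm (i * L) L ⟩
        suc i * L       ≤⟨ ≤ᵇ-sound {suc i * L} (proj₂ (∧-split {D v} h)) ⟩
        gl v            ≤⟨ threshold v (i * L) ⟩
        i * L + ∑ rs (λ r → ⟦ (place r == v) ∧ (i * L ≤ᵇ gl (other r)) ⟧)
          ≤⟨ +-monoʳ-≤ (i * L) (∑-mono-∈ rs λ {r} r∈ → ⟦⟧-mono λ q →
               let p , t = ∧-split {place r == v} q in
               ∧-intro p (∧-intro (closed r∈ (at p (proj₁ (∧-split h)))) t)) ⟩
        i * L + ∑ rs (λ r → ⟦ (place r == v) ∧ S i (other r) ⟧) ∎)

    -- Only the number of heads of a component is controlled, and it may have many more tails. Every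
    -- arrival given to a vertex outside `hs` has its other end in `hs`, so expansion into the
    -- loaded non-heads `Y` together with `hs` gives 2|Y| ≤ |Y|+H.
    start : size (S 1) ≤ 2 * H
    start = begin
      size (S 1)                        ≤⟨ ∑-mono V (λ v → pt (S 1 v) (elem v hs)) ⟩
      ∑ V (λ v → ⟦ Y v ⟧ + ⟦ elem v hs ⟧)  ≡⟨ ∑-+ V _ _ ⟩
      size Y + size (λ v → elem v hs)   ≤⟨ +-mono-≤ Y≤ (size-elem hs) ⟩
      H + H                             ≡⟨ cong (H +_) (+-identityʳ H) ⟨
      2 * H                             ∎
      where
      open ≤-Reasoning
      Y Z : Fin n → Bool
      Y v = S 1 v ∧ not (elem v hs)
      Z v = Y v ∨ elem v hs
      pt : ∀ a b → ⟦ a ⟧ ≤ ⟦ a ∧ not b ⟧ + ⟦ b ⟧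
      pt true  true  = s≤s z≤n
      pt true  false = s≤s z≤n
      pt false b     = z≤n
      not-true : ∀ {b} → not b ≡ true → b ≡ false
      not-true {false} _ = refl
      many : ∀ v → Y v ≡ true → L ≤ ∑ rs (λ r → ⟦ (place r == v) ∧ Z (other r) ⟧)
      many v h = begin
        L              ≡⟨ *-identityˡ L ⟨
        1 * L          ≤⟨ ≤ᵇ-sound {1 * L} (proj₂ (∧-split {D v} (proj₁ (∧-split {S 1 v} h)))) ⟩
        gl v           ≤⟨ ∑-mono-∈ rs (λ {r} r∈ → ⟦⟧-mono {place r == v} λ q →
                            ∧-intro q (∨-introʳ (Y (other r)) (heads r∈ (at q (proj₁ (∧-split {D v} (proj₁ (∧-split {S 1 v} h)))))
                              (subst (λ z → elem z hs ≡ false) (sym (==⇒≡ (place r) v q)) (not-true (proj₂ (∧-split {S 1 v} h))))))) ⟩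
        ∑ rs (λ r → ⟦ (place r == v) ∧ Z (other r) ⟧) ∎
        where ∨-introʳ : ∀ a {b} → b ≡ true → (a ∨ b) ≡ true
              ∨-introʳ true  _ = refl
              ∨-introʳ false h = h
      Y≤ : size Y ≤ H
      Y≤ = +-cancelˡ-≤ (size Y) _ _ (begin
        size Y + size Y         ≡⟨ cong (size Y +_) (+-identityʳ (size Y)) ⟨
        2 * size Y              ≤⟨ expansion Y Z (λ v h → cong (_∨ elem v hs) h) many ⟩
        size Z                  ≤⟨ ∑-mono V (λ v → or (Y v) (elem v hs)) ⟩
        ∑ V (λ v → ⟦ Y v ⟧ + ⟦ elem v hs ⟧)  ≡⟨ ∑-+ V _ _ ⟩
        size Y + size (λ v → elem v hs) ≤⟨ +-monoʳ-≤ (size Y) (size-elem hs) ⟩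
        size Y + H              ∎)
        where or : ∀ a b → ⟦ a ∨ b ⟧ ≤ ⟦ a ⟧ + ⟦ b ⟧
              or true  b = s≤s z≤n
              or false b = ≤-refl

    iterate : ∀ i → 2 ^ i * size (S (suc i)) ≤ 2 * H
    iterate zero    = ≤-trans (≤-reflexive (+-identityʳ _)) start
    iterate (suc i) = begin
      2 * 2 ^ i * size (S (2 + i))       ≡⟨ ring (2 ^ i) (size (S (2 + i))) ⟩
      2 ^ i * (2 * size (S (2 + i)))     ≤⟨ *-monoʳ-≤ (2 ^ i) (shrink (suc i)) ⟩
      2 ^ i * size (S (suc i))           ≤⟨ iterate i ⟩
      2 * H                              ∎
      where open ≤-Reasoning
            ring : ∀ a b → 2 * a * b ≡ a * (2 * b)
            ring = solve-∀

  -- Halving `j` times from at most `2 * H` vertices leaves no vertex of load `suc j * (2 * μ)`.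
  greedy-load : ∀ j → 2 * length hs < 2 ^ j → ∀ v → D v ≡ true → ∑ rs (λ r → ⟦ place r == v ⟧) ≤ suc j * (2 * μ)
  greedy-load j lt v d with suc j * L ≤? gl v
  ... | no ¬p = <⇒≤ (≰⇒> ¬p)
  ... | yes p = contradiction (≤-trans lt (≤-trans (m≤m*n (2 ^ j) (size (S (suc j))) {{>-nonZero (size-> (S (suc j)) v (∧-intro d (≤ᵇ-true p)))}}) (iterate j)))
                  (<⇒≱ (n<1+n (2 * H)))

-- The algorithm

module Algo {n : ℕ} (G : Graph n) (dir : Fin (length (edges G)) → Bool)
  (cls : Fin (length (edges G)) → ℕ) (k : ℕ) where

  m : ℕ
  m = length (edges G)

  hd tl : Fin m → Fin n
  hd e = target (dir e) (edge G e)
  tl e = target (not (dir e)) (edge G e)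

  -- A rejected arrival is stored with the outcome of the greedy comparison: true = given to its head.
  Rejected : Set
  Rejected = Fin m × Bool

  record State : Set where
    constructor state
    field
      accepted : List (Fin m)
      rejected : List Rejected
  open State public

  count : List (Fin m) → Fin n → ℕ → ℕ
  count acc u c = ∑ acc λ a → ⟦ (hd a == u) ∧ (c ≤ᵇ cls a) ⟧

  place other : Rejected → Fin n
  place (e , b) = if b then hd e else tl e
  other (e , b) = if b then tl e else hd e

  greedyLoad : List Rejected → Fin n → ℕ
  greedyLoad rs v = ∑ rs λ r → ⟦ place r == v ⟧

  full preferHead : State → Fin m → Bool
  full st e = k ≤ᵇ count (accepted st) (hd e) (cls e)
  preferHead st e = greedyLoad (rejected st) (hd e) ≤ᵇ greedyLoad (rejected st) (tl e)

  step : State → Fin m → State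
  step st e = if full st e then state (accepted st) ((e , preferHead st e) ∷ rejected st)
                           else state (e ∷ accepted st) (rejected st)

  decide : State → Fin m → Bool
  decide st e = if full st e then (if preferHead st e then dir e else not (dir e)) else dir e

  run : State → List (Fin m) → State
  run = foldl step

  initial : State
  initial = state [] []

  alg : Algorithm G
  alg past e = decide (run initial past) e

  targets : State → List (Fin m) → List (Fin n)
  targets st []       = []
  targets st (e ∷ es) = target (decide st e) (edge G e) ∷ targets (step st e) es

  runAlg≡targets : ∀ past es → runAlg G alg past es ≡ targets (run initial past) es
  runAlg≡targets past []       = refl
  runAlg≡targets past (e ∷ es) = cong (target (alg past e) (edge G e) ∷_)
    (trans (runAlg≡targets (past ++ [ e ]) es) (cong (λ st → targets st es) (foldl-++ step initial past [ e ])))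

  acceptedLoad : List (Fin m) → Fin n → ℕ
  acceptedLoad acc v = ∑ acc λ a → ⟦ hd a == v ⟧

  total : State → Fin n → ℕ
  total st v = acceptedLoad (accepted st) v + greedyLoad (rejected st) v

  total-step : ∀ st e v → total (step st e) v ≡ ⟦ target (decide st e) (edge G e) == v ⟧ + total st v
  total-step st e v with full st e
  ... | false = +-assoc ⟦ hd e == v ⟧ _ _
  ... | true with preferHead st e
  ... | true  = swap (acceptedLoad (accepted st) v) ⟦ hd e == v ⟧ (greedyLoad (rejected st) v)
    where swap : ∀ a b c → a + (b + c) ≡ b + (a + c)
          swap = solve-∀
  ... | false = swap (acceptedLoad (accepted st) v) ⟦ tl e == v ⟧ (greedyLoad (rejected st) v)
    where swap : ∀ a b c → a + (b + c) ≡ b + (a + c)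
          swap = solve-∀

  ∑-targets : ∀ st es v → ∑ (targets st es) (λ w → ⟦ w == v ⟧) + total st v ≡ total (run st es) v
  ∑-targets st []       v = refl
  ∑-targets st (e ∷ es) v = begin
    t + ∑ (targets (step st e) es) (λ w → ⟦ w == v ⟧) + total st v     ≡⟨ ring t _ (total st v) ⟩
    ∑ (targets (step st e) es) (λ w → ⟦ w == v ⟧) + (t + total st v)   ≡⟨ cong (∑ (targets (step st e) es) (λ w → ⟦ w == v ⟧) +_) (total-step st e v) ⟨
    ∑ (targets (step st e) es) (λ w → ⟦ w == v ⟧) + total (step st e) v ≡⟨ ∑-targets (step st e) es v ⟩
    total (run (step st e) es) v ∎
    where
    open ≡-Reasoning
    t = ⟦ target (decide st e) (edge G e) == v ⟧
    ring : ∀ a b c → a + b + c ≡ b + (a + c)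
    ring = solve-∀

  load-alg : ∀ s v → load (runAlg G alg [] s) v ≡ total (run initial s) v
  load-alg s v = begin
    load (runAlg G alg [] s) v                             ≡⟨ cong (λ hs → load hs v) (runAlg≡targets [] s) ⟩
    load (targets initial s) v                               ≡⟨ load≡∑ (targets initial s) v ⟩
    ∑ (targets initial s) (λ w → ⟦ w == v ⟧)                 ≡⟨ +-identityʳ _ ⟨
    ∑ (targets initial s) (λ w → ⟦ w == v ⟧) + total initial v ≡⟨ ∑-targets initial s v ⟩
    total (run initial s) v                                  ∎
    where open ≡-Reasoning

  run-invariant : (P : State → Set) → (∀ st e → P st → P (step st e)) → ∀ st es → P st → P (run st es)
  run-invariant P h st []       p = p
  run-invariant P h st (e ∷ es) p = run-invariant P h (step st e) es (h st e p)

  step-elim : (P : State → Set) (st : State) (e : Fin m) →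
              (k ≤ count (accepted st) (hd e) (cls e) → P (state (accepted st) ((e , preferHead st e) ∷ rejected st))) →
              (count (accepted st) (hd e) (cls e) < k → P (state (e ∷ accepted st) (rejected st))) →
              P (step st e)
  step-elim P st e rej acc with full st e in q
  ... | true  = rej (≤ᵇ-sound {k} q)
  ... | false = acc (≤ᵇ-refute {k} q)

  -- Each arrival ends up in exactly one of the two lists, so the exponential weight of a sequence
  -- can be read off from the final state.
  ∏-run : ∀ (g : Fin m → ℕ) st es →
          ∏ (accepted (run st es)) g * ∏ (rejected (run st es)) (g ∘ proj₁) ≡
          ∏ (accepted st) g * ∏ (rejected st) (g ∘ proj₁) * ∏ es g
  ∏-run g st []       = sym (*-identityʳ _)
  ∏-run g st (e ∷ es) = trans (∏-run g (step st e) es)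
    (trans (cong (_* ∏ es g) (step-elim (λ st′ → ∏ (accepted st′) g * ∏ (rejected st′) (g ∘ proj₁) ≡
                                                 ∏ (accepted st) g * ∏ (rejected st) (g ∘ proj₁) * g e) st e
      (λ _ → r₁ (∏ (accepted st) g) (g e) (∏ (rejected st) (g ∘ proj₁)))
      (λ _ → r₂ (∏ (accepted st) g) (g e) (∏ (rejected st) (g ∘ proj₁)))))
    (*-assoc (∏ (accepted st) g * ∏ (rejected st) (g ∘ proj₁)) (g e) (∏ es g)))
    where r₁ : ∀ a b c → a * (b * c) ≡ a * c * b
          r₁ = solve-∀
          r₂ : ∀ a b c → b * a * c ≡ a * c * b
          r₂ = solve-∀

  ∑-run : ∀ (f : Fin m → ℕ) st es →
          ∑ (accepted (run st es)) f + ∑ (rejected (run st es)) (f ∘ proj₁) ≡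
          ∑ (accepted st) f + ∑ (rejected st) (f ∘ proj₁) + ∑ es f
  ∑-run f st []       = sym (+-identityʳ _)
  ∑-run f st (e ∷ es) = trans (∑-run f (step st e) es)
    (trans (cong (_+ ∑ es f) (step-elim (λ st′ → ∑ (accepted st′) f + ∑ (rejected st′) (f ∘ proj₁) ≡
                                                 ∑ (accepted st) f + ∑ (rejected st) (f ∘ proj₁) + f e) st e
      (λ _ → r₁ (∑ (accepted st) f) (f e) (∑ (rejected st) (f ∘ proj₁)))
      (λ _ → r₂ (∑ (accepted st) f) (f e) (∑ (rejected st) (f ∘ proj₁)))))
    (+-assoc (∑ (accepted st) f + ∑ (rejected st) (f ∘ proj₁)) (f e) (∑ es f)))
    where r₁ : ∀ a b c → a + (b + c) ≡ a + c + b
          r₁ = solve-∀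
          r₂ : ∀ a b c → b + a + c ≡ a + c + b
          r₂ = solve-∀

  RejectedFull : State → Set
  RejectedFull st = ∀ {r} → r ∈ rejected st → k ≤ count (accepted st) (hd (proj₁ r)) (cls (proj₁ r))

  -- The accepted counts only grow, so a head that was full at a rejection is still full at the end,
  -- where the exploration is made.
  rejectedFull : ∀ s → RejectedFull (run initial s)
  rejectedFull s = run-invariant RejectedFull
    (λ st e inv → step-elim RejectedFull st e
      (λ full → λ { (here refl) → full ; (there p) → inv p })
      (λ _ p → ≤-trans (inv p) (m≤n+m _ _)))
    initial s λ ()

  ClassBound : State → Set
  ClassBound st = ∀ u c → ∑ (accepted st) (λ a → ⟦ (hd a == u) ∧ (c ≡ᵇ cls a) ⟧) ≤ k

  -- An arrival is accepted only while its own and the higher classes together hold fewer than `k`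
  -- arrivals at the head; in particular its own class does.
  classBound : ∀ s → ClassBound (run initial s)
  classBound s = run-invariant ClassBound (λ st e inv → step-elim ClassBound st e (λ _ → inv) (accept st e inv)) initial s (λ _ _ → z≤n)
    where
    ≡ᵇ-sound : ∀ {a b} → (a ≡ᵇ b) ≡ true → a ≡ b
    ≡ᵇ-sound {a} {b} h = ≡ᵇ⇒≡ a b (≡⇒T h)
    accept : ∀ st e → ClassBound st → count (accepted st) (hd e) (cls e) < k → ClassBound (state (e ∷ accepted st) (rejected st))
    accept st e inv lt u c with (hd e == u) ∧ (c ≡ᵇ cls e) in q
    ... | false = inv u c
    ... | true with ==⇒≡ (hd e) u (proj₁ (∧-split q)) | ≡ᵇ-sound {c} (proj₂ (∧-split {hd e == u} q))
    ... | refl | refl = ≤-trans (s≤s (∑-mono (accepted st) λ a → ⟦⟧-mono λ h →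
            ∧-intro (proj₁ (∧-split h)) (≤ᵇ-true (≤-reflexive (≡ᵇ-sound {cls e} (proj₂ (∧-split {hd a == hd e} h))))))) lt

  acceptedLoad≤ : ∀ R → (∀ e → cls e ≤ R) → ∀ s v → acceptedLoad (accepted (run initial s)) v ≤ suc R * k
  acceptedLoad≤ R h s v = begin
    ∑ acc (λ a → ⟦ hd a == v ⟧)
      ≤⟨ ∑-mono acc pt ⟩
    ∑ acc (λ a → ∑ (allFin (suc R)) (λ c → ⟦ (hd a == v) ∧ (toℕ c ≡ᵇ cls a) ⟧))
      ≡⟨ ∑-swap acc (allFin (suc R)) _ ⟩
    ∑ (allFin (suc R)) (λ c → ∑ acc (λ a → ⟦ (hd a == v) ∧ (toℕ c ≡ᵇ cls a) ⟧))
      ≤⟨ ∑-mono (allFin (suc R)) (λ c → classBound s v (toℕ c)) ⟩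
    ∑ (allFin (suc R)) (λ _ → k)
      ≡⟨ ∑-allFin-const (suc R) k ⟩
    suc R * k ∎
    where
    open ≤-Reasoning
    acc = accepted (run initial s)
    pt : ∀ a → ⟦ hd a == v ⟧ ≤ ∑ (allFin (suc R)) (λ c → ⟦ (hd a == v) ∧ (toℕ c ≡ᵇ cls a) ⟧)
    pt a = ≤-trans (⟦⟧-mono {hd a == v} λ q → ∧-intro q (T⇒≡ (≡⇒≡ᵇ _ _ (Fin.toℕ-fromℕ< (s≤s (h a))))))
      (∑-allFin-term (λ c → ⟦ (hd a == v) ∧ (toℕ c ≡ᵇ cls a) ⟧) (fromℕ< (s≤s (h a))))

  -- What is left of the order of the greedy choices: an arrival given to `v` when `v` already had
  -- load `a` saw load at least `a` at its other end, and loads never decrease.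
  Threshold : List Rejected → Set
  Threshold rs = ∀ v a → greedyLoad rs v ≤ a + ∑ rs (λ r → ⟦ (place r == v) ∧ (a ≤ᵇ greedyLoad rs (other r)) ⟧)

  threshold-∷ : ∀ r rs → greedyLoad rs (place r) ≤ greedyLoad rs (other r) → Threshold rs → Threshold (r ∷ rs)
  threshold-∷ r rs le inv v a = cases (place r == v) refl
    where
    open ≤-Reasoning
    gl′ : Fin n → ℕ
    gl′ = greedyLoad (r ∷ rs)
    old : ℕ
    old = ∑ rs (λ q → ⟦ (place q == v) ∧ (a ≤ᵇ gl′ (other q)) ⟧)
    old≥ : greedyLoad rs v ≤ a + old
    old≥ = ≤-trans (inv v a) (+-monoʳ-≤ a (∑-mono rs λ q → ⟦⟧-mono λ h →
      ∧-intro (proj₁ (∧-split h)) (≤ᵇ-true (≤-trans (≤ᵇ-sound {a} (proj₂ (∧-split {place q == v} h))) (m≤n+m _ ⟦ place r == other q ⟧)))))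
    cases : ∀ b → (place r == v) ≡ b → ⟦ b ⟧ + greedyLoad rs v ≤ a + (⟦ b ∧ (a ≤ᵇ gl′ (other r)) ⟧ + old)
    cases false _ = old≥
    cases true  q with a ≤? greedyLoad rs v
    ... | no ¬p = ≤-trans (≰⇒> ¬p) (m≤m+n a _)
    ... | yes p = begin
      suc (greedyLoad rs v)     ≤⟨ s≤s old≥ ⟩
      suc (a + old)             ≡⟨ +-suc a old ⟨
      a + (1 + old)             ≡⟨ cong (λ b → a + (⟦ b ⟧ + old)) (sym (≤ᵇ-true a≤)) ⟩
      a + (⟦ a ≤ᵇ gl′ (other r) ⟧ + old) ∎
      where
      a≤ : a ≤ gl′ (other r)
      a≤ = begin
        a                            ≤⟨ p ⟩
        greedyLoad rs v              ≡⟨ cong (greedyLoad rs) (==⇒≡ (place r) v q) ⟨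
        greedyLoad rs (place r)      ≤⟨ le ⟩
        greedyLoad rs (other r)      ≤⟨ m≤n+m _ ⟦ place r == other r ⟧ ⟩
        gl′ (other r)                ∎

  threshold : ∀ s → Threshold (rejected (run initial s))
  threshold s = run-invariant (Threshold ∘ rejected)
    (λ st e inv → step-elim (Threshold ∘ rejected) st e
      (λ _ → threshold-∷ (e , preferHead st e) (rejected st) (greedy st e) inv) (λ _ → inv))
    initial s (λ _ _ → z≤n)
    where
    greedy : ∀ st e → greedyLoad (rejected st) (place (e , preferHead st e)) ≤ greedyLoad (rejected st) (other (e , preferHead st e))
    greedy st e with preferHead st e in q
    ... | true  = ≤ᵇ-sound {greedyLoad (rejected st) (hd e)} q
    ... | false = <⇒≤ (≤ᵇ-refute {greedyLoad (rejected st) (hd e)} q)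

  place-other : ∀ r → (place r ≡ hd (proj₁ r) × other r ≡ tl (proj₁ r)) ⊎ (place r ≡ tl (proj₁ r) × other r ≡ hd (proj₁ r))
  place-other (e , true)  = inj₁ (refl , refl)
  place-other (e , false) = inj₂ (refl , refl)

  dense : ∀ s (Z : Fin n → Bool) → ∑ (rejected (run initial s)) (λ r → ⟦ Z (place r) ∧ Z (other r) ⟧) ≤ Mstar (map (edge G) s) * size Z
  dense s Z = begin
    ∑ rs (λ r → ⟦ Z (place r) ∧ Z (other r) ⟧)       ≡⟨ ∑-cong rs (λ r → cong ⟦_⟧ (trans (sym-∧ r) (ends (proj₁ r)))) ⟩
    ∑ rs (f ∘ proj₁)                                 ≤⟨ m≤n+m _ (∑ (accepted (run initial s)) f) ⟩
    ∑ (accepted (run initial s)) f + ∑ rs (f ∘ proj₁)  ≡⟨ ∑-run f initial s ⟩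
    ∑ s f                                            ≤⟨ Base.inside≤opt G Z s ⟩
    Mstar (map (edge G) s) * size Z                  ∎
    where
    open ≤-Reasoning
    rs = rejected (run initial s)
    f : Fin m → ℕ
    f e = ⟦ Z (proj₁ (edge G e)) ∧ Z (proj₂ (edge G e)) ⟧
    ∧-comm : ∀ a b → (a ∧ b) ≡ (b ∧ a)
    ∧-comm true  true  = refl
    ∧-comm true  false = refl
    ∧-comm false true  = refl
    ∧-comm false false = refl
    sym-∧ : ∀ r → Z (place r) ∧ Z (other r) ≡ Z (hd (proj₁ r)) ∧ Z (tl (proj₁ r))
    sym-∧ (e , true)  = refl
    sym-∧ (e , false) = ∧-comm (Z (tl e)) (Z (hd e))
    ends : ∀ e → Z (hd e) ∧ Z (tl e) ≡ Z (proj₁ (edge G e)) ∧ Z (proj₂ (edge G e))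
    ends e with dir e
    ... | true  = refl
    ... | false = ∧-comm (Z (proj₂ (edge G e))) (Z (proj₁ (edge G e)))

-- Weights of explorations

∏-* : {A : Set} (xs : List A) (f g : A → ℕ) → ∏ xs (λ x → f x * g x) ≡ ∏ xs f * ∏ xs g
∏-* []       f g = refl
∏-* (x ∷ xs) f g = trans (cong (f x * g x *_) (∏-* xs f g)) (ring (f x) (g x) (∏ xs f) (∏ xs g))
  where ring : ∀ a b c d → a * b * (c * d) ≡ a * c * (b * d)
        ring = solve-∀

∏-if : {A : Set} (xs : List A) (p : A → Bool) (z : ℕ) → ∏ xs (λ x → if p x then z else 1) ≡ z ^ ∑ xs (λ x → ⟦ p x ⟧)
∏-if []       p z = refl
∏-if (x ∷ xs) p z with p x
... | true  = cong (z *_) (∏-if xs p z)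
... | false = trans (+-identityʳ _) (∏-if xs p z)

data Distinct {A : Set} : List A → Set where
  []  : Distinct []
  _∷_ : ∀ {x xs} → x ∉ xs → Distinct xs → Distinct (x ∷ xs)

module Weights {m n : ℕ} (hd : Fin m → Fin n) (cls : Fin m → ℕ) (Z : ℕ → ℕ) (1≤Z : ∀ c → 1 ≤ Z c)
  (Y₀ κ : ℕ) (0<n : 0 < n) (nY₀≤m : n * Y₀ ≤ m) where

  EI : List (Fin m)
  EI = allFin m

  inClass : Fin n → ℕ → Fin m → Bool
  inClass u c e = (hd e == u) ∧ (c ≤ᵇ cls e)

  module _ (class-size : ∀ u c → n * ∑ EI (λ e → ⟦ inClass u c e ⟧) * Z c ≤ m * κ) where

    headWeight : List (Fin n × ℕ) → Fin m → ℕ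
    headWeight []            a = 1
    headWeight ((u , c) ∷ H) a = if inClass u c a then Z c else headWeight H a

    edgeWeight : List (Fin m) → Fin m → ℕ
    edgeWeight E a = ∑ E λ e → ⟦ a == e ⟧ * Y₀

    -- The expectation of ∏ weight is an exponential-moment bound on the probability that every edge
    -- of E is rejected while every (u , c) in H has k accepted arrivals of class at least c.
    weight : List (Fin m) → List (Fin n × ℕ) → Fin m → ℕ
    weight E H a = headWeight H a + edgeWeight E a

    ∑-headWeight : ∀ H → n * ∑ EI (headWeight H) ≤ m * (n + κ * length H)
    ∑-headWeight [] = ≤-reflexive (trans (cong (n *_) (∑-allFin-const m 1)) (ring n m κ))
      where ring : ∀ n m κ → n * (m * 1) ≡ m * (n + κ * 0)
            ring = solve-∀
    ∑-headWeight ((u , c) ∷ H) = begin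
      n * ∑ EI (headWeight ((u , c) ∷ H))
        ≤⟨ *-monoʳ-≤ n (∑-mono EI (λ a → pt (inClass u c a) (Z c) (headWeight H a))) ⟩
      n * ∑ EI (λ a → ⟦ inClass u c a ⟧ * Z c + headWeight H a)
        ≡⟨ cong (n *_) (trans (∑-+ EI (λ a → ⟦ inClass u c a ⟧ * Z c) (headWeight H))
             (cong (_+ ∑ EI (headWeight H)) (∑-*ʳ EI (λ a → ⟦ inClass u c a ⟧) (Z c)))) ⟩
      n * (∑ EI (λ a → ⟦ inClass u c a ⟧) * Z c + ∑ EI (headWeight H))
        ≡⟨ distr n (∑ EI (λ a → ⟦ inClass u c a ⟧)) (Z c) (∑ EI (headWeight H)) ⟩
      n * ∑ EI (λ a → ⟦ inClass u c a ⟧) * Z c + n * ∑ EI (headWeight H)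
        ≤⟨ +-mono-≤ (class-size u c) (∑-headWeight H) ⟩
      m * κ + m * (n + κ * length H)
        ≡⟨ ring m κ n (length H) ⟩
      m * (n + κ * suc (length H)) ∎
      where
      open ≤-Reasoning
      pt : ∀ b z h → (if b then z else h) ≤ ⟦ b ⟧ * z + h
      pt true  z h = ≤-trans (≤-reflexive (sym (+-identityʳ z))) (m≤m+n _ h)
      pt false z h = ≤-refl
      distr : ∀ n s z h → n * (s * z + h) ≡ n * s * z + n * h
      distr = solve-∀
      ring : ∀ m κ n l → m * κ + m * (n + κ * l) ≡ m * (n + κ * suc l)
      ring = solve-∀

    ∑-edgeWeight : ∀ E → n * ∑ EI (edgeWeight E) ≤ m * length E
    ∑-edgeWeight E = begin
      n * ∑ EI (edgeWeight E)                               ≡⟨ cong (n *_) (∑-swap EI E (λ a e → ⟦ a == e ⟧ * Y₀)) ⟩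
      n * ∑ E (λ e → ∑ EI (λ a → ⟦ a == e ⟧ * Y₀))          ≡⟨ cong (n *_) (∑-cong E (λ e → ∑-δ e (λ _ → Y₀))) ⟩
      n * ∑ E (λ _ → Y₀)                                    ≡⟨ cong (n *_) (∑-const E Y₀) ⟩
      n * (length E * Y₀)                                   ≡⟨ ring n (length E) Y₀ ⟩
      n * Y₀ * length E                                     ≤⟨ *-monoˡ-≤ (length E) nY₀≤m ⟩
      m * length E                                          ∎
      where open ≤-Reasoning
            ring : ∀ a b c → a * (b * c) ≡ a * c * b
            ring = solve-∀

    -- As `weight` is a sum, the mean weight of one arrival is at most 1 + (|E|+κ|H|)/n: an edge
    -- adds at most 1/n by the choice of `Y₀`, a head at most κ/n by `class-size`. The `n`
    -- independent arrivals turn this into an exponential.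
    expected-weight : ∀ E H → ∑ (seqs m n) (λ s → ∏ s (weight E H)) ≤ m ^ n * 8 ^ (length E + κ * length H)
    expected-weight E H = *-cancelʳ-≤ _ _ (n ^ n) {{m^n≢0 n n {{>-nonZero 0<n}}}} (begin
      ∑ (seqs m n) (λ s → ∏ s (weight E H)) * n ^ n    ≡⟨ cong (_* n ^ n) (∑-seqs-∏ m n (weight E H)) ⟩
      Γ ^ n * n ^ n                                    ≡⟨ *-comm (Γ ^ n) (n ^ n) ⟩
      n ^ n * Γ ^ n                                    ≡⟨ ^-distribʳ-* n n Γ ⟨
      (n * Γ) ^ n                                      ≤⟨ ^-monoˡ-≤ n nΓ≤ ⟩
      (m * (n + t)) ^ n                                ≡⟨ ^-distribʳ-* n m (n + t) ⟩
      m ^ n * (n + t) ^ n                              ≤⟨ *-monoʳ-≤ (m ^ n) ([n+a]^n≤8^a*n^n n t) ⟩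
      m ^ n * (8 ^ t * n ^ n)                          ≡⟨ *-assoc (m ^ n) (8 ^ t) (n ^ n) ⟨
      m ^ n * 8 ^ t * n ^ n                            ∎)
      where
      open ≤-Reasoning
      Γ t : ℕ
      Γ = ∑ EI (weight E H)
      t = length E + κ * length H
      nΓ≤ : n * Γ ≤ m * (n + t)
      nΓ≤ = begin
        n * Γ                                                     ≡⟨ cong (n *_) (∑-+ EI (headWeight H) (edgeWeight E)) ⟩
        n * (∑ EI (headWeight H) + ∑ EI (edgeWeight E))           ≡⟨ *-distribˡ-+ n (∑ EI (headWeight H)) (∑ EI (edgeWeight E)) ⟩
        n * ∑ EI (headWeight H) + n * ∑ EI (edgeWeight E)         ≤⟨ +-mono-≤ (∑-headWeight H) (∑-edgeWeight E) ⟩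
        m * (n + κ * length H) + m * length E                     ≡⟨ ring m n (κ * length H) (length E) ⟩
        m * (n + t)                                               ∎
        where ring : ∀ m n a b → m * (n + a) + m * b ≡ m * (n + (b + a))
              ring = solve-∀

    1≤headWeight : ∀ H a → 1 ≤ headWeight H a
    1≤headWeight []            a = ≤-refl
    1≤headWeight ((u , c) ∷ H) a with inClass u c a
    ... | true  = 1≤Z c
    ... | false = 1≤headWeight H a

    headWeight-fresh : ∀ H {a} → hd a ∉ map proj₁ H → headWeight H a ≡ 1
    headWeight-fresh []            h = refl
    headWeight-fresh ((u , c) ∷ H) {a} h with inClass u c a in q
    ... | true  = ⊥-elim (h (here (==⇒≡ (hd a) u (proj₁ (∧-split q)))))
    ... | false = headWeight-fresh H (h ∘ there)

    edgeWeight-fresh : ∀ E {a} → a ∉ E → edgeWeight E a ≡ 0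
    edgeWeight-fresh []      h = refl
    edgeWeight-fresh (e ∷ E) {a} h rewrite ≢⇒== (λ p → h (here p)) = edgeWeight-fresh E (h ∘ there)

    headBound : ℕ → List (Fin n × ℕ) → ℕ
    headBound k H = ∏ H λ uc → Z (proj₂ uc) ^ k

    ∏-headWeight : ∀ k (acc : List (Fin m)) H → Distinct (map proj₁ H) →
      (∀ {u c} → (u , c) ∈ H → k ≤ ∑ acc (λ a → ⟦ inClass u c a ⟧)) → headBound k H ≤ ∏ acc (headWeight H)
    ∏-headWeight k acc []            d       h = ∏-≥1 acc (λ _ → ≤-refl)
    ∏-headWeight k acc ((u , c) ∷ H) (f ∷ d) h = begin
      Z c ^ k * headBound k H
        ≤⟨ *-mono-≤ (^-monoʳ-≤ (Z c) {{>-nonZero (1≤Z c)}} (h (here refl))) (∏-headWeight k acc H d (h ∘ there)) ⟩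
      Z c ^ ∑ acc (λ a → ⟦ inClass u c a ⟧) * ∏ acc (headWeight H)
        ≡⟨ cong (_* ∏ acc (headWeight H)) (∏-if acc (inClass u c) (Z c)) ⟨
      ∏ acc (λ a → if inClass u c a then Z c else 1) * ∏ acc (headWeight H)
        ≡⟨ ∏-* acc (λ a → if inClass u c a then Z c else 1) (headWeight H) ⟨
      ∏ acc (λ a → (if inClass u c a then Z c else 1) * headWeight H a)
        ≤⟨ ∏-mono acc pt ⟩
      ∏ acc (headWeight ((u , c) ∷ H)) ∎
      where
      open ≤-Reasoning
      pt : ∀ a → (if inClass u c a then Z c else 1) * headWeight H a ≤ (if inClass u c a then Z c else headWeight H a)
      pt a with inClass u c a in q
      ... | false = ≤-reflexive (*-identityˡ _)
      ... | true  = ≤-reflexive (trans (cong (Z c *_) (headWeight-fresh H (subst (_∉ map proj₁ H) (sym (==⇒≡ (hd a) u (proj₁ (∧-split q)))) f)))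
                      (*-identityʳ (Z c)))

    ∑-∈-pos : {A : Set} {rs : List A} {x : A} (p : A → Bool) → x ∈ rs → p x ≡ true → 1 ≤ ∑ rs (λ r → ⟦ p r ⟧)
    ∑-∈-pos p x∈ h = ≤-trans (≤-reflexive (cong ⟦_⟧ (sym h))) (∑-∈ (λ r → ⟦ p r ⟧) x∈)

    ∏-edgeWeight : {A : Set} (rs : List A) (π : A → Fin m) → ∀ E → Distinct E →
      (∀ {e} → e ∈ E → ∃ λ r → r ∈ rs × π r ≡ e) → suc Y₀ ^ length E ≤ ∏ rs (λ r → 1 + edgeWeight E (π r))
    ∏-edgeWeight rs π []      d       h = ∏-≥1 rs (λ _ → ≤-refl)
    ∏-edgeWeight rs π (e ∷ E) (f ∷ d) h = begin
      suc Y₀ * suc Y₀ ^ length E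
        ≤⟨ *-mono-≤ one (∏-edgeWeight rs π E d (h ∘ there)) ⟩
      suc Y₀ ^ ∑ rs (λ r → ⟦ π r == e ⟧) * ∏ rs (λ r → 1 + edgeWeight E (π r))
        ≡⟨ cong (_* ∏ rs (λ r → 1 + edgeWeight E (π r))) (∏-if rs (λ r → π r == e) (suc Y₀)) ⟨
      ∏ rs (λ r → if π r == e then suc Y₀ else 1) * ∏ rs (λ r → 1 + edgeWeight E (π r))
        ≡⟨ ∏-* rs (λ r → if π r == e then suc Y₀ else 1) (λ r → 1 + edgeWeight E (π r)) ⟨
      ∏ rs (λ r → (if π r == e then suc Y₀ else 1) * (1 + edgeWeight E (π r)))
        ≤⟨ ∏-mono rs pt ⟩
      ∏ rs (λ r → 1 + edgeWeight (e ∷ E) (π r)) ∎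
      where
      open ≤-Reasoning
      one : suc Y₀ ≤ suc Y₀ ^ ∑ rs (λ r → ⟦ π r == e ⟧)
      one = let r , r∈ , eq = h (here refl) in
        ≤-trans (≤-reflexive (sym (*-identityʳ (suc Y₀))))
          (^-monoʳ-≤ (suc Y₀) (∑-∈-pos (λ r → π r == e) r∈ (trans (cong (_== e) eq) (==-refl e))))
      pt : ∀ r → (if π r == e then suc Y₀ else 1) * (1 + edgeWeight E (π r)) ≤ 1 + (⟦ π r == e ⟧ * Y₀ + edgeWeight E (π r))
      pt r with π r == e in q
      ... | false = ≤-reflexive (*-identityˡ _)
      ... | true  = ≤-reflexive (trans (cong (λ z → suc Y₀ * (1 + z)) fr) (trans (ring Y₀) (cong (λ z → 1 + (1 * Y₀ + z)) (sym fr))))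
        where fr : edgeWeight E (π r) ≡ 0
              fr = edgeWeight-fresh E (subst (_∉ E) (sym (==⇒≡ (π r) e q)) f)
              ring : ∀ y → suc y * 1 ≡ 1 + (1 * y + 0)
              ring = solve-∀

    -- Accepted arrivals pay for the heads and rejected arrivals for the edges. No arrival has to
    -- pay for both, which is why a sum suffices as weight and no independence between edges and
    -- heads is needed.
    weight-lower : {A : Set} → ∀ k (acc : List (Fin m)) (rs : List A) (π : A → Fin m) E H → Distinct E → Distinct (map proj₁ H) →
      (∀ {e} → e ∈ E → ∃ λ r → r ∈ rs × π r ≡ e) →
      (∀ {u c} → (u , c) ∈ H → k ≤ ∑ acc (λ a → ⟦ inClass u c a ⟧)) →
      suc Y₀ ^ length E * headBound k H ≤ ∏ acc (weight E H) * ∏ rs (weight E H ∘ π)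
    weight-lower k acc rs π E H dE dH hE hH = begin
      suc Y₀ ^ length E * headBound k H
        ≤⟨ *-mono-≤ (∏-edgeWeight rs π E dE hE) (∏-headWeight k acc H dH hH) ⟩
      ∏ rs (λ r → 1 + edgeWeight E (π r)) * ∏ acc (headWeight H)
        ≤⟨ *-mono-≤ (∏-mono rs λ r → +-monoˡ-≤ (edgeWeight E (π r)) (1≤headWeight H (π r))) (∏-mono acc λ a → m≤m+n _ (edgeWeight E a)) ⟩
      ∏ rs (weight E H ∘ π) * ∏ acc (weight E H)
        ≡⟨ *-comm (∏ rs (weight E H ∘ π)) _ ⟩
      ∏ acc (weight E H) * ∏ rs (weight E H ∘ π) ∎
      where open ≤-Reasoning

-- Hops

module Hops {m n : ℕ} (hd tl : Fin m → Fin n) (cls : Fin m → ℕ) (Z : ℕ → ℕ) (1≤Z : ∀ c → 1 ≤ Z c)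
  (Y₀ κ : ℕ) (0<n : 0 < n) (nY₀≤m : n * Y₀ ≤ m)
  (class-size : ∀ u c → n * ∑ (allFin m) (λ e → ⟦ (hd e == u) ∧ (c ≤ᵇ cls e) ⟧) * Z c ≤ m * κ)
  (ω : ℕ → ℕ) where

  module Wt = Weights {m} {n} hd cls Z 1≤Z Y₀ κ 0<n nY₀≤m
  open Wt using (EI; inClass)

  Y : ℕ
  Y = suc Y₀

  weight : List (Fin m) → List (Fin n × ℕ) → Fin m → ℕ
  weight = Wt.weight class-size

  -- One step of the exploration of the rejected edges from a vertex w: the edges used, the new
  -- active head with a lower bound for its class, the new vertices, and the weight of the step.
  record Hop : Set where
    constructor hop
    field
      path   : List (Fin m)
      head   : Fin n
      class  : ℕ
      nodes  : List (Fin n)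
      factor : ℕ
      path≤  : length path ≤ 2
      nodes≤ : length nodes ≤ 2
  open Hop

  -- The extra `Y` in these factors makes up for the missing second edge, so that all three kinds of
  -- hop gain the same `Y * Y * Q`. The class in `upHead` is 0 because of the new head one knows
  -- only that it rejected some arrival.
  down upHead : Fin n → Fin m → Hop
  down   w e = hop (e ∷ []) (hd e) (cls e) (hd e ∷ []) (⟦ tl e == w ⟧ * (Y * ω (cls e))) (s≤s z≤n) (s≤s z≤n)
  upHead w e = hop (e ∷ []) (tl e) 0 (tl e ∷ []) (⟦ hd e == w ⟧ * (Y * ω 0)) (s≤s z≤n) (s≤s z≤n)

  -- Moving up to a tail that is not itself a full head is not unlikely: a vertex has order M such
  -- edges expected. The move is paid for only by the full head that the next edge leads down to, so
  -- the two edges form one hop.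
  upDown : Fin n → Fin m → Fin m → Hop
  upDown w e e′ = hop (e ∷ e′ ∷ []) (hd e′) (cls e′) (tl e ∷ hd e′ ∷ [])
    (⟦ hd e == w ⟧ * (⟦ tl e′ == tl e ⟧ * ω (cls e′))) ≤-refl ≤-refl

  hops : Fin n → List Hop
  hops w = map (down w) EI ++ map (upHead w) EI ++ concatMap (λ e → map (upDown w e) EI) EI

  out into : Fin n → ℕ
  out w = ∑ EI λ e → ⟦ hd e == w ⟧
  into w = ∑ EI λ e → ⟦ tl e == w ⟧ * ω (cls e)

  ∑-hops : ∀ w → ∑ (hops w) factor ≡ Y * into w + (out w * (Y * ω 0) + ∑ EI (λ e → ⟦ hd e == w ⟧ * into (tl e)))
  ∑-hops w = trans (∑-++ (map (down w) EI) _ factor) (cong₂ _+_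
    (trans (∑-map (down w) EI factor) (trans (∑-cong EI λ e → swap ⟦ tl e == w ⟧ Y (ω (cls e))) (∑-*ˡ EI Y _)))
    (trans (∑-++ (map (upHead w) EI) _ factor) (cong₂ _+_
      (trans (∑-map (upHead w) EI factor) (∑-*ʳ EI (λ e → ⟦ hd e == w ⟧) (Y * ω 0)))
      (trans (∑-concatMap (λ e → map (upDown w e) EI) EI factor) (∑-cong EI λ e →
        trans (∑-map (upDown w e) EI factor) (∑-*ˡ EI ⟦ hd e == w ⟧ _))))))
    where swap : ∀ a b c → a * (b * c) ≡ b * (a * c)
          swap = solve-∀

  -- The constant is 9 for `down`, 4 for `upHead` and 4 · 9 for `upDown`.
  hops-bound : ∀ U M Q → (∀ w → U * into w ≤ 9 * (Y * M) * Q) → (∀ w → out w ≤ 4 * (Y * M)) → U * ω 0 ≤ Q → 1 ≤ M →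
               ∀ w → U * ∑ (hops w) factor ≤ 49 * (M * M) * (Y * Y * Q)
  hops-bound U M Q hi ho h0 1≤M w = begin
    U * ∑ (hops w) factor
      ≡⟨ cong (U *_) (∑-hops w) ⟩
    U * (Y * into w + (out w * (Y * ω 0) + ∑ EI (λ e → ⟦ hd e == w ⟧ * into (tl e))))
      ≡⟨ r₁ U Y (into w) (out w) (ω 0) _ ⟩
    Y * (U * into w) + (out w * (Y * (U * ω 0)) + U * ∑ EI (λ e → ⟦ hd e == w ⟧ * into (tl e)))
      ≤⟨ +-mono-≤ (*-monoʳ-≤ Y (hi w)) (+-mono-≤ (*-mono-≤ (ho w) (*-monoʳ-≤ Y h0)) two) ⟩
    Y * (9 * (Y * M) * Q) + (4 * (Y * M) * (Y * Q) + 4 * (Y * M) * (9 * (Y * M) * Q))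
      ≡⟨ r₂ Y M Q ⟩
    13 * M * (Y * Y * Q) + 36 * (M * M) * (Y * Y * Q)
      ≤⟨ +-monoˡ-≤ _ (*-monoˡ-≤ (Y * Y * Q) (*-monoʳ-≤ 13 (m≤m*n M M {{>-nonZero 1≤M}}))) ⟩
    13 * (M * M) * (Y * Y * Q) + 36 * (M * M) * (Y * Y * Q)
      ≡⟨ r₃ (M * M) (Y * Y * Q) ⟩
    49 * (M * M) * (Y * Y * Q) ∎
    where
    open ≤-Reasoning
    r₁ : ∀ U Y i o w s → U * (Y * i + (o * (Y * w) + s)) ≡ Y * (U * i) + (o * (Y * (U * w)) + U * s)
    r₁ = solve-∀
    r₂ : ∀ Y M Q → Y * (9 * (Y * M) * Q) + (4 * (Y * M) * (Y * Q) + 4 * (Y * M) * (9 * (Y * M) * Q)) ≡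
                   13 * M * (Y * Y * Q) + 36 * (M * M) * (Y * Y * Q)
    r₂ = solve-∀
    r₃ : ∀ a b → 13 * a * b + 36 * a * b ≡ 49 * a * b
    r₃ = solve-∀
    two : U * ∑ EI (λ e → ⟦ hd e == w ⟧ * into (tl e)) ≤ 4 * (Y * M) * (9 * (Y * M) * Q)
    two = begin
      U * ∑ EI (λ e → ⟦ hd e == w ⟧ * into (tl e))       ≡⟨ ∑-*ˡ EI U (λ e → ⟦ hd e == w ⟧ * into (tl e)) ⟨
      ∑ EI (λ e → U * (⟦ hd e == w ⟧ * into (tl e)))     ≤⟨ ∑-mono EI (λ e → ≤-trans (≤-reflexive (swap U ⟦ hd e == w ⟧ (into (tl e)))) (*-monoʳ-≤ ⟦ hd e == w ⟧ (hi (tl e)))) ⟩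
      ∑ EI (λ e → ⟦ hd e == w ⟧ * (9 * (Y * M) * Q))     ≡⟨ ∑-*ʳ EI (λ e → ⟦ hd e == w ⟧) (9 * (Y * M) * Q) ⟩
      out w * (9 * (Y * M) * Q)                          ≤⟨ *-monoˡ-≤ (9 * (Y * M) * Q) (ho w) ⟩
      4 * (Y * M) * (9 * (Y * M) * Q)                    ∎
      where swap : ∀ a b c → a * (b * c) ≡ b * (a * c)
            swap = solve-∀

  -- The total weight, on a sequence s of arrivals, of all explorations that make p more hops,
  -- where the vertices of the list are still to be expanded.
  Φ : ℕ → List (Fin m) → List (Fin n × ℕ) → List (Fin n) → List (Fin m) → ℕ
  Φ zero    E H todo    s = ∏ s (weight E H)
  Φ (suc p) E H []      s = 0
  Φ (suc p) E H (w ∷ t) s = Φ (suc p) E H t s +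
    ∑ (hops w) λ h → factor h * Φ p (path h ++ E) ((head h , class h) ∷ H) (nodes h ++ w ∷ t) s

  length-++-≤ : ∀ {A : Set} (xs ys : List A) {b} → length xs ≤ b → length (xs ++ ys) ≤ b + length ys
  length-++-≤ []       ys {b} h = m≤n+m (length ys) b
  length-++-≤ (x ∷ xs) ys {suc b} (s≤s h) = s≤s (length-++-≤ xs ys h)

  module _ (U Ω : ℕ) (hops≤ : ∀ w → U * ∑ (hops w) factor * 8 ^ (2 + κ) ≤ Ω) where
    expected-Φ : ∀ p E H todo → U ^ p * ∑ (seqs m n) (Φ p E H todo) ≤
                 m ^ n * 8 ^ (length E + κ * length H) * 2 ^ (3 * p + length todo) * Ω ^ p
    expected-Φ zero E H todo = begin
      1 * ∑ (seqs m n) (Φ 0 E H todo)                            ≡⟨ *-identityˡ _ ⟩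
      ∑ (seqs m n) (Φ 0 E H todo)                                ≤⟨ Wt.expected-weight class-size E H ⟩
      m ^ n * 8 ^ (length E + κ * length H)                      ≤⟨ m≤m*n _ (2 ^ length todo) {{m^n≢0 2 (length todo)}} ⟩
      m ^ n * 8 ^ (length E + κ * length H) * 2 ^ length todo    ≡⟨ *-identityʳ _ ⟨
      m ^ n * 8 ^ (length E + κ * length H) * 2 ^ length todo * 1 ∎
      where open ≤-Reasoning
    expected-Φ (suc p) E H [] = ≤-trans (≤-reflexive (trans (cong (U ^ suc p *_) (∑-zero (seqs m n) λ _ → refl)) (*-zeroʳ (U ^ suc p)))) z≤n
    expected-Φ (suc p) E H (w ∷ t) = begin
      U ^ suc p * ∑ (seqs m n) (Φ (suc p) E H (w ∷ t))
        ≡⟨ cong (U ^ suc p *_) (∑-+ (seqs m n) (Φ (suc p) E H t) _) ⟩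
      U ^ suc p * (∑ (seqs m n) (Φ (suc p) E H t) + ∑ (seqs m n) (λ s → ∑ (hops w) (λ h → factor h * Ψ h s)))
        ≡⟨ *-distribˡ-+ (U ^ suc p) _ _ ⟩
      U ^ suc p * ∑ (seqs m n) (Φ (suc p) E H t) + U ^ suc p * ∑ (seqs m n) (λ s → ∑ (hops w) (λ h → factor h * Ψ h s))
        ≤⟨ +-mono-≤ (expected-Φ (suc p) E H t) hop-part ⟩
      X * 2 ^ (3 * suc p + length t) * Ω ^ suc p + X * 2 ^ (3 * suc p + length t) * Ω ^ suc p
        ≡⟨ twice X (2 ^ (3 * suc p + length t)) (Ω ^ suc p) ⟩
      X * 2 ^ suc (3 * suc p + length t) * Ω ^ suc p
        ≡⟨ cong (λ z → X * 2 ^ z * Ω ^ suc p) (sym (+-suc (3 * suc p) (length t))) ⟩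
      X * 2 ^ (3 * suc p + suc (length t)) * Ω ^ suc p ∎
      where
      open ≤-Reasoning
      X : ℕ
      X = m ^ n * 8 ^ (length E + κ * length H)
      Ψ : Hop → List (Fin m) → ℕ
      Ψ h = Φ p (path h ++ E) ((head h , class h) ∷ H) (nodes h ++ w ∷ t)
      twice : ∀ x a b → x * a * b + x * a * b ≡ x * (2 * a) * b
      twice = solve-∀
      bound : ℕ
      bound = X * 8 ^ (2 + κ) * 2 ^ (3 * suc p + length t) * Ω ^ p
      one-hop : ∀ h → U ^ p * ∑ (seqs m n) (Ψ h) ≤ bound
      one-hop h = begin
        U ^ p * ∑ (seqs m n) (Ψ h)
          ≤⟨ expected-Φ p (path h ++ E) ((head h , class h) ∷ H) (nodes h ++ w ∷ t) ⟩
        m ^ n * 8 ^ (length (path h ++ E) + κ * suc (length H)) * 2 ^ (3 * p + length (nodes h ++ w ∷ t)) * Ω ^ p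
          ≤⟨ *-monoˡ-≤ (Ω ^ p) (*-mono-≤ (*-monoʳ-≤ (m ^ n) (^-monoʳ-≤ 8 (≤-trans
               (+-monoˡ-≤ (κ * suc (length H)) (length-++-≤ (path h) E (path≤ h))) (≤-reflexive (e₁ (length E) κ (length H))))))
               (^-monoʳ-≤ 2 (≤-trans (+-monoʳ-≤ (3 * p) (length-++-≤ (nodes h) (w ∷ t) (nodes≤ h))) (≤-reflexive (e₂ p (length t)))))) ⟩
        m ^ n * 8 ^ ((length E + κ * length H) + (2 + κ)) * 2 ^ (3 * suc p + length t) * Ω ^ p
          ≡⟨ cong (λ z → z * 2 ^ (3 * suc p + length t) * Ω ^ p) (trans (cong (m ^ n *_) (^-distribˡ-+-* 8 (length E + κ * length H) (2 + κ)))
               (sym (*-assoc (m ^ n) (8 ^ (length E + κ * length H)) (8 ^ (2 + κ))))) ⟩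
        bound ∎
        where
        e₁ : ∀ e κ h → 2 + e + κ * suc h ≡ e + κ * h + (2 + κ)
        e₁ = solve-∀
        e₂ : ∀ p t → 3 * p + (2 + suc t) ≡ 3 * suc p + t
        e₂ = solve-∀
      hop-part : U ^ suc p * ∑ (seqs m n) (λ s → ∑ (hops w) (λ h → factor h * Ψ h s)) ≤
                 X * 2 ^ (3 * suc p + length t) * Ω ^ suc p
      hop-part = begin
        U * U ^ p * ∑ (seqs m n) (λ s → ∑ (hops w) (λ h → factor h * Ψ h s))
          ≡⟨ cong (U * U ^ p *_) (trans (∑-swap (seqs m n) (hops w) (λ s h → factor h * Ψ h s)) (∑-cong (hops w) λ h → ∑-*ˡ (seqs m n) (factor h) (Ψ h))) ⟩
        U * U ^ p * ∑ (hops w) (λ h → factor h * ∑ (seqs m n) (Ψ h))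
          ≡⟨ trans (*-assoc U (U ^ p) _) (cong (U *_) (sym (∑-*ˡ (hops w) (U ^ p) _))) ⟩
        U * ∑ (hops w) (λ h → U ^ p * (factor h * ∑ (seqs m n) (Ψ h)))
          ≤⟨ *-monoʳ-≤ U (∑-mono (hops w) λ h → ≤-trans (≤-reflexive (swap (U ^ p) (factor h) (∑ (seqs m n) (Ψ h)))) (*-monoʳ-≤ (factor h) (one-hop h))) ⟩
        U * ∑ (hops w) (λ h → factor h * bound)
          ≡⟨ cong (U *_) (∑-*ʳ (hops w) factor bound) ⟩
        U * (∑ (hops w) factor * bound)
          ≡⟨ collect U (∑ (hops w) factor) X (8 ^ (2 + κ)) (2 ^ (3 * suc p + length t)) (Ω ^ p) ⟩
        U * ∑ (hops w) factor * 8 ^ (2 + κ) * (X * 2 ^ (3 * suc p + length t) * Ω ^ p)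
          ≤⟨ *-monoˡ-≤ (X * 2 ^ (3 * suc p + length t) * Ω ^ p) (hops≤ w) ⟩
        Ω * (X * 2 ^ (3 * suc p + length t) * Ω ^ p)
          ≡⟨ last Ω X (2 ^ (3 * suc p + length t)) (Ω ^ p) ⟩
        X * 2 ^ (3 * suc p + length t) * (Ω * Ω ^ p) ∎
        where
        swap : ∀ a b c → a * (b * c) ≡ b * (a * c)
        swap = solve-∀
        collect : ∀ U f X e b w → U * (f * (X * e * b * w)) ≡ U * f * e * (X * b * w)
        collect = solve-∀
        last : ∀ o X b w → o * (X * b * w) ≡ X * b * (o * w)
        last = solve-∀

-- Exploring a component

module Explore {m n : ℕ} (hd tl : Fin m → Fin n) (cls : Fin m → ℕ) (Z : ℕ → ℕ) (1≤Z : ∀ c → 1 ≤ Z c)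
  (Y₀ κ : ℕ) (0<n : 0 < n) (nY₀≤m : n * Y₀ ≤ m)
  (class-size : ∀ u c → n * ∑ (allFin m) (λ e → ⟦ (hd e == u) ∧ (c ≤ᵇ cls e) ⟧) * Z c ≤ m * κ)
  (ω : ℕ → ℕ) (k Q R : ℕ) (Z^k*ω : ∀ c → c ≤ R → Z c ^ k * ω c ≡ Q) (cls≤R : ∀ e → cls e ≤ R)
  (acc rejs s : List (Fin m)) (∏-split : ∀ g → ∏ acc g * ∏ rejs g ≡ ∏ s g)
  (full : ∀ {e} → e ∈ rejs → k ≤ ∑ acc (λ a → ⟦ (hd a == hd e) ∧ (cls e ≤ᵇ cls a) ⟧)) where

  open Hops {m} {n} hd tl cls Z 1≤Z Y₀ κ 0<n nY₀≤m class-size ω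
  open Hop
  open Wt using (EI; inClass)
  open import Data.List.Membership.DecPropositional {A = Fin n} Fin._≟_ using (_∈?_)
  open import Data.List.Membership.DecPropositional {A = Fin m} Fin._≟_ using () renaming (_∈?_ to _∈ₑ?_)

  headBound : List (Fin n × ℕ) → ℕ
  headBound = Wt.headBound class-size k

  bound : List (Fin m) → List (Fin n × ℕ) → ℕ
  bound E H = Y ^ length E * headBound H

  count : Fin n → ℕ → ℕ
  count u c = ∑ acc λ a → ⟦ inClass u c a ⟧

  Active : Fin n → Set
  Active v = ∃ λ e → e ∈ rejs × hd e ≡ v

  Active? : ∀ v → Dec (Active v)
  Active? v = Fin.any? λ e → (e ∈ₑ? rejs) ×-dec (hd e Fin.≟ v)

  active-count : ∀ {v} → Active v → k ≤ count v 0
  active-count (e , e∈ , refl) = ≤-trans (full e∈) (∑-mono acc λ a → ⟦⟧-mono λ h → ∧-intro (proj₁ (∧-split h)) refl)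

  -- No hop from `w` reaches a new head. The condition `tl e ∉ disc` in `updowns` loses nothing, as
  -- a discovered tail is expanded in its own right.
  record Exhausted (disc : List (Fin n)) (w : Fin n) : Set where
    constructor exhausted
    field
      downs   : ∀ {e} → e ∈ rejs → tl e ≡ w → hd e ∈ disc
      ups     : ∀ {e} → e ∈ rejs → hd e ≡ w → Active (tl e) → tl e ∈ disc
      updowns : ∀ {e} → e ∈ rejs → hd e ≡ w → tl e ∉ disc → ∀ {e′} → e′ ∈ rejs → tl e′ ≡ tl e → hd e′ ∈ disc

  Exhausted-mono : ∀ xs {disc w} → Exhausted disc w → Exhausted (xs ++ disc) w
  Exhausted-mono xs (exhausted d u ud) = exhausted
    (λ e∈ p → ∈-++⁺ʳ xs (d e∈ p)) (λ e∈ p a → ∈-++⁺ʳ xs (u e∈ p a))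
    (λ e∈ p t∉ e′∈ q → ∈-++⁺ʳ xs (ud e∈ p (t∉ ∘ ∈-++⁺ʳ xs) e′∈ q))

  record Inv (E : List (Fin m)) (H : List (Fin n × ℕ)) (todo disc : List (Fin n)) : Set where
    field
      distinctE : Distinct E
      E⊆rejs    : ∀ {e} → e ∈ E → e ∈ rejs
      E⊆disc    : ∀ {e} → e ∈ E → hd e ∈ disc × tl e ∈ disc
      distinctH : Distinct (map proj₁ H)
      H-count   : ∀ {u c} → (u , c) ∈ H → k ≤ count u c
      H⊆disc    : ∀ {u} → u ∈ map proj₁ H → u ∈ disc
      active∈H  : ∀ {v} → v ∈ disc → Active v → v ∈ map proj₁ H
      todo⊆disc : ∀ {v} → v ∈ todo → v ∈ disc
      done      : ∀ {w} → w ∈ disc → w ∈ todo ⊎ Exhausted disc w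

  record Extension (E : List (Fin m)) (disc : List (Fin n)) (w : Fin n) (h : Hop) : Set where
    field
      h∈hops    : h ∈ hops w
      gain      : factor h * (Y ^ length (path h) * Z (class h) ^ k) ≡ Y * Y * Q
      fresh     : Distinct E → (∀ {e} → e ∈ E → hd e ∈ disc × tl e ∈ disc) → Distinct (path h ++ E)
      path⊆rejs : ∀ {e} → e ∈ path h → e ∈ rejs
      path⊆     : ∀ {e} → e ∈ path h → hd e ∈ nodes h ++ disc × tl e ∈ nodes h ++ disc
      head-new  : head h ∉ disc
      head∈     : head h ∈ nodes h
      head-count : k ≤ count (head h) (class h)
      only-head : ∀ {v} → v ∈ nodes h → Active v → v ≡ head h

  extend : ∀ {E H todo disc w h} → Inv E H todo disc → Extension E disc w h →
           Inv (path h ++ E) ((head h , class h) ∷ H) (nodes h ++ todo) (nodes h ++ disc)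
  extend {E} {H} {todo} {disc} {w} {h} I X = record
    { distinctE = fresh distinctE E⊆disc
    ; E⊆rejs    = λ e∈ → [ path⊆rejs , E⊆rejs ]′ (∈-++⁻ (path h) e∈)
    ; E⊆disc    = λ e∈ → [ path⊆ , (λ q → let a , b = E⊆disc q in ∈-++⁺ʳ (nodes h) a , ∈-++⁺ʳ (nodes h) b) ]′ (∈-++⁻ (path h) e∈)
    ; distinctH = (λ p → head-new (H⊆disc p)) ∷ distinctH
    ; H-count   = λ { (here refl) → head-count ; (there p) → H-count p }
    ; H⊆disc    = λ { (here refl) → ∈-++⁺ˡ head∈ ; (there p) → ∈-++⁺ʳ (nodes h) (H⊆disc p) }
    ; active∈H  = λ v∈ a → [ (λ q → here (only-head q a)) , (λ q → there (active∈H q a)) ]′ (∈-++⁻ (nodes h) v∈)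
    ; todo⊆disc = λ v∈ → [ ∈-++⁺ˡ , (λ q → ∈-++⁺ʳ (nodes h) (todo⊆disc q)) ]′ (∈-++⁻ (nodes h) v∈)
    ; done      = λ w∈ → [ (λ q → inj₁ (∈-++⁺ˡ q)) , (λ q → [ (λ t → inj₁ (∈-++⁺ʳ (nodes h) t)) , (λ x → inj₂ (Exhausted-mono (nodes h) x)) ]′ (done q)) ]′
                           (∈-++⁻ (nodes h) w∈) }
    where open Inv I
          open Extension X

  gain₁ : ∀ c → c ≤ R → 1 * (Y * ω c) * (Y ^ 1 * Z c ^ k) ≡ Y * Y * Q
  gain₁ c c≤R = trans (ring Y (ω c) (Z c ^ k)) (cong (Y * Y *_) (Z^k*ω c c≤R))
    where ring : ∀ y w z → 1 * (y * w) * (y * 1 * z) ≡ y * y * (z * w)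
          ring = solve-∀

  gain₂ : ∀ c → c ≤ R → 1 * (1 * ω c) * (Y ^ 2 * Z c ^ k) ≡ Y * Y * Q
  gain₂ c c≤R = trans (ring Y (ω c) (Z c ^ k)) (cong (Y * Y *_) (Z^k*ω c c≤R))
    where ring : ∀ y w z → 1 * (1 * w) * (y * (y * 1) * z) ≡ y * y * (z * w)
          ring = solve-∀

  module _ {E : List (Fin m)} {disc : List (Fin n)} {w : Fin n} (w∈ : w ∈ disc) where
    down-extension : ∀ e → e ∈ rejs → tl e ≡ w → hd e ∉ disc → Extension E disc w (down w e)
    down-extension e e∈ refl hd∉ = record
      { h∈hops     = ∈-++⁺ˡ (∈-map⁺ (down w) (∈-allFin e))
      ; gain       = trans (cong (λ b → ⟦ b ⟧ * (Y * ω (cls e)) * (Y ^ 1 * Z (cls e) ^ k)) (==-refl (tl e))) (gain₁ (cls e) (cls≤R e))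
      ; fresh      = λ d sub → (λ e∈E → hd∉ (proj₁ (sub e∈E))) ∷ d
      ; path⊆rejs  = λ { (here refl) → e∈ }
      ; path⊆      = λ { (here refl) → here refl , there w∈ }
      ; head-new   = hd∉
      ; head∈      = here refl
      ; head-count = full e∈
      ; only-head  = λ { (here refl) _ → refl } }

    upHead-extension : ∀ e → e ∈ rejs → hd e ≡ w → Active (tl e) → tl e ∉ disc → Extension E disc w (upHead w e)
    upHead-extension e e∈ refl a tl∉ = record
      { h∈hops     = ∈-++⁺ʳ (map (down w) EI) (∈-++⁺ˡ (∈-map⁺ (upHead w) (∈-allFin e)))
      ; gain       = trans (cong (λ b → ⟦ b ⟧ * (Y * ω 0) * (Y ^ 1 * Z 0 ^ k)) (==-refl (hd e))) (gain₁ 0 z≤n)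
      ; fresh      = λ d sub → (λ e∈E → tl∉ (proj₂ (sub e∈E))) ∷ d
      ; path⊆rejs  = λ { (here refl) → e∈ }
      ; path⊆      = λ { (here refl) → there w∈ , here refl }
      ; head-new   = tl∉
      ; head∈      = here refl
      ; head-count = active-count a
      ; only-head  = λ { (here refl) _ → refl } }

    upDown-extension : ∀ e e′ → e ∈ rejs → hd e ≡ w → tl e ∉ disc → ¬ Active (tl e) →
                       e′ ∈ rejs → tl e′ ≡ tl e → hd e′ ∉ disc → Extension E disc w (upDown w e e′)
    upDown-extension e e′ e∈ refl tl∉ ¬a e′∈ t≡ hd∉ = record
      { h∈hops     = ∈-++⁺ʳ (map (down w) EI) (∈-++⁺ʳ (map (upHead w) EI)
                       (∈-concatMap⁺ (λ e → map (upDown w e) EI) (lose (∈-allFin e) (∈-map⁺ (upDown w e) (∈-allFin e′)))))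
      ; gain       = trans (cong₂ (λ b c → ⟦ b ⟧ * (⟦ c ⟧ * ω (cls e′)) * (Y ^ 2 * Z (cls e′) ^ k)) (==-refl (hd e))
                       (trans (cong (_== tl e) t≡) (==-refl (tl e)))) (gain₂ (cls e′) (cls≤R e′))
      ; fresh      = λ d sub → (λ { (here refl) → hd∉ w∈ ; (there e∈E) → tl∉ (proj₂ (sub e∈E)) }) ∷
                               (λ e′∈E → hd∉ (proj₁ (sub e′∈E))) ∷ d
      ; path⊆rejs  = λ { (here refl) → e∈ ; (there (here refl)) → e′∈ }
      ; path⊆      = λ { (here refl) → there (there w∈) , here refl ; (there (here refl)) → there (here refl) , here t≡ }
      ; head-new   = hd∉
      ; head∈      = there (here refl)
      ; head-count = full e′∈
      ; only-head  = λ { (here refl) a → ⊥-elim (¬a a) ; (there (here refl)) _ → refl } }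

    search : (∃ λ h → Extension E disc w h) ⊎ Exhausted disc w
    search = s₁ (Fin.any? λ e → (e ∈ₑ? rejs) ×-dec (tl e Fin.≟ w) ×-dec ¬? (hd e ∈? disc))
      where
      Down UpHead UpDown : Fin m → Set
      Down e = e ∈ rejs × tl e ≡ w × hd e ∉ disc
      UpHead e = e ∈ rejs × hd e ≡ w × Active (tl e) × tl e ∉ disc
      UpDown e = ∃ λ e′ → (e ∈ rejs × hd e ≡ w × tl e ∉ disc × ¬ Active (tl e)) × (e′ ∈ rejs × tl e′ ≡ tl e × hd e′ ∉ disc)
      Result = (∃ λ h → Extension E disc w h) ⊎ Exhausted disc w
      s₃ : ¬ ∃ Down → ¬ ∃ UpHead → Dec (∃ UpDown) → Result
      s₃ ¬d ¬u (yes (e , e′ , (a , b , c , d) , (f , g , h))) = inj₁ (upDown w e e′ , upDown-extension e e′ a b c d f g h)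
      s₃ ¬d ¬u (no ¬ud) = inj₂ (exhausted
        (λ {e} e∈ p → decidable-stable (hd e ∈? disc) λ q → ¬d (e , e∈ , p , q))
        (λ {e} e∈ p a → decidable-stable (tl e ∈? disc) λ q → ¬u (e , e∈ , p , a , q))
        -- A tail outside `disc` cannot be active here, since otherwise an `upHead` hop would have
        -- been found.
        (λ {e} e∈ p t∉ {e′} e′∈ q → decidable-stable (hd e′ ∈? disc) λ h∉ →
          ¬ud (e , e′ , (e∈ , p , t∉ , λ a → ¬u (e , e∈ , p , a , t∉)) , (e′∈ , q , h∉))))
      s₂ : ¬ ∃ Down → Dec (∃ UpHead) → Result
      s₂ ¬d (yes (e , a , b , c , d)) = inj₁ (upHead w e , upHead-extension e a b c d)
      s₂ ¬d (no ¬u) = s₃ ¬d ¬u (Fin.any? λ e → Fin.any? λ e′ →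
        ((e ∈ₑ? rejs) ×-dec (hd e Fin.≟ w) ×-dec ¬? (tl e ∈? disc) ×-dec ¬? (Active? (tl e))) ×-dec
        ((e′ ∈ₑ? rejs) ×-dec (tl e′ Fin.≟ tl e) ×-dec ¬? (hd e′ ∈? disc)))
      s₁ : Dec (∃ Down) → Result
      s₁ (yes (e , a , b , c)) = inj₁ (down w e , down-extension e a b c)
      s₁ (no ¬d) = s₂ ¬d (Fin.any? λ e → (e ∈ₑ? rejs) ×-dec (hd e Fin.≟ w) ×-dec Active? (tl e) ×-dec ¬? (tl e ∈? disc))

  record Closed (disc₀ : List (Fin n)) (N : ℕ) : Set where
    constructor closed
    field
      disc     : List (Fin n)
      heads    : List (Fin n)
      few      : length heads < N
      disc₀⊆   : ∀ {v} → v ∈ disc₀ → v ∈ disc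
      active∈  : ∀ {v} → v ∈ disc → Active v → v ∈ heads
      all-done : ∀ {w} → w ∈ disc → Exhausted disc w

  length-map : ∀ (H : List (Fin n × ℕ)) → length (map proj₁ H) ≡ length H
  length-map []      = refl
  length-map (_ ∷ H) = cong suc (length-map H)

  bound-extend : ∀ E H h → factor h * (Y ^ length (path h) * Z (class h) ^ k) ≡ Y * Y * Q →
                 factor h * bound (path h ++ E) ((head h , class h) ∷ H) ≡ bound E H * (Y * Y * Q)
  bound-extend E H h g = begin
    factor h * (Y ^ length (path h ++ E) * (Z (class h) ^ k * headBound H))
      ≡⟨ cong (λ z → factor h * (z * (Z (class h) ^ k * headBound H))) (trans (cong (Y ^_) (len (path h))) (^-distribˡ-+-* Y (length (path h)) (length E))) ⟩
    factor h * (Y ^ length (path h) * Y ^ length E * (Z (class h) ^ k * headBound H))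
      ≡⟨ ring (factor h) (Y ^ length (path h)) (Y ^ length E) (Z (class h) ^ k) (headBound H) ⟩
    bound E H * (factor h * (Y ^ length (path h) * Z (class h) ^ k))
      ≡⟨ cong (bound E H *_) g ⟩
    bound E H * (Y * Y * Q) ∎
    where
    open ≡-Reasoning
    len : ∀ xs → length (xs ++ E) ≡ length xs + length E
    len []       = refl
    len (_ ∷ xs) = cong suc (len xs)
    ring : ∀ f a b z h → f * (a * b * (z * h)) ≡ b * h * (f * (a * z))
    ring = solve-∀

  Outcome : ℕ → List (Fin m) → List (Fin n × ℕ) → List (Fin n) → List (Fin n) → Set
  Outcome p E H todo disc = (bound E H * (Y * Y * Q) ^ p ≤ Φ p E H todo s) ⊎ Closed disc (length H + p)

  retire : ∀ {E H w t disc} → Inv E H (w ∷ t) disc → Exhausted disc w → Inv E H t disc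
  retire I x = record
    { distinctE = distinctE ; E⊆rejs = E⊆rejs ; E⊆disc = E⊆disc ; distinctH = distinctH ; H-count = H-count
    ; H⊆disc = H⊆disc ; active∈H = active∈H ; todo⊆disc = todo⊆disc ∘ there
    ; done = λ w∈ → [ (λ { (here refl) → inj₂ x ; (there q) → inj₁ q }) , inj₂ ]′ (done w∈) }
    where open Inv I

  outcome-hop : ∀ {p E H w t disc h} → Extension E disc w h →
    Outcome p (path h ++ E) ((head h , class h) ∷ H) (nodes h ++ w ∷ t) (nodes h ++ disc) → Outcome (suc p) E H (w ∷ t) disc
  outcome-hop {p} {E} {H} {w} {t} {disc} {h} X = [ inj₁ ∘ here-bound , inj₂ ∘ weaken ]′
    where
    open Extension X
    open ≤-Reasoning
    term : Hop → ℕ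
    term h = factor h * Φ p (path h ++ E) ((head h , class h) ∷ H) (nodes h ++ w ∷ t) s
    here-bound : bound (path h ++ E) ((head h , class h) ∷ H) * (Y * Y * Q) ^ p ≤ Φ p (path h ++ E) ((head h , class h) ∷ H) (nodes h ++ w ∷ t) s →
                 bound E H * (Y * Y * Q) ^ suc p ≤ Φ (suc p) E H (w ∷ t) s
    here-bound le = begin
      bound E H * (Y * Y * Q * (Y * Y * Q) ^ p)                ≡⟨ *-assoc (bound E H) (Y * Y * Q) ((Y * Y * Q) ^ p) ⟨
      bound E H * (Y * Y * Q) * (Y * Y * Q) ^ p                ≡⟨ cong (_* (Y * Y * Q) ^ p) (bound-extend E H h gain) ⟨
      factor h * bound (path h ++ E) ((head h , class h) ∷ H) * (Y * Y * Q) ^ p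
        ≡⟨ *-assoc (factor h) (bound (path h ++ E) ((head h , class h) ∷ H)) ((Y * Y * Q) ^ p) ⟩
      factor h * (bound (path h ++ E) ((head h , class h) ∷ H) * (Y * Y * Q) ^ p)   ≤⟨ *-monoʳ-≤ (factor h) le ⟩
      term h                                                   ≤⟨ ∑-∈ term h∈hops ⟩
      ∑ (hops w) term                                          ≤⟨ m≤n+m _ (Φ (suc p) E H t s) ⟩
      Φ (suc p) E H (w ∷ t) s                                  ∎
    weaken : Closed (nodes h ++ disc) (suc (length H) + p) → Closed disc (length H + suc p)
    weaken (closed d hs few sub act dn) = closed d hs (≤-trans few (≤-reflexive (sym (+-suc (length H) p))))
      (λ v∈ → sub (∈-++⁺ʳ (nodes h) v∈)) act dn

  -- Lexicographic recursion: a hop spends one unit of `p` and keeps `w` on the list for further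
  -- hops, while an exhausted vertex leaves the list. Each choice matches one summand of `Φ`.
  explore : ∀ p E H todo disc → Inv E H todo disc → Outcome p E H todo disc
  explore zero E H todo disc I = inj₁ (begin
    bound E H * 1                                   ≡⟨ *-identityʳ _ ⟩
    bound E H                                       ≤⟨ Wt.weight-lower class-size k acc rejs id E H distinctE distinctH (λ {e} e∈ → e , E⊆rejs e∈ , refl) H-count ⟩
    ∏ acc (weight E H) * ∏ rejs (weight E H)        ≡⟨ ∏-split (weight E H) ⟩
    ∏ s (weight E H)                                ∎)
    where open ≤-Reasoning
          open Inv I
  explore (suc p) E H [] disc I = inj₂ (closed disc (map proj₁ H)
    (≤-trans (s≤s (≤-reflexive (length-map H))) (≤-trans (s≤s (m≤m+n (length H) p)) (≤-reflexive (sym (+-suc (length H) p)))))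
    id active∈H (λ w∈ → [ (λ ()) , id ]′ (done w∈)))
    where open Inv I
  explore (suc p) E H (w ∷ t) disc I =
    [ (λ (h , X) → outcome-hop X (explore p (path h ++ E) ((head h , class h) ∷ H) (nodes h ++ w ∷ t) (nodes h ++ disc) (extend I X)))
    , (λ x → [ (λ le → inj₁ (≤-trans le (m≤m+n _ _))) , inj₂ ]′ (explore (suc p) E H t disc (retire I x)))
    ]′ (search (Inv.todo⊆disc I (here refl)))

  initial : ∀ {u} → Active u → Inv [] ((u , 0) ∷ []) (u ∷ []) (u ∷ [])
  initial a = record
    { distinctE = []
    ; E⊆rejs    = λ ()
    ; E⊆disc    = λ ()
    ; distinctH = (λ ()) ∷ []
    ; H-count   = λ { (here refl) → active-count a }
    ; H⊆disc    = id
    ; active∈H  = λ v∈ _ → v∈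
    ; todo⊆disc = id
    ; done      = inj₁ }

  module _ {disc₀ : List (Fin n)} {N : ℕ} (C : Closed disc₀ N) where
    open Closed C
    open Exhausted

    -- Tails that are not heads of rejected arrivals and lead to no new head are never recorded.
    -- Adding them makes the discovered set closed under rejected edges without adding any head.
    Near : Fin n → Set
    Near v = v ∈ disc ⊎ ∃ λ e → e ∈ rejs × tl e ≡ v × hd e ∈ disc

    Near? : ∀ v → Dec (Near v)
    Near? v = (v ∈? disc) ⊎-dec Fin.any? λ e → (e ∈ₑ? rejs) ×-dec (tl e Fin.≟ v) ×-dec (hd e ∈? disc)

    near-head : ∀ {e} → e ∈ rejs → Near (hd e) → hd e ∈ disc
    near-head e∈ (inj₁ p)                 = p
    near-head {e} e∈ (inj₂ (e₁ , e₁∈ , q , p)) =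
      subst (_∈ disc) q (ups (all-done p) e₁∈ refl (e , e∈ , sym q))

    head⇒tail : ∀ {e} → e ∈ rejs → Near (hd e) → Near (tl e)
    head⇒tail {e} e∈ p = inj₂ (e , e∈ , refl , near-head e∈ p)

    tail⇒head : ∀ {e} → e ∈ rejs → Near (tl e) → Near (hd e)
    tail⇒head {e} e∈ (inj₁ p) = inj₁ (downs (all-done p) e∈ refl)
    tail⇒head {e} e∈ (inj₂ (e₁ , e₁∈ , q , p)) = cases (tl e ∈? disc)
      where cases : Dec (tl e ∈ disc) → Near (hd e)
            cases (yes t∈) = inj₁ (downs (all-done t∈) e∈ refl)
            cases (no t∉)  = inj₁ (updowns (all-done p) e₁∈ refl (t∉ ∘ subst (_∈ disc) q) e∈ (sym q))

    head∈heads : ∀ {e} → e ∈ rejs → Near (hd e) → hd e ∈ heads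
    head∈heads {e} e∈ p = active∈ (near-head e∈ p) (e , e∈ , refl)

-- Load of the algorithm

dec-sound : {P : Set} (d : Dec P) → does d ≡ true → P
dec-sound (yes p) _ = p

∈⇒elem : ∀ {n} {v : Fin n} {xs} → v ∈ xs → elem v xs ≡ true
∈⇒elem {v = v} (here refl) rewrite ==-refl v = refl
∈⇒elem {v = v} {x ∷ xs} (there p) with v == x
... | true  = refl
... | false = ∈⇒elem p

∑-zero-or-∈ : {A : Set} (rs : List A) (p : A → Bool) → ∑ rs (λ r → ⟦ p r ⟧) ≡ 0 ⊎ ∃ λ r → r ∈ rs × p r ≡ true
∑-zero-or-∈ []       p = inj₁ refl
∑-zero-or-∈ (r ∷ rs) p with p r in q
... | true  = inj₂ (r , here refl , q)
... | false with ∑-zero-or-∈ rs p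
... | inj₁ z             = inj₁ z
... | inj₂ (r′ , r∈ , h) = inj₂ (r′ , there r∈ , h)

∏-map : {A B : Set} (h : A → B) (xs : List A) (f : B → ℕ) → ∏ (map h xs) f ≡ ∏ xs (f ∘ h)
∏-map h []       f = refl
∏-map h (x ∷ xs) f = cong (f (h x) *_) (∏-map h xs f)

*-foldr-⊔ : {A : Set} (c : ℕ) (f : A → ℕ) (xs : List A) {b : ℕ} → (∀ x → c * f x ≤ b) → c * foldr _⊔_ 0 (map f xs) ≤ b
*-foldr-⊔ c f []       h = ≤-trans (≤-reflexive (*-zeroʳ c)) z≤n
*-foldr-⊔ c f (x ∷ xs) h = ≤-trans (≤-reflexive (*-distribˡ-⊔ c (f x) _)) (⊔-lub (h x) (*-foldr-⊔ c f xs h))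

load≤length : ∀ {n} (hs : List (Fin n)) v → load hs v ≤ length hs
load≤length hs v = ≤-trans (≤-reflexive (load≡∑ hs v))
  (≤-trans (∑-mono hs (λ w → ⟦⟧≤1 (w == v))) (≤-reflexive (trans (∑-const hs 1) (*-identityʳ _))))

length-runAlg : ∀ {n} (G : Graph n) A past es → length (runAlg G A past es) ≡ length es
length-runAlg G A past []       = refl
length-runAlg G A past (e ∷ es) = cong suc (length-runAlg G A (past ++ [ e ]) es)

module Analysis {n : ℕ} (G : Graph n) (dir : Fin (length (edges G)) → Bool) (cls : Fin (length (edges G)) → ℕ)
  (k : ℕ) (Z : ℕ → ℕ) (1≤Z : ∀ c → 1 ≤ Z c) (Y₀ κ : ℕ) (0<n : 0 < n) (nY₀≤m : n * Y₀ ≤ length (edges G))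
  (class-size : ∀ u c → n * ∑ (allFin (length (edges G))) (λ e → ⟦ (target (dir e) (edge G e) == u) ∧ (c ≤ᵇ cls e) ⟧) * Z c ≤ length (edges G) * κ)
  (ω : ℕ → ℕ) (Q R : ℕ) (Z^k*ω : ∀ c → c ≤ R → Z c ^ k * ω c ≡ Q) (cls≤R : ∀ e → cls e ≤ R)
  (p j : ℕ) (2p<2^j : 2 * p < 2 ^ j) where

  open Algo G dir cls k
  open Hops {m} {n} hd tl cls Z 1≤Z Y₀ κ 0<n nY₀≤m class-size ω using (Φ; Y; hops; expected-Φ; module Hop)

  opt : List (Fin m) → ℕ
  opt s = Mstar (map (edge G) s)

  -- The value that `Φ` must reach when `p` hops succeed: the full root contributes `Z 0 ^ k`, each
  -- hop `Y * Y * Q`.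
  threshold-weight : ℕ
  threshold-weight = Z 0 ^ k * (Y * Y * Q) ^ p

  Φ-from : Fin n → List (Fin m) → ℕ
  Φ-from u = Φ p [] ((u , 0) ∷ []) (u ∷ [])

  module _ (s : List (Fin m)) (0<opt : 0 < opt s) where
    acc : List (Fin m)
    acc = accepted (run initial s)
    rs : List Rejected
    rs = rejected (run initial s)

    rejs : List (Fin m)
    rejs = map proj₁ rs

    run-splits : ∀ g → ∏ acc g * ∏ rejs g ≡ ∏ s g
    run-splits g = trans (cong (∏ acc g *_) (∏-map proj₁ rs g)) (trans (∏-run g initial s) (*-identityˡ (∏ s g)))

    rejected-full : ∀ {e} → e ∈ rejs → k ≤ count acc (hd e) (cls e)
    rejected-full e∈ = let r , r∈ , eq = ∈-map⁻ proj₁ e∈ in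
      subst (λ e → k ≤ count acc (hd e) (cls e)) (sym eq) (rejectedFull s r∈)

    module X = Explore {m} {n} hd tl cls Z 1≤Z Y₀ κ 0<n nY₀≤m class-size ω k Q R Z^k*ω cls≤R
      acc rejs s run-splits rejected-full

    small-component : ∀ {r} → r ∈ rs → X.Closed (hd (proj₁ r) ∷ []) (suc p) → greedyLoad rs (place r) ≤ suc j * (2 * opt s)
    small-component {r} r∈ C = Levels.greedy-load rs place other (opt s) 0<opt (dense s) (threshold s) D closed-D
      heads elem-heads j (≤-<-trans (*-monoʳ-≤ 2 (≤-pred few)) 2p<2^j) (place r) root
      where
      open X.Closed C
      D : Fin n → Bool
      D v = does (X.Near? C v)
      in-D : ∀ v → X.Near C v → D v ≡ true
      in-D v q = dec-true (X.Near? C v) q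
      near : ∀ v → D v ≡ true → X.Near C v
      near v q = dec-sound (X.Near? C v) q
      closed-D : ∀ {r} → r ∈ rs → D (place r) ≡ true → D (other r) ≡ true
      closed-D {e , true}  r∈ d = in-D (tl e) (X.head⇒tail C (∈-map⁺ proj₁ r∈) (near (hd e) d))
      closed-D {e , false} r∈ d = in-D (hd e) (X.tail⇒head C (∈-map⁺ proj₁ r∈) (near (tl e) d))
      elem-heads : ∀ {r} → r ∈ rs → D (place r) ≡ true → elem (place r) heads ≡ false → elem (other r) heads ≡ true
      elem-heads {e , true}  r∈ d ¬h = ⊥-elim (true≢false (∈⇒elem (X.head∈heads C (∈-map⁺ proj₁ r∈) (near (hd e) d))) ¬h)
      elem-heads {e , false} r∈ d _  = ∈⇒elem (X.head∈heads C (∈-map⁺ proj₁ r∈) (X.tail⇒head C (∈-map⁺ proj₁ r∈) (near (tl e) d)))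
      root-near : X.Near C (hd (proj₁ r))
      root-near = inj₁ (disc₀⊆ (here refl))
      root : D (place r) ≡ true
      root = [ (λ q → in-D (place r) (subst (X.Near C) (sym (proj₁ q)) root-near))
             , (λ q → in-D (place r) (subst (X.Near C) (sym (proj₁ q)) (X.head⇒tail C (∈-map⁺ proj₁ r∈) root-near)))
             ]′ (place-other r)

    load-bound : ℕ
    load-bound = suc R * k + suc j * (2 * opt s)

    dichotomy : ∀ v → load (runAlg G alg [] s) v ≤ load-bound ⊎ ∃ λ u → threshold-weight ≤ Φ-from u s
    dichotomy v = [ (λ z → inj₁ (add-loads (≤-trans (≤-reflexive z) z≤n)))
                  , (λ (r , r∈ , q) → [ (λ le → inj₂ (hd (proj₁ r) , subst (_≤ Φ-from (hd (proj₁ r)) s) bound≡ le))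
                                      , (λ C → inj₁ (add-loads (subst (λ w → greedyLoad rs w ≤ suc j * (2 * opt s)) (==⇒≡ (place r) v q) (small-component r∈ C))))
                                      ]′ (X.explore p [] ((hd (proj₁ r) , 0) ∷ []) (hd (proj₁ r) ∷ []) (hd (proj₁ r) ∷ [])
                                           (X.initial (proj₁ r , ∈-map⁺ proj₁ r∈ , refl))))
                  ]′ (∑-zero-or-∈ rs (λ r → place r == v))
      where
      bound≡ : 1 * (Z 0 ^ k * 1) * (Y * Y * Q) ^ p ≡ threshold-weight
      bound≡ = cong (_* (Y * Y * Q) ^ p) (trans (*-identityˡ _) (*-identityʳ (Z 0 ^ k)))
      add-loads : greedyLoad rs v ≤ suc j * (2 * opt s) → load (runAlg G alg [] s) v ≤ load-bound
      add-loads h = ≤-trans (≤-reflexive (load-alg s v)) (+-mono-≤ (acceptedLoad≤ R cls≤R s v) h)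

    -- Markov's inequality made pointwise: if the load bound fails, some `Φ-from u s` reaches
    -- `threshold-weight`, and the load is then at most the number `n` of arrivals.
    maxLoad-alg : length s ≡ n → threshold-weight * maxLoad (runAlg G alg [] s) ≤
                  threshold-weight * load-bound + n * ∑ (allFin n) (λ u → Φ-from u s)
    maxLoad-alg len = *-foldr-⊔ threshold-weight (load (runAlg G alg [] s)) (allFin n) λ v →
      [ (λ h → ≤-trans (*-monoʳ-≤ threshold-weight h) (m≤m+n _ _))
      , (λ (u , h) → begin
          threshold-weight * load (runAlg G alg [] s) v     ≤⟨ *-mono-≤ h (load≤n v) ⟩
          Φ-from u s * n                                    ≡⟨ *-comm (Φ-from u s) n ⟩
          n * Φ-from u s                                    ≤⟨ *-monoʳ-≤ n (∑-allFin-term (λ u → Φ-from u s) u) ⟩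
          n * ∑ (allFin n) (λ u → Φ-from u s)               ≤⟨ m≤n+m _ (threshold-weight * load-bound) ⟩
          threshold-weight * load-bound + n * ∑ (allFin n) (λ u → Φ-from u s) ∎)
      ]′ (dichotomy v)
      where
      open ≤-Reasoning
      load≤n : ∀ v → load (runAlg G alg [] s) v ≤ n
      load≤n v = ≤-trans (load≤length (runAlg G alg [] s) v) (≤-reflexive (trans (length-runAlg G alg [] s) len))

  module _ (opt-pos : ∀ s → length s ≡ n → 0 < opt s) where
    summed : threshold-weight * ∑ (seqs m n) (λ s → maxLoad (runAlg G alg [] s)) ≤
             threshold-weight * (m ^ n * (suc R * k) + suc j * (2 * ∑ (seqs m n) opt)) +
             n * ∑ (allFin n) (λ u → ∑ (seqs m n) (Φ-from u))
    summed = begin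
      threshold-weight * ∑ (seqs m n) (λ s → maxLoad (runAlg G alg [] s))
        ≡⟨ ∑-*ˡ (seqs m n) threshold-weight (λ s → maxLoad (runAlg G alg [] s)) ⟨
      ∑ (seqs m n) (λ s → threshold-weight * maxLoad (runAlg G alg [] s))
        ≤⟨ ∑-seqs-mono m n (λ s len → maxLoad-alg s (opt-pos s len) len) ⟩
      ∑ (seqs m n) (λ s → threshold-weight * (suc R * k + suc j * (2 * opt s)) + n * ∑ (allFin n) (λ u → Φ-from u s))
        ≡⟨ ∑-+ (seqs m n) (λ s → threshold-weight * (suc R * k + suc j * (2 * opt s))) (λ s → n * ∑ (allFin n) (λ u → Φ-from u s)) ⟩
      ∑ (seqs m n) (λ s → threshold-weight * (suc R * k + suc j * (2 * opt s))) + ∑ (seqs m n) (λ s → n * ∑ (allFin n) (λ u → Φ-from u s))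
        ≡⟨ cong₂ _+_
             (trans (∑-*ˡ (seqs m n) threshold-weight (λ s → suc R * k + suc j * (2 * opt s))) (cong (threshold-weight *_)
               (trans (∑-+ (seqs m n) (λ _ → suc R * k) (λ s → suc j * (2 * opt s))) (cong₂ _+_ (∑-seqs-const m n (suc R * k))
                 (trans (∑-*ˡ (seqs m n) (suc j) (λ s → 2 * opt s)) (cong (suc j *_) (∑-*ˡ (seqs m n) 2 opt)))))))
             (trans (∑-*ˡ (seqs m n) n (λ s → ∑ (allFin n) (λ u → Φ-from u s))) (cong (n *_) (∑-swap (seqs m n) (allFin n) (λ s u → Φ-from u s)))) ⟩
      threshold-weight * (m ^ n * (suc R * k) + suc j * (2 * ∑ (seqs m n) opt)) + n * ∑ (allFin n) (λ u → ∑ (seqs m n) (Φ-from u)) ∎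
      where open ≤-Reasoning

  module _ (U Ω : ℕ) (hops≤ : ∀ w → U * ∑ (hops w) Hop.factor * 8 ^ (2 + κ) ≤ Ω) where
    rare : U ^ p * (n * ∑ (allFin n) (λ u → ∑ (seqs m n) (Φ-from u))) ≤ n * (n * (m ^ n * 8 ^ κ * 2 ^ (3 * p + 1) * Ω ^ p))
    rare = begin
      U ^ p * (n * ∑ (allFin n) (λ u → ∑ (seqs m n) (Φ-from u)))
        ≡⟨ swap (U ^ p) n _ ⟩
      n * (U ^ p * ∑ (allFin n) (λ u → ∑ (seqs m n) (Φ-from u)))
        ≡⟨ cong (n *_) (∑-*ˡ (allFin n) (U ^ p) (λ u → ∑ (seqs m n) (Φ-from u))) ⟨
      n * ∑ (allFin n) (λ u → U ^ p * ∑ (seqs m n) (Φ-from u))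
        ≤⟨ *-monoʳ-≤ n (∑-mono (allFin n) λ u → expected-Φ U Ω hops≤ p [] ((u , 0) ∷ []) (u ∷ [])) ⟩
      n * ∑ (allFin n) (λ u → m ^ n * 8 ^ (κ * 1) * 2 ^ (3 * p + 1) * Ω ^ p)
        ≡⟨ cong (n *_) (∑-allFin-const n (m ^ n * 8 ^ (κ * 1) * 2 ^ (3 * p + 1) * Ω ^ p)) ⟩
      n * (n * (m ^ n * 8 ^ (κ * 1) * 2 ^ (3 * p + 1) * Ω ^ p))
        ≡⟨ cong (λ z → n * (n * (m ^ n * 8 ^ z * 2 ^ (3 * p + 1) * Ω ^ p))) (*-identityʳ κ) ⟩
      n * (n * (m ^ n * 8 ^ κ * 2 ^ (3 * p + 1) * Ω ^ p)) ∎
      where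
      open ≤-Reasoning
      swap : ∀ a b c → a * (b * c) ≡ b * (a * c)
      swap = solve-∀

-- The competitive ratio

m≤2^m : ∀ m → m ≤ 2 ^ m
m≤2^m zero    = z≤n
m≤2^m (suc m) = ≤-trans (+-mono-≤ (m^n>0 2 m) (m≤2^m m)) (≤-reflexive (cong (2 ^ m +_) (sym (+-identityʳ (2 ^ m)))))

n≤2^⌈log₂n⌉ : ∀ n → n ≤ 2 ^ ⌈log₂ n ⌉
n≤2^⌈log₂n⌉ = <-rec (λ n → n ≤ 2 ^ ⌈log₂ n ⌉) go
  where
  open ≤-Reasoning
  go : ∀ n → (∀ {i} → i < n → i ≤ 2 ^ ⌈log₂ i ⌉) → n ≤ 2 ^ ⌈log₂ n ⌉
  go zero          rec = z≤n
  go (suc zero)    rec = m^n>0 2 ⌈log₂ 1 ⌉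
  go (suc (suc n)) rec = begin
    N                          ≡⟨ ⌊n/2⌋+⌈n/2⌉≡n N ⟨
    ⌊ N /2⌋ + ⌈ N /2⌉          ≤⟨ +-monoˡ-≤ ⌈ N /2⌉ (⌊n/2⌋≤⌈n/2⌉ N) ⟩
    ⌈ N /2⌉ + ⌈ N /2⌉          ≡⟨ cong (⌈ N /2⌉ +_) (+-identityʳ ⌈ N /2⌉) ⟨
    2 * ⌈ N /2⌉                ≤⟨ *-monoʳ-≤ 2 (rec (⌈n/2⌉<n n)) ⟩
    2 * 2 ^ ⌈log₂ ⌈ N /2⌉ ⌉    ≡⟨ cong (λ z → 2 ^ suc z) (⌈log₂⌈n/2⌉⌉≡⌈log₂n⌉∸1 N) ⟩
    2 ^ suc (⌈log₂ N ⌉ ∸ 1)    ≡⟨ cong (2 ^_) (m+[n∸m]≡n (⌈log₂⌉-mono-≤ {2} {N} (s≤s (s≤s z≤n)))) ⟩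
    2 ^ ⌈log₂ N ⌉              ∎
    where N = suc (suc n)

8^≡2^ : ∀ a → 8 ^ a ≡ 2 ^ (3 * a)
8^≡2^ = ^-*-assoc 2 3

-- The origin of 58: the left side is at most 2^(17+38M), where 36M comes from `8 ^ κ` with κ = 12M
-- and 2M from M². The 32 is the cost per hop in `rare-constant`.
hop-constant : ∀ M → 0 < M → 32 * (49 * (M * M) * 8 ^ (2 + 4 * (3 * M))) ≤ 2 ^ (58 * M)
hop-constant M 0<M = begin
  32 * (49 * (M * M) * 8 ^ (2 + 4 * (3 * M)))
    ≤⟨ *-monoʳ-≤ 32 (*-mono-≤ (*-mono-≤ (m≤m+n 49 15) (*-mono-≤ (m≤2^m M) (m≤2^m M))) (≤-reflexive (8^≡2^ (2 + 4 * (3 * M))))) ⟩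
  2 ^ 5 * (2 ^ 6 * (2 ^ M * 2 ^ M) * 2 ^ (3 * (2 + 4 * (3 * M))))
    ≡⟨ cong (2 ^ 5 *_) (trans (cong (_* 2 ^ (3 * (2 + 4 * (3 * M)))) (trans (cong (2 ^ 6 *_) (sym (^-distribˡ-+-* 2 M M))) (sym (^-distribˡ-+-* 2 6 (M + M)))))
         (sym (^-distribˡ-+-* 2 (6 + (M + M)) (3 * (2 + 4 * (3 * M)))))) ⟩
  2 ^ 5 * 2 ^ (6 + (M + M) + 3 * (2 + 4 * (3 * M)))
    ≡⟨ ^-distribˡ-+-* 2 5 (6 + (M + M) + 3 * (2 + 4 * (3 * M))) ⟨
  2 ^ (5 + (6 + (M + M) + 3 * (2 + 4 * (3 * M))))
    ≤⟨ ^-monoʳ-≤ 2 (≤-trans (≤-reflexive (r₁ M)) (≤-trans (+-monoˡ-≤ (38 * M) (≤-trans (m≤m+n 17 3) (*-monoʳ-≤ 20 0<M))) (≤-reflexive (r₂ M)))) ⟩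
  2 ^ (58 * M) ∎
  where
  open ≤-Reasoning
  r₁ : ∀ M → 5 + (6 + (M + M) + 3 * (2 + 4 * (3 * M))) ≡ 17 + 38 * M
  r₁ = solve-∀
  r₂ : ∀ M → 20 * M + 38 * M ≡ 58 * M
  r₂ = solve-∀

-- The root is a full head of class 0; its contribution `tower 0 ^ k` covers its cost `8 ^ κ` and
-- one spare factor 2.
root-constant : ∀ M → 0 < M → 8 ^ (4 * (3 * M)) * 2 ≤ 2 ^ (58 * M + 2 * (3 * M))
root-constant M 0<M = begin
  8 ^ (4 * (3 * M)) * 2          ≡⟨ cong (_* 2) (8^≡2^ (4 * (3 * M))) ⟩
  2 ^ (3 * (4 * (3 * M))) * 2    ≡⟨ *-comm (2 ^ (3 * (4 * (3 * M)))) 2 ⟩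
  2 ^ suc (3 * (4 * (3 * M)))    ≤⟨ ^-monoʳ-≤ 2 (≤-trans (+-mono-≤ (≤-trans 0<M (m≤n*m M 28)) (≤-reflexive (r₁ M))) (≤-reflexive (r₂ M))) ⟩
  2 ^ (58 * M + 2 * (3 * M))     ∎
  where
  open ≤-Reasoning
  r₁ : ∀ M → 3 * (4 * (3 * M)) ≡ 36 * M
  r₁ = solve-∀
  r₂ : ∀ M → 28 * M + 36 * M ≡ 58 * M + 2 * (3 * M)
  r₂ = solve-∀

-- One factor n pays for the roots and one for the trivial load bound on a bad sequence; the powers
-- of 2 count the orders in which an exploration can interleave its hops with retired vertices.
rare-constant : ∀ n p c e K T U W → n ≤ 2 ^ p → 32 * c ≤ U → e * 2 ≤ K →
                n * (n * (W * e * 2 ^ (3 * p + 1) * (c * T) ^ p)) ≤ U ^ p * (K * T ^ p * W)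
rare-constant n p c e K T U W hn hc hK = begin
  n * (n * (W * e * 2 ^ (3 * p + 1) * (c * T) ^ p))
    ≤⟨ *-mono-≤ hn (*-monoˡ-≤ _ hn) ⟩
  2 ^ p * (2 ^ p * (W * e * 2 ^ (3 * p + 1) * (c * T) ^ p))
    ≡⟨ cong₂ (λ a b → 2 ^ p * (2 ^ p * (W * e * a * b)))
         (trans (^-distribˡ-+-* 2 (3 * p) 1) (cong (_* 2) (sym (^-*-assoc 2 3 p)))) (^-distribʳ-* p c T) ⟩
  2 ^ p * (2 ^ p * (W * e * (8 ^ p * 2) * (c ^ p * T ^ p)))
    ≡⟨ ring (2 ^ p) W e (8 ^ p) (c ^ p) (T ^ p) ⟩
  2 ^ p * (2 ^ p * 8 ^ p) * c ^ p * (e * 2 * T ^ p * W)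
    ≡⟨ cong (λ z → 2 ^ p * z * c ^ p * (e * 2 * T ^ p * W)) (sym (^-distribʳ-* p 2 8)) ⟩
  2 ^ p * 16 ^ p * c ^ p * (e * 2 * T ^ p * W)
    ≡⟨ cong (λ z → z * c ^ p * (e * 2 * T ^ p * W)) (sym (^-distribʳ-* p 2 16)) ⟩
  32 ^ p * c ^ p * (e * 2 * T ^ p * W)
    ≡⟨ cong (_* (e * 2 * T ^ p * W)) (sym (^-distribʳ-* p 32 c)) ⟩
  (32 * c) ^ p * (e * 2 * T ^ p * W)
    ≤⟨ *-mono-≤ (^-monoˡ-≤ p hc) (*-monoˡ-≤ W (*-monoˡ-≤ (T ^ p) hK)) ⟩
  U ^ p * (K * T ^ p * W) ∎
  where
  open ≤-Reasoning
  ring : ∀ a W e b c t → a * (a * (W * e * (b * 2) * (c * t))) ≡ a * (a * b) * c * (e * 2 * t * W)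
  ring = solve-∀

-- Here k = 64M, so accepted arrivals cost at most 2L · 64 · 2O = 256LO; greedy ones cost at most
-- 8LO, and bad sequences at most W ≤ LO. The sum is 265LO.
final-constant : ∀ W R L M O S D N → 0 < D → N ≤ D * W → M * W ≤ 2 * O → W ≤ O → R ≤ L → 1 ≤ L →
  D * S ≤ D * (W * (suc R * (58 * M + 2 * (3 * M))) + suc (2 + R) * (2 * O)) + N → S ≤ 265 * L * O
final-constant W R L M O S D N 0<D hN hM hW hR hL h = ≤-trans (*-cancelˡ-≤ D {{>-nonZero 0<D}} (begin
  D * S                                          ≤⟨ h ⟩
  D * B + N                                      ≤⟨ +-monoʳ-≤ (D * B) hN ⟩
  D * B + D * W                                  ≡⟨ *-distribˡ-+ D B W ⟨
  D * (B + W)                                    ∎)) (begin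
  B + W                                                  ≡⟨ r₁ W R M O ⟩
  suc R * (64 * (M * W)) + (3 + R) * (2 * O) + 1 * W
    ≤⟨ +-mono-≤ (+-mono-≤ (*-mono-≤ (+-mono-≤ hL hR) (*-monoʳ-≤ 64 hM)) (*-monoˡ-≤ (2 * O) (+-mono-≤ (*-monoʳ-≤ 3 hL) hR))) (*-mono-≤ hL hW) ⟩
  (L + L) * (64 * (2 * O)) + (3 * L + L) * (2 * O) + L * O  ≡⟨ r₂ L O ⟩
  265 * L * O                                            ∎)
  where
  open ≤-Reasoning
  B = W * (suc R * (58 * M + 2 * (3 * M))) + suc (2 + R) * (2 * O)
  r₁ : ∀ W R M O → W * (suc R * (58 * M + 2 * (3 * M))) + suc (2 + R) * (2 * O) + W ≡ suc R * (64 * (M * W)) + (3 + R) * (2 * O) + 1 * W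
  r₁ = solve-∀
  r₂ : ∀ L O → (L + L) * (64 * (2 * O)) + (3 * L + L) * (2 * O) + L * O ≡ 265 * L * O
  r₂ = solve-∀

module Competitive {n : ℕ} (3≤n : 3 ≤ n) (G : Graph n) where
  open Base G using (m; opt; inside≤opt)

  0<n : 0 < n
  0<n = ≤-trans (s≤s z≤n) 3≤n

  0<m : 0 < m
  0<m with edges G in eq
  ... | []    = contradiction eq (nonempty G)
  ... | _ ∷ _ = s≤s z≤n

  W O : ℕ
  W = m ^ n
  O = ∑ (seqs m n) opt

  0<W : 0 < W
  0<W = m^n>0 m {{>-nonZero 0<m}} n

  opt-pos : ∀ s → length s ≡ n → 0 < opt s
  opt-pos s len with opt s in eq
  ... | suc _ = s≤s z≤n
  ... | zero  = contradiction (begin-strict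
    0                                       <⟨ 0<n ⟩
    n                                       ≡⟨ len ⟨
    length s                                ≡⟨ *-identityʳ (length s) ⟨
    length s * 1                            ≡⟨ ∑-const s 1 ⟨
    ∑ s (λ _ → 1)                           ≤⟨ inside≤opt (λ _ → true) s ⟩
    opt s * size {n} (λ _ → true)           ≡⟨ cong (_* size {n} (λ _ → true)) eq ⟩
    0                                       ∎) λ ()
    where open ≤-Reasoning

  W≤O : W ≤ O
  W≤O = ≤-trans (≤-reflexive (sym (trans (∑-seqs-const m n 1) (*-identityʳ W)))) (∑-seqs-mono m n opt-pos)

  instance
    W≢0 : NonZero W
    W≢0 = >-nonZero 0<W

  M : ℕ
  -- Rounding up costs at most a factor 2, because every sequence has optimum at least 1.
  M = suc (O / W)

  O≤MW : O ≤ M * W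
  O≤MW = ≤-trans (≤-reflexive (m≡m%n+[m/n]*n O W)) (+-monoˡ-≤ (O / W * W) (<⇒≤ (m%n<n O W)))

  MW≤2O : M * W ≤ 2 * O
  MW≤2O = ≤-trans (+-mono-≤ W≤O (m/n*n≤m O W)) (≤-reflexive (cong (O +_) (sym (+-identityʳ O))))

  L R : ℕ
  L = loglog n
  R = ⌈log₂ ⌈log₂ n ⌉ ⌉

  1≤L : 1 ≤ L
  1≤L = m≤m⊔n 1 R

  Goal : Set
  Goal = Σ (Algorithm G) (λ A → ∑ (seqs m n) (λ s → maxLoad (runAlg G A [] s)) ≤ 265 * L * O)

  -- With fewer than 3M arrivals every algorithm is good enough. The other case needs 3M ≤ n to cut
  -- the arrivals into 3M nonempty blocks for `binTail-class`.
  few-vertices : n < 3 * M → Goal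
  few-vertices n<3M = (λ _ _ → true) , (begin
    ∑ (seqs m n) (λ s → maxLoad (runAlg G (λ _ _ → true) [] s))
      ≤⟨ ∑-seqs-mono m n (λ s len → maxLoad≤ (runAlg G (λ _ _ → true) [] s) λ v → ≤-trans (load≤length (runAlg G (λ _ _ → true) [] s) v)
           (≤-reflexive (trans (length-runAlg G (λ _ _ → true) [] s) len))) ⟩
    ∑ (seqs m n) (λ _ → n)   ≡⟨ ∑-seqs-const m n n ⟩
    W * n                    ≤⟨ *-monoʳ-≤ W (<⇒≤ n<3M) ⟩
    W * (3 * M)              ≡⟨ r₁ W M ⟩
    3 * (M * W)              ≤⟨ *-monoʳ-≤ 3 MW≤2O ⟩
    3 * (2 * O)              ≡⟨ r₂ O ⟩
    6 * 1 * O                ≤⟨ *-monoˡ-≤ O (*-mono-≤ (m≤m+n 6 259) 1≤L) ⟩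
    265 * L * O              ∎)
    where
    open ≤-Reasoning
    r₁ : ∀ W M → W * (3 * M) ≡ 3 * (M * W)
    r₁ = solve-∀
    r₂ : ∀ O → 3 * (2 * O) ≡ 6 * 1 * O
    r₂ = solve-∀

  module Main (3M≤n : 3 * M ≤ n) where
    module El = Elimination G M (s≤s z≤n) 0<m O≤MW
    ordering : El.Order (λ _ → true) n
    ordering = El.order n (λ _ → true) (trans (∑-allFin-const n 1) (*-identityʳ n)) (λ _ ())
    open El.Order ordering using (ht; injective; removal)
    module Or = Orientation G M (s≤s z≤n) 0<m O≤MW ht (λ u v → injective u v refl refl) (λ v → removal v refl)

    n≤ZR : n ≤ tower R
    n≤ZR = ≤-trans (n≤2^⌈log₂n⌉ n) (^-monoʳ-≤ 2 (n≤2^⌈log₂n⌉ ⌈log₂ n ⌉))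

    module Cl = Classes M R (s≤s z≤n) 0<m 3M≤n n≤ZR Or.hd Or.tl ht

    k κ Q Y₀ p : ℕ
    k = Cl.k Or.out≤ Or.incoming≤
    κ = Cl.κ Or.out≤ Or.incoming≤
    Q = Cl.Q Or.out≤ Or.incoming≤
    Y₀ = Cl.Y₀ Or.out≤ Or.incoming≤
    -- So many hops that `2 ^ p` covers each factor `n` of the union bound, and so few that a
    -- component with at most `p` heads has greedy load at most 3+R times twice the optimum.
    p = ⌈log₂ n ⌉

    cls : Fin m → ℕ
    cls = Cl.cls Or.out≤ Or.incoming≤
    ω : ℕ → ℕ
    ω = Cl.ω Or.out≤ Or.incoming≤

    1≤Z : ∀ c → 1 ≤ tower c
    1≤Z c = ≤-trans (s≤s z≤n) (2≤Z c)

    2p<2^j : 2 * p < 2 ^ (2 + R)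
    2p<2^j = ≤-<-trans (*-monoʳ-≤ 2 (n≤2^⌈log₂n⌉ p)) (^-monoʳ-< 2 (s≤s (s≤s z≤n)) (n<1+n (suc R)))

    open Analysis G Or.dir cls k tower 1≤Z Y₀ κ 0<n (Cl.nY₀≤m Or.out≤ Or.incoming≤) (Cl.class-size Or.out≤ Or.incoming≤)
      ω Q R (Cl.Z^k*ω Or.out≤ Or.incoming≤) (Cl.cls≤R Or.out≤ Or.incoming≤) p (2 + R) 2p<2^j
    module Hp = Hops Or.hd Or.tl cls tower 1≤Z Y₀ κ 0<n (Cl.nY₀≤m Or.out≤ Or.incoming≤) (Cl.class-size Or.out≤ Or.incoming≤) ω

    τ U c : ℕ
    τ = Hp.Y * Hp.Y * Q
    U = 2 ^ (58 * M)
    c = 49 * (M * M) * 8 ^ (2 + κ)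

    hops≤ : ∀ w → U * ∑ (Hp.hops w) Hp.Hop.factor * 8 ^ (2 + κ) ≤ c * τ
    hops≤ w = ≤-trans (*-monoˡ-≤ (8 ^ (2 + κ)) (Hp.hops-bound U M Q (Cl.into≤ Or.out≤ Or.incoming≤) (Cl.out-bound Or.out≤ Or.incoming≤)
        (≤-trans (*-monoˡ-≤ (ω 0) (^-monoʳ-≤ 2 (m≤m+n (58 * M) (2 * (3 * M))))) (≤-reflexive (Cl.Z^k*ω Or.out≤ Or.incoming≤ 0 z≤n))) (s≤s z≤n) w))
      (≤-reflexive (ring (49 * (M * M)) τ (8 ^ (2 + κ))))
      where ring : ∀ a t e → a * t * e ≡ a * e * t
            ring = solve-∀

    rareness : n * ∑ (allFin n) (λ u → ∑ (seqs m n) (Φ-from u)) ≤ threshold-weight * W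
    rareness = *-cancelˡ-≤ (U ^ p) {{m^n≢0 U p {{m^n≢0 2 (58 * M)}}}} (≤-trans (rare U (c * τ) hops≤)
      (rare-constant n p c (8 ^ κ) (tower 0 ^ k) τ U W (n≤2^⌈log₂n⌉ n) (hop-constant M (s≤s z≤n)) (root-constant M (s≤s z≤n))))

    threshold-weight-pos : 0 < threshold-weight
    threshold-weight-pos = *-mono-≤ (m^n>0 2 k) (m^n>0 τ {{>-nonZero (*-mono-≤ {1} {Hp.Y * Hp.Y} (s≤s z≤n) (m^n>0 (tower R) {{>-nonZero (1≤Z R)}} k))}} p)

    goal : Goal
    goal = Algo.alg G Or.dir cls k , final-constant W R L M O _ threshold-weight _ threshold-weight-pos
      rareness MW≤2O W≤O (m≤n⊔m 1 R) 1≤L (summed opt-pos)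

  goal : Goal
  goal with 3 * M ≤? n
  ... | yes p = Main.goal p
  ... | no ¬p = few-vertices (≰⇒> ¬p)

theorem2p2 : Σ ℕ (λ C → (0 < C) × ((n : ℕ) → 3 ≤ n → (G : Graph n) →
    Σ (Algorithm G) (λ A → SumAlg G A n ≤ C * loglog n * SumOPT G n)))
theorem2p2 = 265 , s≤s z≤n , λ n 3≤n G → let A , h = Competitive.goal 3≤n G in
  A , subst₂ (λ a o → a ≤ 265 * loglog n * o) (sym (∑-sum (seqs _ n) _)) (sym (∑-sum (seqs _ n) _)) h
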